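{- Let $G$ be a finite simple graph that can be embedded on the torus and that contains no two $3$-cycles sharing a common edge. Then $G$ admits an odd $8$-coloring, i.e. $\chi_o(G)\le 8$.
   Context: An odd $k$-coloring of a graph $G$ is a proper vertex coloring $c:V(G)\to\{1,\dots,k\}$ (adjacent vertices receive different colors) such that every non-isolated vertex $v$ has some color that appears an odd number of times among the colors of the neighbors of $v$. The odd chromatic number $\chi_o(G)$ is the minimum $k$ such that $G$ has an odd $k$-coloring. Two cycles are called adjacent if they share at least one common edge; "without adjacent $3$-cycles" means no two distinct triangles of $G$ share an edge. -}

module Defs where

open import Data.Bool using (Bool; true; false; _∧_)
open import Data.Nat using (ℕ; zero; suc; _*_; _+_; _≤_; _%_)
open import Data.Fin using (Fin; _≟_)
open import Data.Fin.Properties using () 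
open import Data.List using (List; length; filterᵇ; cartesianProduct; allFin)
open import Data.List.Membership.Propositional using (_∈_)
open import Data.List.Relation.Unary.All using (All)
open import Data.List.Relation.Unary.AllPairs using (AllPairs)
open import Data.Product using (Σ; ∃; ∃-syntax; _×_; _,_; proj₁; proj₂)
open import Relation.Nullary using (¬_; does)
open import Relation.Binary.PropositionalEquality using (_≡_; _≢_)

record Graph : Set where
  field
    n     : ℕ
    adj   : Fin n → Fin n → Bool
    sym   : ∀ u v → adj u v ≡ adj v u
    irrefl : ∀ v → adj v v ≡ false
open Graph public

Adj : (G : Graph) → Fin (n G) → Fin (n G) → Set
Adj G u v = adj G u v ≡ true

nbrsWithColour : (G : Graph) {k : ℕ} → (Fin (n G) → Fin k) → Fin (n G) → Fin k → ℕ
nbrsWithColour G c v i = length (filterᵇ (λ u → adj G v u ∧ does (c u ≟ i)) (allFin (n G)))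

IsOddColoring : (G : Graph) (k : ℕ) → (Fin (n G) → Fin k) → Set
IsOddColoring G k c =
  (∀ u v → Adj G u v → c u ≢ c v) ×
  (∀ v → (∃[ u ] Adj G v u) → ∃[ i ] (nbrsWithColour G c v i % 2 ≡ 1))

HasOddColoring : Graph → ℕ → Set
HasOddColoring G k = ∃[ c ] IsOddColoring G k c

NoAdjacentTriangles : Graph → Set
NoAdjacentTriangles G = ∀ a b x y → Adj G a b →
  Adj G a x → Adj G b x → Adj G a y → Adj G b y → x ≡ y

-- Toroidality, via rotation systems (Heffter–Edmonds–Ringel)

iter : ∀ {A : Set} → (A → A) → ℕ → A → A
iter f zero    a = a
iter f (suc k) a = f (iter f k a)

Subgraph : (G H : Graph) → Set
Subgraph G H = Σ (n G ≡ n H) λ { _≡_.refl → ∀ u v → Adj G u v → Adj H u v }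

Connected : Graph → Set
Connected H = ∀ (S : Fin (n H) → Bool) (a b : Fin (n H)) → S a ≡ true → S b ≡ false →
  ∃[ u ] ∃[ v ] (S u ≡ true × S v ≡ false × Adj H u v)

-- rot v is the cyclic successor map on the neighbourhood of v
IsRotationSystem : (H : Graph) → (Fin (n H) → Fin (n H) → Fin (n H)) → Set
IsRotationSystem H rot =
  (∀ v u → Adj H v u → Adj H v (rot v u)) ×
  (∀ v u w → Adj H v u → Adj H v w → ∃[ k ] (iter (rot v) k u ≡ w))

Dart : Graph → Set
Dart H = Fin (n H) × Fin (n H)

IsDart : (H : Graph) → Dart H → Set
IsDart H (u , v) = Adj H u v

darts : (H : Graph) → List (Dart H)
darts H = filterᵇ (λ d → adj H (proj₁ d) (proj₂ d)) (cartesianProduct (allFin (n H)) (allFin (n H)))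

faceStep : (H : Graph) → (Fin (n H) → Fin (n H) → Fin (n H)) → Dart H → Dart H
faceStep H rot (u , v) = (v , rot v u)

SameFace : (H : Graph) → (Fin (n H) → Fin (n H) → Fin (n H)) → Dart H → Dart H → Set
SameFace H rot d d' = ∃[ k ] (iter (faceStep H rot) k d ≡ d')

FaceReps : (H : Graph) → (Fin (n H) → Fin (n H) → Fin (n H)) → List (Dart H) → Set
FaceReps H rot R =
  All (IsDart H) R ×
  AllPairs (λ r r' → ¬ SameFace H rot r r') R ×
  (∀ d → IsDart H d → ∃[ r ] (r ∈ R × SameFace H rot r d))

-- Connected H has a cellular embedding of genus ≤ 1:  n − m + f ≥ 0,
-- written as 2m ≤ 2n + 2f (number of darts = 2m).
ConnectedToroidal : Graph → Set
ConnectedToroidal H = ∃[ rot ] ∃[ R ]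
  (IsRotationSystem H rot × FaceReps H rot R ×
   length (darts H) ≤ 2 * (n H + length R))

-- G embeds on the torus iff it is a spanning subgraph of a connected
-- graph that embeds on the torus.
Toroidal : Graph → Set
Toroidal G = ∃[ H ] (Subgraph G H × Connected H × ConnectedToroidal H)

{-# OPTIONS --safe #-}

-- A minimal counterexample is sought in a wider class: connected toroidal graphs whose edges are either real or mere
-- constraints, without adjacent real triangles, in which only the vertices free of constraint edges need an odd colour.
-- Contracting v into a neighbour z turns the other edges at v into constraint edges at z. A colouring of the smaller
-- graph thus makes c z unique around v, and v can be coloured by avoiding the colours of its neighbours and one further
-- colour for each hard neighbour (no constraint edges, even degree). Hence degree plus number of hard neighbours is at
-- least 8 everywhere; the same argument excludes some configurations of two or three vertices. By Euler's formula the
-- charges degree - 4 of the vertices, reduced by 1 for every triangular face, have a sum of at most 0. Redistributing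
-- them, no vertex ends up negative, and the configurations in which all vertices end up with 0 are excluded.

module Submission where

open import Defs
open import Data.Bool using (Bool; true; false; _∧_; _∨_; not; _xor_; if_then_else_)
open import Data.Nat using (ℕ; zero; suc; _+_; _*_; _≤_; _<_; z≤n; s≤s; _%_)
import Data.Nat as ℕ
import Data.Nat.Properties as ℕₚ
open import Data.Nat.Tactic.RingSolver using (solve)
open import Data.Fin using (Fin; zero; suc; _≟_)
import Data.Fin as Fin
import Data.Fin.Properties as Finₚ
open import Data.List using (List; []; _∷_; length; filterᵇ; cartesianProduct; lookup; tabulate; map; _++_)
open import Data.List.Relation.Unary.Any using (index)
open import Data.List.Relation.Unary.Any.Properties using (lookup-index)
open import Data.List.Relation.Unary.All as All using (All)
open import Data.List.Relation.Unary.AllPairs as AllPairs using (AllPairs)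
open import Data.Product using (∃; _×_; _,_; proj₁; proj₂)
open import Data.Sum using (_⊎_; inj₁; inj₂)
open import Data.Empty using (⊥; ⊥-elim)
open import Relation.Nullary using (¬_; Dec; yes; no; does)
open import Relation.Nullary.Decidable using (_×-dec_; _→-dec_; ¬?; map′; decidable-stable)
open import Relation.Binary.PropositionalEquality as ≡ using (_≡_; _≢_; refl; cong; cong₂; subst; trans)
open import Function using (_∘_; case_of_)
open import Algebra.Properties.CommutativeMonoid.Sum ℕₚ.+-0-commutativeMonoid as Sum using ()

-- Deleting a vertex v is of little use: it gives no control over the colours around v itself. Edges
-- from one neighbour z to the others would make `c z` unique there, and contraction draws them on
-- the torus, but they may form adjacent triangles and disturb parities at their ends. Hence the two
-- kinds of edges. The ends of new edges are neighbours of v, whose odd colours are restored when v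
-- is coloured again, so the smaller graph may ignore them. A vertex of odd real degree has an odd
-- colour anyway, because its colour counts add up to the degree; only hard vertices cost anything,
-- and eight colours tolerate seven prohibitions. The triangle hypothesis acts through hard
-- vertices: they have real edges only, so an edge between two of them lies on at most one
-- triangular face. Charges are counted in eighteenths, which makes the third of a triangle at each
-- corner (6) and the transfers 3 and 2 integers. Euler's inequality must count just the vertices to
-- be coloured, so a disconnected graph is treated by components, and the torus of a component
-- arises by contracting everything outside it.

-- Truth values as summands

⟦_⟧ : Bool → ℕ
⟦ true ⟧  = 1
⟦ false ⟧ = 0

⟦⟧≤1 : ∀ p → ⟦ p ⟧ ≤ 1
⟦⟧≤1 true  = s≤s z≤n
⟦⟧≤1 false = z≤n

true-≤ : ∀ {p q} → (p ≡ true → q ≡ true) → ⟦ p ⟧ ≤ ⟦ q ⟧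
true-≤ {true}  {true}  h = s≤s z≤n
true-≤ {true}  {false} h = case h refl of λ ()
true-≤ {false} {q}     h = z≤n

true-≡ : ∀ {p q} → (p ≡ true → q ≡ true) → (q ≡ true → p ≡ true) → p ≡ q
true-≡ {true}  {true}  h h′ = refl
true-≡ {true}  {false} h h′ = ≡.sym (h refl)
true-≡ {false} {true}  h h′ = h′ refl
true-≡ {false} {false} h h′ = refl

false≢true : ∀ {p} {A : Set} → p ≡ false → p ≡ true → A
false≢true refl ()

¬true⇒false : ∀ {p} → ¬ (p ≡ true) → p ≡ false
¬true⇒false {true}  h = ⊥-elim (h refl)
¬true⇒false {false} h = refl

∧-intro : ∀ {p q} → p ≡ true → q ≡ true → p ∧ q ≡ true
∧-intro refl refl = refl

∧-elimˡ : ∀ {p q} → p ∧ q ≡ true → p ≡ true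
∧-elimˡ {true} h = refl

∧-elimʳ : ∀ {p q} → p ∧ q ≡ true → q ≡ true
∧-elimʳ {true} h = h

∨-introˡ : ∀ {p q} → p ≡ true → p ∨ q ≡ true
∨-introˡ refl = refl

∨-introʳ : ∀ {p q} → q ≡ true → p ∨ q ≡ true
∨-introʳ {p = true}  h = refl
∨-introʳ {p = false} h = h

∨-elim : ∀ {p q} → p ∨ q ≡ true → p ≡ true ⊎ q ≡ true
∨-elim {true}  h = inj₁ refl
∨-elim {false} h = inj₂ h

∧-elim₄ : ∀ {p q r s} → p ∧ (q ∧ (r ∧ s)) ≡ true → p ≡ true × q ≡ true × r ≡ true × s ≡ true
∧-elim₄ {true} {true} {true} {true} h = refl , refl , refl , refl

∨-elim₃ : ∀ {p q r} → p ∨ (q ∨ r) ≡ true → p ≡ true ⊎ q ≡ true ⊎ r ≡ true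
∨-elim₃ {true}         h = inj₁ refl
∨-elim₃ {false} {true} h = inj₂ (inj₁ refl)
∨-elim₃ {false} {false} h = inj₂ (inj₂ h)

not-intro : ∀ {p} → ¬ (p ≡ true) → not p ≡ true
not-intro {true}  h = ⊥-elim (h refl)
not-intro {false} h = refl

not-elim : ∀ {p} → not p ≡ true → ¬ (p ≡ true)
not-elim {true} () refl

true? : ∀ p → Dec (p ≡ true)
true? true  = yes refl
true? false = no λ ()

infix 7 _==_
_==_ : ∀ {m} → Fin m → Fin m → Bool
a == b = does (a ≟ b)

==-refl : ∀ {m} (a : Fin m) → a == a ≡ true
==-refl a with a ≟ a
... | yes _ = refl
... | no h  = ⊥-elim (h refl)

≡⇒== : ∀ {m} {a b : Fin m} → a ≡ b → a == b ≡ true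
≡⇒== {a = a} refl = ==-refl a

≢⇒== : ∀ {m} {a b : Fin m} → a ≢ b → a == b ≡ false
≢⇒== {a = a} {b} h with a ≟ b
... | yes e = ⊥-elim (h e)
... | no _  = refl

==⇒≡ : ∀ {m} {a b : Fin m} → a == b ≡ true → a ≡ b
==⇒≡ {a = a} {b} h with a ≟ b
... | yes e = e

/=⇒≢ : ∀ {m} {a b : Fin m} → not (a == b) ≡ true → a ≢ b
/=⇒≢ h e = not-elim h (≡⇒== e)

≢⇒/= : ∀ {m} {a b : Fin m} → a ≢ b → not (a == b) ≡ true
≢⇒/= h = not-intro (h ∘ ==⇒≡)

-- Finite sums

opaque
  ∑ : ∀ {m} → (Fin m → ℕ) → ℕ
  ∑ = Sum.sum

  ∑-empty : (f : Fin 0 → ℕ) → ∑ f ≡ 0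
  ∑-empty f = refl

  ∑-suc : ∀ {m} (f : Fin (suc m) → ℕ) → ∑ f ≡ f zero + ∑ (f ∘ suc)
  ∑-suc f = refl

  ∑-cong : ∀ {m} {f g : Fin m → ℕ} → (∀ i → f i ≡ g i) → ∑ f ≡ ∑ g
  ∑-cong = Sum.sum-cong-≗

  ∑-+ : ∀ {m} (f g : Fin m → ℕ) → ∑ (λ i → f i + g i) ≡ ∑ f + ∑ g
  ∑-+ = Sum.∑-distrib-+

  ∑-swap : ∀ {m k} (f : Fin m → Fin k → ℕ) → ∑ (λ i → ∑ (f i)) ≡ ∑ (λ j → ∑ λ i → f i j)
  ∑-swap = Sum.∑-comm

  ∑-*ˡ : ∀ {m} c (f : Fin m → ℕ) → ∑ (λ i → c * f i) ≡ c * ∑ f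
  ∑-*ˡ {zero}  c f = ≡.sym (ℕₚ.*-zeroʳ c)
  ∑-*ˡ {suc m} c f = trans (cong (c * f zero +_) (∑-*ˡ c (f ∘ suc)))
    (≡.sym (ℕₚ.*-distribˡ-+ c (f zero) (∑ (f ∘ suc))))

  ∑-*ʳ : ∀ {m} c (f : Fin m → ℕ) → ∑ (λ i → f i * c) ≡ ∑ f * c
  ∑-*ʳ c f = trans (∑-cong λ i → ℕₚ.*-comm (f i) c) (trans (∑-*ˡ c f) (ℕₚ.*-comm c (∑ f)))

  ∑-mono : ∀ {m} {f g : Fin m → ℕ} → (∀ i → f i ≤ g i) → ∑ f ≤ ∑ g
  ∑-mono {zero}  h = z≤n
  ∑-mono {suc m} h = ℕₚ.+-mono-≤ (h zero) (∑-mono (h ∘ suc))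

  ∑-zero : ∀ {m} {f : Fin m → ℕ} → (∀ i → f i ≡ 0) → ∑ f ≡ 0
  ∑-zero {zero}  h = refl
  ∑-zero {suc m} h = cong₂ _+_ (h zero) (∑-zero (h ∘ suc))

  ∑-point : ∀ {m} (f : Fin m → ℕ) → ∀ i → f i ≤ ∑ f
  ∑-point f zero    = ℕₚ.m≤m+n _ _
  ∑-point f (suc i) = ℕₚ.≤-trans (∑-point (f ∘ suc) i) (ℕₚ.m≤n+m _ _)

  ∑-one : ∀ {m} → ∑ {m} (λ _ → 1) ≡ m
  ∑-one {zero}  = refl
  ∑-one {suc m} = cong suc ∑-one

  ∑-δ : ∀ {m} (f : Fin m → ℕ) → ∀ a → ∑ (λ i → ⟦ i == a ⟧ * f i) ≡ f a
  ∑-δ f zero    = trans (cong (1 * f zero +_) (∑-zero {f = λ i → ⟦ suc i == zero ⟧ * f (suc i)} λ i → refl))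
    (trans (ℕₚ.+-identityʳ _) (ℕₚ.+-identityʳ _))
  ∑-δ f (suc a) = trans (∑-cong λ i → cong (λ b → ⟦ b ⟧ * f (suc i)) (lem i)) (∑-δ (f ∘ suc) a)
    where
    lem : ∀ i → suc i == suc a ≡ i == a
    lem i with i ≟ a
    ... | yes _ = refl
    ... | no _  = refl

  ∑-δ₁ : ∀ {m} (a : Fin m) → ∑ (λ i → ⟦ i == a ⟧) ≡ 1
  ∑-δ₁ a = trans (∑-cong λ i → ≡.sym (ℕₚ.*-identityʳ ⟦ i == a ⟧)) (∑-δ (λ _ → 1) a)

  ∑-gap : ∀ {m} {f g : Fin m → ℕ} → (∀ i → f i ≤ g i) → ∀ a → f a + 1 ≤ g a → ∑ f + 1 ≤ ∑ g
  ∑-gap {f = f} {g} h a ha = subst (_≤ ∑ g) (trans (∑-+ f _) (cong (∑ f +_) (∑-δ₁ a))) (∑-mono pt)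
    where
    pt : ∀ i → f i + ⟦ i == a ⟧ ≤ g i
    pt i with i ≟ a
    ... | yes refl = ha
    ... | no _     = subst (_≤ g i) (≡.sym (ℕₚ.+-identityʳ (f i))) (h i)

  ∑-gap₂ : ∀ {m} {f g : Fin m → ℕ} → (∀ i → f i ≤ g i) → ∀ a b → a ≢ b → f a + 1 ≤ g a → f b + 1 ≤ g b →
    ∑ f + 2 ≤ ∑ g
  ∑-gap₂ {f = f} {g} h a b a≢b ha hb = subst (_≤ ∑ g)
    (trans (cong (_+ 1) (trans (∑-+ f _) (cong (∑ f +_) (∑-δ₁ a)))) (ℕₚ.+-assoc (∑ f) 1 1))
    (∑-gap pt b ptb)
    where
    pt : ∀ i → f i + ⟦ i == a ⟧ ≤ g i
    pt i with i ≟ a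
    ... | yes refl = ha
    ... | no _     = subst (_≤ g i) (≡.sym (ℕₚ.+-identityʳ (f i))) (h i)
    ptb : f b + ⟦ b == a ⟧ + 1 ≤ g b
    ptb with b ≟ a
    ... | yes e = ⊥-elim (a≢b (≡.sym e))
    ... | no _  = subst (λ z → z + 1 ≤ g b) (≡.sym (ℕₚ.+-identityʳ (f b))) hb

  -- One strict inequality would by `∑-gap` order the sums strictly. This turns a total charge of
  -- zero into equality at every single vertex.
  ∑-eq : ∀ {m} {f g : Fin m → ℕ} → (∀ i → f i ≤ g i) → ∑ g ≤ ∑ f → ∀ i → f i ≡ g i
  ∑-eq {f = f} {g} h s i with ℕₚ.m≤n⇒m<n∨m≡n (h i)
  ... | inj₂ e = e
  ... | inj₁ l = ⊥-elim (ℕₚ.<-irrefl refl (ℕₚ.<-≤-trans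
    (subst (_≤ ∑ g) (ℕₚ.+-comm (∑ f) 1) (∑-gap h i (subst (_≤ g i) (ℕₚ.+-comm 1 (f i)) l))) s))

  ∑-pos : ∀ {m} (f : Fin m → ℕ) → 1 ≤ ∑ f → ∃ λ i → 1 ≤ f i
  ∑-pos {suc m} f h with f zero in e
  ... | suc x = zero , subst (1 ≤_) (≡.sym e) (s≤s z≤n)
  ... | zero  = let i , p = ∑-pos (f ∘ suc) h in suc i , p

  -- The source of free colours: `f i` counts the prohibitions of the colour i, and fewer
  -- prohibitions than colours leave one colour untouched.
  ∑-hole : ∀ {m} (f : Fin m → ℕ) → ∑ f < m → ∃ λ i → f i ≡ 0
  ∑-hole {suc m} f h with f zero in e
  ... | zero  = zero , e
  ... | suc x = let i , p = ∑-hole (f ∘ suc) (ℕₚ.≤-trans (s≤s (ℕₚ.m≤n+m _ x)) (ℕₚ.≤-pred h)) in suc i , p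

  ⟦⟧-pos : ∀ {p} → 1 ≤ ⟦ p ⟧ → p ≡ true
  ⟦⟧-pos {true} h = refl

  ∑-∃ : ∀ {m} {f : Fin m → Bool} → 1 ≤ ∑ (λ i → ⟦ f i ⟧) → ∃ λ i → f i ≡ true
  ∑-∃ {f = f} h = let i , e = ∑-pos (λ i → ⟦ f i ⟧) h in i , ⟦⟧-pos e

  ∃-∑ : ∀ {m} {f : Fin m → Bool} → ∀ i → f i ≡ true → 1 ≤ ∑ (λ i → ⟦ f i ⟧)
  ∃-∑ {f = f} i e = ℕₚ.≤-trans (subst (1 ≤_) (cong ⟦_⟧ (≡.sym e)) (s≤s z≤n)) (∑-point _ i)

δ-yes : ∀ {m} {i a : Fin m} x → i ≡ a → ⟦ i == a ⟧ * x ≡ x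
δ-yes x e rewrite ≡⇒== e = ℕₚ.+-identityʳ x

δ-no : ∀ {m} {i a : Fin m} x → i ≢ a → ⟦ i == a ⟧ * x ≡ 0
δ-no x e rewrite ≢⇒== e = refl

≤-resp₂ : ∀ {a b c d} → a ≡ b → c ≡ d → b ≤ d → a ≤ c
≤-resp₂ refl refl h = h

⟦⟧-true : ∀ {p} → p ≡ true → ⟦ p ⟧ ≡ 1
⟦⟧-true refl = refl

⟦⟧-false : ∀ {p} → ¬ (p ≡ true) → ⟦ p ⟧ ≡ 0
⟦⟧-false {true}  h = ⊥-elim (h refl)
⟦⟧-false {false} h = refl

⟦∧⟧ : ∀ p q → ⟦ p ∧ q ⟧ ≡ ⟦ p ⟧ * ⟦ q ⟧
⟦∧⟧ true  q = ≡.sym (ℕₚ.+-identityʳ ⟦ q ⟧)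
⟦∧⟧ false q = refl

-- Parity

odd : ℕ → Bool
odd zero    = false
odd (suc n) = not (odd n)

odd-+ : ∀ a b → odd (a + b) ≡ odd a xor odd b
odd-+ zero    b = refl
odd-+ (suc a) b rewrite odd-+ a b with odd a | odd b
... | true  | true  = refl
... | true  | false = refl
... | false | true  = refl
... | false | false = refl

opaque
  unfolding ∑

  odd-∑ : ∀ {m} (f : Fin m → ℕ) → odd (∑ f) ≡ true → ∃ λ i → odd (f i) ≡ true
  odd-∑ {suc m} f h with odd (f zero) in e
  ... | true  = zero , e
  ... | false = let i , p = odd-∑ (f ∘ suc) (trans (≡.sym (trans (odd-+ (f zero) _) (cong (_xor odd (∑ (f ∘ suc))) e))) h)
                in suc i , p

odd⇒%2 : ∀ a → odd a ≡ true → a % 2 ≡ 1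
odd⇒%2 (suc zero)    h = refl
odd⇒%2 (suc (suc a)) h = odd⇒%2 a (trans (≡.sym (not-not (odd a))) h)
  where
  not-not : ∀ b → not (not b) ≡ b
  not-not true  = refl
  not-not false = refl

-- Certificates for linear inequalities

-- The equation says b - a = (y - x) + k without subtraction, so k is the slack. An inequality is
-- thus proved by a combination `x≤y` of the hypotheses and an identity for the ring solver.
lin : ∀ {x y a b} → x ≤ y → ∀ k → a + y + k ≡ b + x → a ≤ b
lin {x} {y} {a} {b} x≤y k eq = ℕₚ.+-cancelʳ-≤ y a b
  (ℕₚ.≤-trans (ℕₚ.m≤m+n (a + y) k) (subst (_≤ b + y) (≡.sym eq) (ℕₚ.+-monoʳ-≤ b x≤y)))

infixl 6 _⊕_
infixl 7 _⊛_
_⊕_ : ∀ {a b c d} → a ≤ b → c ≤ d → a + c ≤ b + d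
_⊕_ = ℕₚ.+-mono-≤
_⊛_ : ∀ {a b} k → a ≤ b → k * a ≤ k * b
k ⊛ h = ℕₚ.*-monoʳ-≤ k h

-- Graphs on the torus: rotation systems whose faces are recorded by a labelling of the darts

∑∑ : ∀ {m} → (Fin m → Fin m → ℕ) → ℕ
∑∑ f = ∑ λ a → ∑ λ b → f a b

positive : ℕ → Bool
positive zero    = false
positive (suc _) = true

positive-intro : ∀ {x} → 1 ≤ x → positive x ≡ true
positive-intro (s≤s _) = refl

positive-elim : ∀ {x} → positive x ≡ true → 1 ≤ x
positive-elim {suc x} h = s≤s z≤n

module _ {N : ℕ} where

  private
    V : Set
    V = Fin N

  used : ∀ {L} → (V → V → Bool) → (V → V → Fin L) → Fin L → Bool
  used A lab l = positive (∑∑ λ a b → ⟦ A a b ∧ lab a b == l ⟧)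

  used-intro : ∀ {L} {A} {lab : V → V → Fin L} {l} a b → A a b ≡ true → lab a b ≡ l → used A lab l ≡ true
  used-intro {A = A} {lab} {l} a b h e = positive-intro
    (ℕₚ.≤-trans (∃-∑ {f = λ b → A a b ∧ lab a b == l} b (∧-intro h (≡⇒== e)))
                (∑-point (λ a → ∑ λ b → ⟦ A a b ∧ lab a b == l ⟧) a))

  used-elim : ∀ {L} {A} {lab : V → V → Fin L} {l} → used A lab l ≡ true →
    ∃ λ a → ∃ λ b → A a b ≡ true × lab a b ≡ l
  used-elim {A = A} {lab} {l} h =
    let a , p = ∑-pos (λ a → ∑ λ b → ⟦ A a b ∧ lab a b == l ⟧) (positive-elim h)
        b , q = ∑-∃ {f = λ b → A a b ∧ lab a b == l} p
    in a , b , ∧-elimˡ q , ==⇒≡ (∧-elimʳ {A a b} q)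

  -- Labels are constant along faces, but several faces may share a label. The used labels are then
  -- at most as many as the faces, so `euler` is only strengthened, and merging two faces is a mere
  -- relabelling. The vertex type stays fixed under reductions, with `al` marking what is left.
  -- Cyclicity of the rotation is phrased with closed sets: after a surgery it suffices to transport
  -- a set S.
  record Torus (al : V → Bool) (A : V → V → Bool) : Set where
    field
      A-sym   : ∀ a b → A a b ≡ true → A b a ≡ true
      A-irr   : ∀ a → ¬ (A a a ≡ true)
      A-alive : ∀ a b → A a b ≡ true → al a ≡ true
      rot     : V → V → V
      rot-A   : ∀ v u → A v u ≡ true → A v (rot v u) ≡ true
      -- the rotation at v is a single cycle
      rot-tr  : ∀ v (S : V → Bool) → (∀ u → A v u ≡ true → S u ≡ true → S (rot v u) ≡ true) →
                ∀ u w → A v u ≡ true → A v w ≡ true → S u ≡ true → S w ≡ true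
      L       : ℕ
      lab     : V → V → Fin L
      lab-φ   : ∀ a b → A a b ≡ true → lab b (rot b a) ≡ lab a b
      euler   : ∑∑ (λ a b → ⟦ A a b ⟧) ≤ 2 * (∑ (λ a → ⟦ al a ⟧) + ∑ λ l → ⟦ used A lab l ⟧)

    A-≢ : ∀ {a b} → A a b ≡ true → a ≢ b
    A-≢ h refl = A-irr _ h

    rot-fix : ∀ {v u w} → A v u ≡ true → A v w ≡ true → rot v u ≡ u → w ≡ u
    rot-fix {v} {u} {w} hu hw e = ==⇒≡ (rot-tr v (_== u)
      (λ x _ x≡u → ≡⇒== (trans (cong (rot v) (==⇒≡ x≡u)) e)) u w hu hw (==-refl u))

  Torus-resp : ∀ {al A A′} → (∀ a b → A a b ≡ A′ a b) → Torus al A → Torus al A′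
  Torus-resp {al} {A} {A′} e t = record
    { A-sym = λ a b h → to (A-sym a b (from h))
    ; A-irr = λ a h → A-irr a (from h)
    ; A-alive = λ a b h → A-alive a b (from h)
    ; rot = rot
    ; rot-A = λ v u h → to (rot-A v u (from h))
    ; rot-tr = λ v S f u w hu hw → rot-tr v S (λ x hx → f x (to hx)) u w (from hu) (from hw)
    ; L = L ; lab = lab
    ; lab-φ = λ a b h → lab-φ a b (from h)
    ; euler = subst (_≤ 2 * (∑ (λ a → ⟦ al a ⟧) + ∑ λ l → ⟦ used A′ lab l ⟧))
        (∑-cong λ a → ∑-cong λ b → cong ⟦_⟧ (e a b))
        (ℕₚ.≤-trans euler (ℕₚ.*-monoʳ-≤ 2 (ℕₚ.+-monoʳ-≤ (∑ λ a → ⟦ al a ⟧) (∑-mono λ l → true-≤ (us l)))))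
    }
    where
    open Torus t
    to : ∀ {a b} → A a b ≡ true → A′ a b ≡ true
    to {a} {b} h = trans (≡.sym (e a b)) h
    from : ∀ {a b} → A′ a b ≡ true → A a b ≡ true
    from {a} {b} h = trans (e a b) h
    us : ∀ l → used A lab l ≡ true → used A′ lab l ≡ true
    us l h = let a , b , p , q = used-elim {A = A} {lab} h in used-intro {A = A′} {lab} a b (to p) q

  -- Deleting an edge merges the faces on its two sides, so at most one face is lost.
  module _ {al A} (t : Torus al A) (a b : V) (ab : A a b ≡ true) where
    private
      open Torus t

      E : V → V → Bool
      E x y = (x == a ∧ y == b) ∨ (x == b ∧ y == a)

      a≢b : a ≢ b
      a≢b = A-≢ ab

      E-elim : ∀ {x y} → E x y ≡ true → (x ≡ a × y ≡ b) ⊎ (x ≡ b × y ≡ a)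
      E-elim {x} {y} h with ∨-elim {x == a ∧ y == b} h
      ... | inj₁ p = inj₁ (==⇒≡ (∧-elimˡ p) , ==⇒≡ (∧-elimʳ {x == a} p))
      ... | inj₂ p = inj₂ (==⇒≡ (∧-elimˡ p) , ==⇒≡ (∧-elimʳ {x == b} p))

      E-ab : E a b ≡ true
      E-ab = ∨-introˡ (∧-intro (==-refl a) (==-refl b))

      E-ba : E b a ≡ true
      E-ba = ∨-introʳ {p = b == a ∧ a == b} (∧-intro (==-refl b) (==-refl a))

      E-sym : ∀ {x y} → E x y ≡ true → E y x ≡ true
      E-sym {x} {y} h with E-elim {x} {y} h
      ... | inj₁ (refl , refl) = E-ba
      ... | inj₂ (refl , refl) = E-ab

      E-fun : ∀ {x y z} → E x y ≡ true → E x z ≡ true → y ≡ z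
      E-fun {x} {y} {z} h h′ with E-elim {x} {y} h | E-elim {x} {z} h′
      ... | inj₁ (refl , refl) | inj₁ (_ , refl) = refl
      ... | inj₁ (refl , refl) | inj₂ (e , _)    = ⊥-elim (a≢b e)
      ... | inj₂ (refl , refl) | inj₁ (e , _)    = ⊥-elim (a≢b (≡.sym e))
      ... | inj₂ (refl , refl) | inj₂ (_ , refl) = refl

    deleted : V → V → Bool
    deleted x y = A x y ∧ not (E x y)

    private
      A′ : V → V → Bool
      A′ = deleted

      A′⇒A : ∀ {x y} → A′ x y ≡ true → A x y ≡ true
      A′⇒A = ∧-elimˡ

      A′⇒¬E : ∀ {x y} → A′ x y ≡ true → ¬ (E x y ≡ true)
      A′⇒¬E {x} {y} h = not-elim (∧-elimʳ {A x y} h)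

      A′-intro : ∀ {x y} → A x y ≡ true → ¬ (E x y ≡ true) → A′ x y ≡ true
      A′-intro h h′ = ∧-intro h (not-intro h′)

      rot′ : V → V → V
      rot′ x y = if E x (rot x y) then rot x (rot x y) else rot x y

      mrg : Fin L → Fin L
      mrg l = if l == lab b a then lab a b else l

      lab′ : V → V → Fin L
      lab′ x y = mrg (lab x y)

      mrg-E : ∀ {x y} → E x y ≡ true → mrg (lab x y) ≡ lab a b
      mrg-E {x} {y} h with E-elim {x} {y} h
      ... | inj₂ (refl , refl) rewrite ==-refl (lab b a) = refl
      ... | inj₁ (refl , refl) with lab a b ≟ lab b a
      ...   | yes _ = refl
      ...   | no _  = refl

      mrg-≢ : ∀ {l} → l ≢ lab b a → mrg l ≡ l
      mrg-≢ h rewrite ≢⇒== h = refl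

      rot-A′ : ∀ x y → A′ x y ≡ true → A′ x (rot′ x y) ≡ true
      rot-A′ x y h with E x (rot x y) in eq
      ... | false = A′-intro (rot-A x y (A′⇒A h)) (λ e → false≢true eq e)
      ... | true  = A′-intro (rot-A x _ (rot-A x y (A′⇒A h)))
        -- If the second successor were deleted too, it would equal the first, which would then be
        -- fixed by the rotation; so x would have a single neighbour, and y would be the deleted
        -- one.
        (λ e → A′⇒¬E h (subst (λ z → E x z ≡ true)
          (≡.sym (rot-fix (rot-A x y (A′⇒A h)) (A′⇒A h) (E-fun {x} e eq))) eq))

      rot-tr′ : ∀ x (S : V → Bool) → (∀ u → A′ x u ≡ true → S u ≡ true → S (rot′ x u) ≡ true) →
                ∀ u w → A′ x u ≡ true → A′ x w ≡ true → S u ≡ true → S w ≡ true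
      rot-tr′ x S f u w hu hw su = trans (≡.sym (S̃-no (A′⇒¬E hw)))
        (rot-tr x S̃ step u w (A′⇒A hu) (A′⇒A hw) (trans (S̃-no (A′⇒¬E hu)) su))
        where
        -- The skipped neighbour takes the value of its successor; closedness of S under `rot′` then
        -- becomes closedness of this set under `rot`.
        S̃ : V → Bool
        S̃ y = if E x y then S (rot x y) else S y
        S̃-no : ∀ {y} → ¬ (E x y ≡ true) → S̃ y ≡ S y
        S̃-no {y} h with E x y
        ... | true  = ⊥-elim (h refl)
        ... | false = refl
        step : ∀ y → A x y ≡ true → S̃ y ≡ true → S̃ (rot x y) ≡ true
        step y hy sy with E x y in e₁ | E x (rot x y) in e₂
        ... | true  | false = sy
        ... | true  | true  = subst (λ z → S (rot x z) ≡ true) (E-fun {x} e₁ e₂) sy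
        ... | false | _ with f y (A′-intro hy (λ e → false≢true e₁ e)) sy
        step y hy sy | false | false | r rewrite e₂ = r
        step y hy sy | false | true  | r rewrite e₂ = r

      lab-φ′ : ∀ x y → A′ x y ≡ true → lab′ y (rot′ y x) ≡ lab′ x y
      lab-φ′ x y h with E y (rot y x) in eq
      ... | false = cong mrg (lab-φ x y (A′⇒A h))
      ... | true  = trans (cong mrg (lab-φ r y (A-sym y r (rot-A y x (A-sym x y (A′⇒A h))))))
        (trans (mrg-E {r} {y} (E-sym {y} {r} eq)) (trans (≡.sym (mrg-E {y} {r} eq)) (cong mrg (lab-φ x y (A′⇒A h)))))
        where
        r : V
        r = rot y x

      -- If a label sits on the deleted dart a b, it also sits on the next dart of that face. This
      -- one survives unless it is b a, and then the label is the excepted one.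
      used′ : ∀ l → l ≢ lab b a → used A lab l ≡ true → used A′ lab′ l ≡ true
      used′ l l≢ h with used-elim {A = A} {lab} h
      ... | x , y , hA , e with true? (E x y)
      ...   | no ¬e = used-intro {A = A′} {lab′} x y (A′-intro hA ¬e) (trans (mrg-≢ (λ z → l≢ (trans (≡.sym e) z))) e)
      ...   | yes exy with E-elim {x} {y} exy
      ...     | inj₂ (refl , refl) = ⊥-elim (l≢ (≡.sym e))
      ...     | inj₁ (refl , refl) = used-intro {A = A′} {lab′} b (rot b a)
                  (A′-intro (rot-A b a (A-sym a b ab))
                    (λ h′ → l≢ (trans (≡.sym e) (trans (≡.sym (lab-φ a b ab)) (cong (lab b) (E-fun {b} h′ E-ba))))))
                  (trans (cong mrg (trans (lab-φ a b ab) e)) (mrg-≢ l≢))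

      labels : ∑ (λ l → ⟦ used A lab l ⟧) ≤ ∑ (λ l → ⟦ used A′ lab′ l ⟧) + 1
      labels = subst (∑ (λ l → ⟦ used A lab l ⟧) ≤_)
        (trans (∑-+ (λ l → ⟦ used A′ lab′ l ⟧) _) (cong (∑ (λ l → ⟦ used A′ lab′ l ⟧) +_) (∑-δ₁ (lab b a))))
        (∑-mono pt)
        where
        pt : ∀ l → ⟦ used A lab l ⟧ ≤ ⟦ used A′ lab′ l ⟧ + ⟦ l == lab b a ⟧
        pt l with l ≟ lab b a
        ... | yes _ = ℕₚ.≤-trans (⟦⟧≤1 _) (ℕₚ.m≤n+m 1 _)
        ... | no h  = ℕₚ.≤-trans (true-≤ (used′ l h)) (ℕₚ.m≤m+n _ _)

    deleted-keep : ∀ {x y} → A x y ≡ true → ¬ (x ≡ a × y ≡ b) → ¬ (x ≡ b × y ≡ a) → deleted x y ≡ true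
    deleted-keep {x} {y} h h₁ h₂ = A′-intro h λ e → case E-elim {x} {y} e of λ where
      (inj₁ p) → h₁ p
      (inj₂ p) → h₂ p

    deleted-fewer : ∑∑ (λ x y → ⟦ deleted x y ⟧) + 2 ≤ ∑∑ (λ x y → ⟦ A x y ⟧)
    deleted-fewer = ∑-gap₂ (λ x → ∑-mono (le x)) a b a≢b
      (∑-gap (le a) b (gap ab E-ab)) (∑-gap (le b) a (gap (A-sym a b ab) E-ba))
      where
      le : ∀ x y → ⟦ A′ x y ⟧ ≤ ⟦ A x y ⟧
      le x y = true-≤ A′⇒A
      gap : ∀ {x y} → A x y ≡ true → E x y ≡ true → ⟦ A′ x y ⟧ + 1 ≤ ⟦ A x y ⟧
      gap {x} {y} h e rewrite h | e = s≤s z≤n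

    deleteEdge : Torus al deleted
    deleteEdge = record
      { A-sym = λ x y h → A′-intro (A-sym x y (A′⇒A h)) (A′⇒¬E h ∘ E-sym {y} {x})
      ; A-irr = λ x h → A-irr x (A′⇒A h)
      ; A-alive = λ x y h → A-alive x y (A′⇒A h)
      ; rot = rot′ ; rot-A = rot-A′ ; rot-tr = rot-tr′
      ; L = L ; lab = lab′ ; lab-φ = lab-φ′
      ; euler = eul _ _ (∑ λ x → ⟦ al x ⟧) _ _ deleted-fewer euler labels
      }
      where
      eul : ∀ d d′ n f f′ → d′ + 2 ≤ d → d ≤ 2 * (n + f) → f ≤ f′ + 1 → d′ ≤ 2 * (n + f′)
      eul d d′ n f f′ h₁ h₂ h₃ = lin (h₁ ⊕ h₂ ⊕ 2 ⊛ h₃) 0 (solve (d ∷ d′ ∷ n ∷ f ∷ f′ ∷ []))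

-- Subgraphs and edge contractions

module _ {N : ℕ} where

  private
    V : Set
    V = Fin N

  subgraphTorus : ∀ {al A} → Torus al A → (A′ : V → V → Bool) → (∀ x y → A′ x y ≡ true → A′ y x ≡ true) →
    (∀ x y → A′ x y ≡ true → A x y ≡ true) → Torus al A′
  subgraphTorus {al} {A₀} t₀ A′ A′-sym = go (∑∑ λ x y → ⟦ A₀ x y ⟧) t₀ ℕₚ.≤-refl
    where
    less : ∀ a b f → a + 2 ≤ b → b ≤ suc f → a ≤ f
    less a b f h₁ h₂ = lin (h₁ ⊕ h₂) 1 (solve (a ∷ b ∷ f ∷ []))
    go : ∀ fuel {A} → Torus al A → ∑∑ (λ x y → ⟦ A x y ⟧) ≤ fuel →
         (∀ x y → A′ x y ≡ true → A x y ≡ true) → Torus al A′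
    go fuel {A} t le sub with Finₚ.any? (λ x → Finₚ.any? (λ y → true? (A x y ∧ not (A′ x y))))
    ... | no none = Torus-resp (λ x y → true-≡ (λ h → from x y h (true? (A′ x y))) (sub x y)) t
      where
      from : ∀ x y → A x y ≡ true → Dec (A′ x y ≡ true) → A′ x y ≡ true
      from x y h (yes p) = p
      from x y h (no ¬p) = ⊥-elim (none (x , y , ∧-intro h (not-intro ¬p)))
    go zero {A} t le sub | yes (x , y , h) = case ℕₚ.≤-trans (ℕₚ.m≤n+m 2 _)
      (ℕₚ.≤-trans (deleted-fewer t x y (∧-elimˡ h)) le) of λ ()
    go (suc fuel) {A} t le sub | yes (x , y , h) = go fuel (deleteEdge t x y (∧-elimˡ h))
      (less _ _ fuel (deleted-fewer t x y (∧-elimˡ h)) le)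
      λ x′ y′ h′ → deleted-keep t x y (∧-elimˡ h) (sub x′ y′ h′)
        (λ { (refl , refl) → not-elim (∧-elimʳ {A x y} h) h′ })
        (λ { (refl , refl) → not-elim (∧-elimʳ {A x y} h) (A′-sym x′ y′ h′) })

  private
    contract-elim′ : ∀ (v z : V) (A : V → V → Bool) x y →
      not (x == v) ∧ (not (y == v) ∧ (not (x == y) ∧
        (A x y ∨ ((x == z ∧ A v y) ∨ (y == z ∧ A v x))))) ≡ true →
      x ≢ v × y ≢ v × x ≢ y × (A x y ≡ true ⊎ (x ≡ z × A v y ≡ true) ⊎ (y ≡ z × A v x ≡ true))
    contract-elim′ v z A x y h with ∧-elim₄ {not (x == v)} {not (y == v)} {not (x == y)} h
    ... | h₁ , h₂ , h₃ , h₄ with ∨-elim₃ {A x y} {x == z ∧ A v y} h₄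
    ...   | inj₁ p        = /=⇒≢ h₁ , /=⇒≢ h₂ , /=⇒≢ h₃ , inj₁ p
    ...   | inj₂ (inj₁ p) = /=⇒≢ h₁ , /=⇒≢ h₂ , /=⇒≢ h₃ , inj₂ (inj₁ (==⇒≡ (∧-elimˡ p) , ∧-elimʳ {x == z} p))
    ...   | inj₂ (inj₂ p) = /=⇒≢ h₁ , /=⇒≢ h₂ , /=⇒≢ h₃ , inj₂ (inj₂ (==⇒≡ (∧-elimˡ p) , ∧-elimʳ {y == z} p))

  opaque
    _without_ : (V → Bool) → V → V → Bool
    (al without v) x = al x ∧ not (x == v)

    ∑-without : ∀ {al} v → al v ≡ true → ∑ (λ x → ⟦ (al without v) x ⟧) + 1 ≡ ∑ (λ x → ⟦ al x ⟧)
    ∑-without {al} v h = trans (cong (∑ (λ x → ⟦ (al without v) x ⟧) +_) (≡.sym (∑-δ₁ v)))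
      (trans (≡.sym (∑-+ _ _)) (∑-cong pt))
      where
      pt : ∀ x → ⟦ al x ∧ not (x == v) ⟧ + ⟦ x == v ⟧ ≡ ⟦ al x ⟧
      pt x with x ≟ v
      ... | yes refl rewrite h = refl
      ... | no _ with al x
      ...   | true = refl
      ...   | false = refl

    without-intro : ∀ {al v x} → al x ≡ true → x ≢ v → (al without v) x ≡ true
    without-intro h ne = ∧-intro h (≢⇒/= ne)

    without-elim : ∀ {al v x} → (al without v) x ≡ true → al x ≡ true × x ≢ v
    without-elim {al} {v} {x} h = ∧-elimˡ h , /=⇒≢ (∧-elimʳ {al x} h)

    -- the edge v z is contracted into z; parallel edges are identified
    contract : V → V → (V → V → Bool) → V → V → Bool
    contract v z A x y = not (x == v) ∧ (not (y == v) ∧ (not (x == y) ∧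
      (A x y ∨ ((x == z ∧ A v y) ∨ (y == z ∧ A v x)))))

    contract-intro : ∀ {v z} {A : V → V → Bool} {x y} → x ≢ v → y ≢ v → x ≢ y → A x y ≡ true → contract v z A x y ≡ true
    contract-intro h₁ h₂ h₃ h = ∧-intro (≢⇒/= h₁) (∧-intro (≢⇒/= h₂) (∧-intro (≢⇒/= h₃) (∨-introˡ h)))

    contract-introˡ : ∀ {v z} {A : V → V → Bool} {y} → z ≢ v → y ≢ v → z ≢ y → A v y ≡ true → contract v z A z y ≡ true
    contract-introˡ {v} {z} {A} {y} h₁ h₂ h₃ h = ∧-intro (≢⇒/= h₁) (∧-intro (≢⇒/= h₂) (∧-intro (≢⇒/= h₃)
      (∨-introʳ {p = A z y} (∨-introˡ (∧-intro (==-refl z) h)))))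

    contract-introʳ : ∀ {v z} {A : V → V → Bool} {x} → x ≢ v → z ≢ v → x ≢ z → A v x ≡ true → contract v z A x z ≡ true
    contract-introʳ {v} {z} {A} {x} h₁ h₂ h₃ h = ∧-intro (≢⇒/= h₁) (∧-intro (≢⇒/= h₂) (∧-intro (≢⇒/= h₃)
      (∨-introʳ {p = A x z} (∨-introʳ {p = x == z ∧ A v z} (∧-intro (==-refl z) h)))))

    contract-elim : ∀ {v z} {A : V → V → Bool} {x y} → contract v z A x y ≡ true →
      x ≢ v × y ≢ v × x ≢ y × (A x y ≡ true ⊎ (x ≡ z × A v y ≡ true) ⊎ (y ≡ z × A v x ≡ true))
    contract-elim {v} {z} {A} {x} {y} h = contract-elim′ v z A x y h

  -- Contraction keeps all faces.  It removes one vertex and one edge, as v and z have no common neighbour.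
  module _ {al A} (t : Torus al A) (v z : V) (vz : A v z ≡ true)
           (disjoint : ∀ b → A v b ≡ true → A z b ≡ true → ⊥)
           (lone : (∀ b → A v b ≡ true → b ≡ z) → (∀ b → A z b ≡ true → b ≡ v) →
                   ∀ x y → A x y ≡ true → x ≡ v ⊎ x ≡ z) where
    private
      open Torus t

      zv : A z v ≡ true
      zv = A-sym v z vz

      v≢z : v ≢ z
      v≢z = A-≢ vz

      z≢v : z ≢ v
      z≢v = v≢z ∘ ≡.sym

      A′ : V → V → Bool
      A′ = contract v z A

      -- The merged rotation concatenates the one at v, cut open at z, with the one at z, cut open
      -- at v. Where the walk around p meets q it continues behind p in the rotation at q; if q is a
      -- leaf, it returns at once to the walk around p.
      next : V → V → V → V
      next p q w = if w == q then (if rot q p == p then rot p q else rot q p) else w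

      ren : V → V
      ren w = if w == v then z else w

      -- Inverse of `ren` on darts: an edge z y of the contraction comes from v y or from z y, and
      -- by `disjoint` not from both.
      src : V → V → V
      src x y = if x == z ∧ A v y then v else x

      rot′ : V → V → V
      rot′ x y = if x == z
        then (if A v y then next v z (rot v y) else next z v (rot z y))
        else ren (rot x (src y x))

      lab′ : V → V → Fin L
      lab′ x y = lab (src x y) (src y x)

      src-≢ : ∀ {x y} → x ≢ z → src x y ≡ x
      src-≢ h rewrite ≢⇒== h = refl

      src-z : ∀ {y} → A v y ≡ true → src z y ≡ v
      src-z h rewrite ==-refl z | h = refl

      src-z′ : ∀ {y} → A z y ≡ true → src z y ≡ z
      src-z′ {y} h rewrite ¬true⇒false (λ p → disjoint y p h) | ==-refl z = refl

      rot′-≢ : ∀ {x y} → x ≢ z → rot′ x y ≡ ren (rot x (src y x))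
      rot′-≢ h rewrite ≢⇒== h = refl

      next-≢ : ∀ {p q w} → w ≢ q → next p q w ≡ w
      next-≢ h rewrite ≢⇒== h = refl

      src-ren : ∀ {x y} → x ≢ z → A x y ≡ true → src (ren y) x ≡ y
      src-ren {x} {y} x≢z h with y ≟ v
      ... | yes refl = src-z (A-sym x y h)
      ... | no y≢v with y ≟ z
      ...   | no _ = refl
      ...   | yes refl rewrite ¬true⇒false (λ p → disjoint x p (A-sym x y h)) = refl

      A′-≢ : ∀ {x y} → x ≢ z → A′ x y ≡ true → A x (src y x) ≡ true × ren (src y x) ≡ y
      A′-≢ {x} {y} x≢z h with contract-elim {v} {z} {A} {x} {y} h
      ... | x≢v , y≢v , x≢y , inj₂ (inj₁ (e , _)) = ⊥-elim (x≢z e)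
      ... | x≢v , y≢v , x≢y , inj₂ (inj₂ (refl , vx)) rewrite src-z vx | ==-refl v = A-sym v x vx , refl
      ... | x≢v , y≢v , x≢y , inj₁ xy with y ≟ z
      ...   | no _ rewrite ≢⇒== y≢v = xy , refl
      ...   | yes refl rewrite ¬true⇒false (λ p → disjoint x p (A-sym x y xy)) | ≢⇒== y≢v = xy , refl

      A′-ren : ∀ {x y} → x ≢ v → x ≢ z → A x y ≡ true → A′ x (ren y) ≡ true
      A′-ren {x} {y} x≢v x≢z h with y ≟ v
      ... | yes refl = contract-introʳ {A = A} x≢v z≢v x≢z (A-sym x v h)
      ... | no y≢v   = contract-intro {A = A} x≢v y≢v (A-≢ h) h

      -- The ends v and z enter symmetrically; what is true of one end p facing the other end q is
      -- collected here, so that each argument is given once for both.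
      record Side (p q : V) : Set where
        field
          pq     : A p q ≡ true
          side-A : ∀ {y} → y ≢ q → A p y ≡ true → A′ z y ≡ true
          side-r : ∀ {y} → y ≢ q → A p y ≡ true → rot′ z y ≡ next p q (rot p y)
          side-l : ∀ {y} → y ≢ q → A p y ≡ true → lab′ z y ≡ lab p y
          side-l′ : ∀ {y} → y ≢ q → A p y ≡ true → lab′ y z ≡ lab y p

      side-v : Side v z
      side-v = record
        { pq = vz
        ; side-A = λ y≢z h → contract-introˡ {A = A} z≢v (λ { refl → A-irr v h }) (y≢z ∘ ≡.sym) h
        ; side-r = λ y≢z h → r h
        ; side-l = λ y≢z h → cong₂ lab (src-z h) (src-≢ y≢z)
        ; side-l′ = λ y≢z h → cong₂ lab (src-≢ y≢z) (src-z h)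
        }
        where
        r : ∀ {y} → A v y ≡ true → rot′ z y ≡ next v z (rot v y)
        r h rewrite ==-refl z | h = refl

      side-z : Side z v
      side-z = record
        { pq = zv
        ; side-A = λ y≢v h → contract-intro {A = A} z≢v y≢v (A-≢ h) h
        ; side-r = λ y≢v h → r h
        ; side-l = λ y≢v h → cong₂ lab (src-z′ h) (src-≢ (A-≢ h ∘ ≡.sym))
        ; side-l′ = λ y≢v h → cong₂ lab (src-≢ (A-≢ h ∘ ≡.sym)) (src-z′ h)
        }
        where
        r : ∀ {y} → A z y ≡ true → rot′ z y ≡ next z v (rot z y)
        r {y} h rewrite ¬true⇒false (λ p → disjoint y p h) | ==-refl z = refl

      A′-z : ∀ {y} → A′ z y ≡ true → (y ≢ z × A v y ≡ true) ⊎ (y ≢ v × A z y ≡ true)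
      A′-z {y} h with contract-elim {v} {z} {A} {z} {y} h
      ... | _ , y≢v , z≢y , inj₁ p              = inj₂ (y≢v , p)
      ... | _ , y≢v , z≢y , inj₂ (inj₁ (_ , p)) = inj₁ (z≢y ∘ ≡.sym , p)
      ... | _ , y≢v , z≢y , inj₂ (inj₂ (e , _)) = ⊥-elim (z≢y (≡.sym e))

      module _ {p q : V} (sp : Side p q) (sq : Side q p) where
        open Side
        next-q : ∀ {y} → y ≢ q → A p y ≡ true →
          A′ z (next p q q) ≡ true × lab′ z (next p q q) ≡ lab p q
        next-q {y} y≢q h rewrite ==-refl q with rot q p ≟ p
        ... | no ne = side-A sq ne (rot-A q p (pq sq)) , trans (side-l sq ne (rot-A q p (pq sq))) (lab-φ p q (pq sp))
        -- Here q is a leaf: the face runs from p to q, back to p and on to `rot p q`, so this dart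
        -- has the same label. The neighbour y keeps p from being a leaf as well.
        ... | yes e = side-A sp ne (rot-A p q (pq sp)) ,
              trans (side-l sp ne (rot-A p q (pq sp)))
                (trans (lab-φ q p (pq sq)) (trans (cong (lab q) (≡.sym e)) (lab-φ p q (pq sp))))
          where
          ne : rot p q ≢ q
          ne e′ = y≢q (rot-fix (pq sp) h e′)

        next-q′ : rot q p ≢ p → A′ z (next p q q) ≡ true × lab′ z (next p q q) ≡ lab p q
        next-q′ ne rewrite ==-refl q | ≢⇒== ne =
          side-A sq ne (rot-A q p (pq sq)) , trans (side-l sq ne (rot-A q p (pq sq))) (lab-φ p q (pq sp))

        side-rot : ∀ {y} → y ≢ q → A p y ≡ true → A′ z (rot′ z y) ≡ true × lab′ z (rot′ z y) ≡ lab′ y z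
        side-rot {y} y≢q h = by (rot p y ≟ q)
          where
          finish : ∀ {w} → rot′ z y ≡ w → A′ z w ≡ true → lab′ z w ≡ lab y p →
            A′ z (rot′ z y) ≡ true × lab′ z (rot′ z y) ≡ lab′ y z
          finish e a b = subst (λ w → A′ z w ≡ true) (≡.sym e) a ,
            trans (cong (lab′ z) e) (trans b (≡.sym (side-l′ sp y≢q h)))
          by : Dec (rot p y ≡ q) → A′ z (rot′ z y) ≡ true × lab′ z (rot′ z y) ≡ lab′ y z
          by (yes e) = finish (trans (side-r sp y≢q h) (cong (next p q) e)) (proj₁ (next-q y≢q h))
            (trans (proj₂ (next-q y≢q h)) (trans (cong (lab p) (≡.sym e)) (lab-φ y p (A-sym p y h))))
          by (no ne) = finish (trans (side-r sp y≢q h) (next-≢ {p} ne)) (side-A sp ne (rot-A p y h))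
            (trans (side-l sp ne (rot-A p y h)) (lab-φ y p (A-sym p y h)))

        module _ (S : V → Bool) (closed : ∀ u → A′ z u ≡ true → S u ≡ true → S (rot′ z u) ≡ true) where
          -- The rotation at z consists of two arcs. A closed set that meets the arc of p contains
          -- the start of the other arc; `next-reach` then fills that arc, and `next-swap` leads
          -- back to the start of the first. The second disjunct of `S̃` records that the goal has
          -- been attained, since nothing is known of the walk beyond q.
          reach-next : ∀ {y} → y ≢ q → A p y ≡ true → S y ≡ true → S (next p q q) ≡ true
          reach-next {y} y≢q h sy with ∨-elim {S (next p q q)} (rot-tr p S̃ step y q h (pq sp)
            (∨-introˡ (trans (cong S (next-≢ {p} y≢q)) sy)))
            where
            S̃ : V → Bool
            S̃ w = S (next p q w) ∨ S (next p q q)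
            step : ∀ u → A p u ≡ true → S̃ u ≡ true → S̃ (rot p u) ≡ true
            step u hu su with ∨-elim {S (next p q u)} su | u ≟ q
            ... | inj₂ r | _        = ∨-introʳ {p = S (next p q (rot p u))} r
            ... | inj₁ r | yes refl = ∨-introʳ {p = S (next p q (rot p u))} r
            ... | inj₁ r | no u≢q   = ∨-introˡ (trans (cong S (≡.sym (side-r sp u≢q hu)))
                  (closed u (side-A sp u≢q hu) (trans (cong S (≡.sym (next-≢ {p} u≢q))) r)))
          ... | inj₁ r = r
          ... | inj₂ r = r

          next-reach : S (next p q q) ≡ true → ∀ {w} → w ≢ p → A q w ≡ true → S w ≡ true
          next-reach s {w} w≢p h with ∨-elim {w == p} (rot-tr q S̃ step p w (pq sq) h (∨-introˡ (==-refl p)))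
            where
            S̃ : V → Bool
            S̃ w = w == p ∨ S w
            start : Dec (rot q p ≡ p) → S̃ (rot q p) ≡ true
            start (yes e) = ∨-introˡ (≡⇒== e)
            start (no ne) = ∨-introʳ {p = rot q p == p} (trans (cong S (≡.sym e)) s)
              where
              e : next p q q ≡ rot q p
              e rewrite ==-refl q | ≢⇒== ne = refl
            onward : ∀ u → u ≢ p → A q u ≡ true → S u ≡ true → Dec (rot q u ≡ p) → S̃ (rot q u) ≡ true
            onward u ne hu su (yes e)  = ∨-introˡ (≡⇒== e)
            onward u ne hu su (no ne′) = ∨-introʳ {p = rot q u == p}
              (trans (cong S (≡.sym (trans (side-r sq ne hu) (next-≢ {q} ne′)))) (closed u (side-A sq ne hu) su))
            step : ∀ u → A q u ≡ true → S̃ u ≡ true → S̃ (rot q u) ≡ true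
            step u hu su with ∨-elim {u == p} su | u ≟ p
            ... | _      | yes e = subst (λ x → S̃ (rot q x) ≡ true) (≡.sym e) (start (rot q p ≟ p))
            ... | inj₁ e | no ne = ⊥-elim (ne (==⇒≡ e))
            ... | inj₂ r | no ne = onward u ne hu r (rot q u ≟ p)
          ... | inj₁ e = ⊥-elim (w≢p (==⇒≡ e))
          ... | inj₂ r = r

      next-swap : ∀ {p q} (sp : Side p q) (sq : Side q p) (S : V → Bool)
        (closed : ∀ u → A′ z u ≡ true → S u ≡ true → S (rot′ z u) ≡ true) →
        ∀ {y} → y ≢ q → A p y ≡ true → S (next p q q) ≡ true → S (next q p p) ≡ true
      next-swap {p} {q} sp sq S closed {y} y≢q h s = by (rot q p ≟ p)
        where
        e₁ : rot q p ≢ p → next p q q ≡ rot q p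
        e₁ ne rewrite ==-refl q | ≢⇒== ne = refl
        e₂ : rot q p ≡ p → next p q q ≡ next q p p
        e₂ e rewrite ==-refl q | ==-refl p | ≡⇒== e |
          ≢⇒== {a = rot p q} {q} (λ z → y≢q (rot-fix (Side.pq sp) h z)) = refl
        by : Dec (rot q p ≡ p) → S (next q p p) ≡ true
        by (no ne) = reach-next sq sp S closed ne (rot-A q p (Side.pq sq)) (trans (cong S (≡.sym (e₁ ne))) s)
        by (yes e) = trans (cong S (≡.sym (e₂ e))) s

      rot-A′ : ∀ x y → A′ x y ≡ true → A′ x (rot′ x y) ≡ true
      rot-A′ x y h = by (x ≟ z)
        where
        by : Dec (x ≡ z) → A′ x (rot′ x y) ≡ true
        by (no x≢z) = subst (λ w → A′ x w ≡ true) (≡.sym (rot′-≢ x≢z))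
          (A′-ren (proj₁ (contract-elim {v} {z} {A} {x} {y} h)) x≢z (rot-A x _ (proj₁ (A′-≢ x≢z h))))
        by (yes refl) with A′-z h
        ... | inj₁ (y≢z , vy) = proj₁ (side-rot side-v side-z y≢z vy)
        ... | inj₂ (y≢v , zy) = proj₁ (side-rot side-z side-v y≢v zy)

      lab-φ′ : ∀ x y → A′ x y ≡ true → lab′ y (rot′ y x) ≡ lab′ x y
      lab-φ′ x y h = by (y ≟ z)
        where
        ce = contract-elim {v} {z} {A} {x} {y} h
        x≢v = proj₁ ce
        y≢v = proj₁ (proj₂ ce)
        x≢y = proj₁ (proj₂ (proj₂ ce))
        h′ : A′ y x ≡ true
        h′ with proj₂ (proj₂ (proj₂ ce))
        ... | inj₁ p                 = contract-intro {A = A} y≢v x≢v (x≢y ∘ ≡.sym) (A-sym x y p)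
        ... | inj₂ (inj₁ (refl , p)) = contract-introʳ {A = A} y≢v z≢v (x≢y ∘ ≡.sym) p
        ... | inj₂ (inj₂ (refl , p)) = contract-introˡ {A = A} z≢v x≢v (x≢y ∘ ≡.sym) p
        by : Dec (y ≡ z) → lab′ y (rot′ y x) ≡ lab′ x y
        by (no y≢z) = trans (cong (lab′ y) (rot′-≢ y≢z))
          (trans (cong₂ lab (src-≢ y≢z) (src-ren y≢z (rot-A y _ yx)))
            (trans (lab-φ _ y (A-sym y _ yx)) (cong (lab (src x y)) (≡.sym (src-≢ y≢z)))))
          where
          yx : A y (src x y) ≡ true
          yx = proj₁ (A′-≢ y≢z h′)
        by (yes refl) with A′-z h′
        ... | inj₁ (x≢z , vx) = proj₂ (side-rot side-v side-z x≢z vx)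
        ... | inj₂ (x≢v , zx) = proj₂ (side-rot side-z side-v x≢v zx)

      rot-tr′ : ∀ x (S : V → Bool) → (∀ u → A′ x u ≡ true → S u ≡ true → S (rot′ x u) ≡ true) →
                ∀ u w → A′ x u ≡ true → A′ x w ≡ true → S u ≡ true → S w ≡ true
      rot-tr′ x S closed u w hu hw su = by (x ≟ z)
        where
        by : Dec (x ≡ z) → S w ≡ true
        by (no x≢z) = let a , b = A′-≢ x≢z hu; c , d = A′-≢ x≢z hw in
          trans (cong S (≡.sym d)) (rot-tr x (S ∘ ren) step _ _ a c (trans (cong S b) su))
          where
          x≢v = proj₁ (contract-elim {v} {z} {A} {x} {u} hu)
          step : ∀ y → A x y ≡ true → S (ren y) ≡ true → S (ren (rot x y)) ≡ true
          step y hy sy = trans (cong S (trans (cong (ren ∘ rot x) (≡.sym (src-ren x≢z hy))) (≡.sym (rot′-≢ x≢z))))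
            (closed (ren y) (A′-ren x≢v x≢z hy) sy)
        by (yes refl) with A′-z hu | A′-z hw
        ... | inj₁ (a , b) | inj₁ (c , d) = next-reach side-z side-v S closed
              (next-swap side-v side-z S closed a b (reach-next side-v side-z S closed a b su)) c d
        ... | inj₁ (a , b) | inj₂ (c , d) = next-reach side-v side-z S closed
              (reach-next side-v side-z S closed a b su) c d
        ... | inj₂ (a , b) | inj₁ (c , d) = next-reach side-z side-v S closed
              (reach-next side-z side-v S closed a b su) c d
        ... | inj₂ (a , b) | inj₂ (c , d) = next-reach side-v side-z S closed
              (next-swap side-z side-v S closed a b (reach-next side-z side-v S closed a b su)) c d

      -- Row v is credited to row z, and in every other row column v to column z, which makes a
      -- comparison row by row possible. Row z moreover loses its entries at v and z: these are the
      -- two darts of the contracted edge.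
      fewer : ∑∑ (λ x y → ⟦ A′ x y ⟧) + 2 ≤ ∑∑ (λ x y → ⟦ A x y ⟧)
      fewer = cancel _ dv _ (subst₂ _≤_ eq₁ eq₂ (∑-mono row))
        where
        subst₂ = ≡.subst₂
        d d′ : V → ℕ
        d x = ∑ λ y → ⟦ A x y ⟧
        d′ x = ∑ λ y → ⟦ A′ x y ⟧
        dv = d v
        cancel : ∀ a b c → (a + b) + 2 ≤ c + b → a + 2 ≤ c
        cancel a b c h = lin h 0 (solve (a ∷ b ∷ c ∷ []))
        no-v : ∀ y → A′ v y ≡ false
        no-v y = ¬true⇒false λ h → proj₁ (contract-elim {v} {z} {A} {v} {y} h) refl
        no-v′ : ∀ x → A′ x v ≡ false
        no-v′ x = ¬true⇒false λ h → proj₁ (proj₂ (contract-elim {v} {z} {A} {x} {v} h)) refl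
        no-z : A′ z z ≡ false
        no-z = ¬true⇒false λ h → proj₁ (proj₂ (proj₂ (contract-elim {v} {z} {A} {z} {z} h))) refl
        le-or : ∀ y → ⟦ A′ z y ⟧ ≤ ⟦ A z y ⟧ + ⟦ A v y ⟧
        le-or y with true? (A′ z y)
        ... | no ¬p rewrite ¬true⇒false ¬p = z≤n
        ... | yes p with A′-z p
        ...   | inj₁ (_ , q) = ℕₚ.≤-trans (⟦⟧≤1 _) (subst (λ b → 1 ≤ ⟦ A z y ⟧ + ⟦ b ⟧) (≡.sym q) (ℕₚ.m≤n+m 1 _))
        ...   | inj₂ (_ , q) = ℕₚ.≤-trans (⟦⟧≤1 _) (subst (λ b → 1 ≤ ⟦ b ⟧ + ⟦ A v y ⟧) (≡.sym q) (ℕₚ.m≤m+n 1 _))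
        row-z : d′ z + 2 ≤ d z + dv
        row-z = subst (d′ z + 2 ≤_) (∑-+ (λ y → ⟦ A z y ⟧) (λ y → ⟦ A v y ⟧))
          (∑-gap₂ le-or v z v≢z at-v at-z)
          where
          at-v : ⟦ A′ z v ⟧ + 1 ≤ ⟦ A z v ⟧ + ⟦ A v v ⟧
          at-v rewrite no-v′ z | zv = s≤s z≤n
          at-z : ⟦ A′ z z ⟧ + 1 ≤ ⟦ A z z ⟧ + ⟦ A v z ⟧
          at-z rewrite no-z | vz = ℕₚ.m≤n+m 1 _
        row-≢ : ∀ x → x ≢ v → x ≢ z → d′ x ≤ d x
        row-≢ x x≢v x≢z = ℕₚ.+-cancelʳ-≤ a (d′ x) (d x) (subst₂ _≤_
          (trans (∑-+ (λ y → ⟦ A′ x y ⟧) (λ y → ⟦ y == v ⟧ * a)) (cong (d′ x +_) (∑-δ (λ _ → a) v)))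
          (trans (∑-+ (λ y → ⟦ A x y ⟧) (λ y → ⟦ y == z ⟧ * a)) (cong (d x +_) (∑-δ (λ _ → a) z)))
          (∑-mono pt))
          where
          a = ⟦ A x v ⟧
          pt : ∀ y → ⟦ A′ x y ⟧ + ⟦ y == v ⟧ * a ≤ ⟦ A x y ⟧ + ⟦ y == z ⟧ * a
          pt y = by (y ≟ v) (y ≟ z)
            where
            by : Dec (y ≡ v) → Dec (y ≡ z) → ⟦ A′ x y ⟧ + ⟦ y == v ⟧ * a ≤ ⟦ A x y ⟧ + ⟦ y == z ⟧ * a
            by (yes refl) _ = ≤-resp₂ (cong₂ _+_ (cong ⟦_⟧ (no-v′ x)) (δ-yes a (refl {x = v})))
              (cong (a +_) (δ-no a v≢z)) (ℕₚ.m≤m+n a 0)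
            by (no y≢v) (no y≢z) = ≤-resp₂ (cong (⟦ A′ x y ⟧ +_) (δ-no a y≢v)) (cong (⟦ A x y ⟧ +_) (δ-no a y≢z))
              (ℕₚ.+-monoˡ-≤ 0 (true-≤ λ h →
              case proj₂ (proj₂ (proj₂ (contract-elim {v} {z} {A} {x} {y} h))) of λ where
                (inj₁ p) → p
                (inj₂ (inj₁ (e , _))) → ⊥-elim (x≢z e)
                (inj₂ (inj₂ (e , _))) → ⊥-elim (y≢z e)))
            by (no y≢v) (yes refl) = ≤-resp₂ (cong (⟦ A′ x z ⟧ +_) (δ-no a y≢v)) (cong (⟦ A x z ⟧ +_) (δ-yes a (refl {x = z})))
              (atz (true? (A′ x z)))
              where
              atz : Dec (A′ x z ≡ true) → ⟦ A′ x z ⟧ + 0 ≤ ⟦ A x z ⟧ + a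
              atz (no ¬p) = ≤-resp₂ (cong (_+ 0) (⟦⟧-false ¬p)) refl z≤n
              atz (yes p) = ≤-resp₂ (cong (_+ 0) (⟦⟧-true p)) refl
                (case proj₂ (proj₂ (proj₂ (contract-elim {v} {z} {A} {x} {z} p))) of λ where
                  (inj₁ q) → subst (λ b → 1 ≤ ⟦ b ⟧ + a) (≡.sym q) (ℕₚ.m≤m+n 1 _)
                  (inj₂ (inj₁ (e , _))) → ⊥-elim (x≢z e)
                  (inj₂ (inj₂ (_ , q))) → subst (λ b → 1 ≤ ⟦ A x z ⟧ + ⟦ b ⟧) (≡.sym (A-sym v x q)) (ℕₚ.m≤n+m 1 _))
        row : ∀ x → (d′ x + ⟦ x == v ⟧ * dv) + ⟦ x == z ⟧ * 2 ≤ d x + ⟦ x == z ⟧ * dv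
        row x = by (x ≟ v) (x ≟ z)
          where
          by : Dec (x ≡ v) → Dec (x ≡ z) → (d′ x + ⟦ x == v ⟧ * dv) + ⟦ x == z ⟧ * 2 ≤ d x + ⟦ x == z ⟧ * dv
          by (yes refl) _ = ≤-resp₂
            (cong₂ _+_ (cong₂ _+_ (∑-zero λ y → cong ⟦_⟧ (no-v y)) (δ-yes dv (refl {x = v}))) (δ-no 2 v≢z))
            (cong (dv +_) (δ-no dv v≢z)) ℕₚ.≤-refl
          by (no x≢v) (yes refl) = ≤-resp₂
            (cong₂ _+_ (trans (cong (d′ z +_) (δ-no dv x≢v)) (ℕₚ.+-identityʳ (d′ z))) (δ-yes 2 (refl {x = z})))
            (cong (d z +_) (δ-yes dv (refl {x = z}))) row-z
          by (no x≢v) (no x≢z) = ≤-resp₂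
            (cong₂ _+_ (trans (cong (d′ x +_) (δ-no dv x≢v)) (ℕₚ.+-identityʳ (d′ x))) (δ-no 2 x≢z))
            (cong (d x +_) (δ-no dv x≢z)) (ℕₚ.+-monoˡ-≤ 0 (row-≢ x x≢v x≢z))
        eq₁ : ∑ (λ x → (d′ x + ⟦ x == v ⟧ * dv) + ⟦ x == z ⟧ * 2) ≡ (∑ d′ + dv) + 2
        eq₁ = trans (∑-+ (λ x → d′ x + ⟦ x == v ⟧ * dv) _)
          (cong₂ _+_ (trans (∑-+ d′ _) (cong (∑ d′ +_) (∑-δ (λ _ → dv) v))) (∑-δ (λ _ → 2) z))
        eq₂ : ∑ (λ x → d x + ⟦ x == z ⟧ * dv) ≡ ∑ d + dv
        eq₂ = trans (∑-+ d _) (cong (∑ d +_) (∑-δ (λ _ → dv) z))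

      -- Only the darts v z and z v disappear, and the continuation of their faces keeps the labels,
      -- provided that v and z are not both leaves.
      used′ : ¬ (rot z v ≡ v × rot v z ≡ z) → ∀ l → used A lab l ≡ true → used A′ lab′ l ≡ true
      used′ nl l h = let x , y , xy , e = used-elim {A = A} {lab} h in by x y xy e (x ≟ v) (x ≟ z) (y ≟ v) (y ≟ z)
        where
        go : ∀ x y → A′ x y ≡ true → lab′ x y ≡ l → used A′ lab′ l ≡ true
        go x y = used-intro {A = A′} {lab′} x y
        edge : ∀ {p q} (sp : Side p q) (sq : Side q p) → ¬ (rot q p ≡ p × rot p q ≡ q) →
               lab p q ≡ l → used A′ lab′ l ≡ true
        edge {p} {q} sp sq ne e with rot q p ≟ p
        ... | no ne′ = let a , b = next-q′ sp sq ne′ in go z _ a (trans b e)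
        ... | yes e′ = let a , b = next-q sp sq (λ z → ne (e′ , z)) (rot-A p q (Side.pq sp)) in go z _ a (trans b e)
        by : ∀ x y → A x y ≡ true → lab x y ≡ l → Dec (x ≡ v) → Dec (x ≡ z) → Dec (y ≡ v) → Dec (y ≡ z) →
          used A′ lab′ l ≡ true
        by x y xy e (yes refl) _ _ (yes refl) = edge side-v side-z nl e
        by x y xy e _ (yes refl) (yes refl) _ = edge side-z side-v (nl ∘ λ (a , b) → b , a) e
        by x y xy e (yes refl) _ _ (no y≢z) = go z y (Side.side-A side-v y≢z xy) (trans (Side.side-l side-v y≢z xy) e)
        by x y xy e _ (yes refl) (no y≢v) _ = go z y (Side.side-A side-z y≢v xy) (trans (Side.side-l side-z y≢v xy) e)
        by x y xy e (no x≢v) (no x≢z) (yes refl) _ = go x z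
          (contract-introʳ {A = A} x≢v z≢v x≢z (A-sym x v xy)) (trans (Side.side-l′ side-v x≢z (A-sym x v xy)) e)
        by x y xy e (no x≢v) (no x≢z) (no y≢v) (yes refl) = go x z
          (contract-intro {A = A} x≢v y≢v x≢z xy) (trans (Side.side-l′ side-z x≢v (A-sym x z xy)) e)
        by x y xy e (no x≢v) (no x≢z) (no y≢v) (no y≢z) = go x y
          (contract-intro {A = A} x≢v y≢v (A-≢ xy) xy) (trans (cong₂ lab (src-≢ x≢z) (src-≢ y≢z)) e)

      count : (∀ l → used A lab l ≡ true → used A′ lab′ l ≡ true) → ∑∑ (λ x y → ⟦ A′ x y ⟧) ≤
        2 * (∑ (λ x → ⟦ (al without v) x ⟧) + ∑ λ l → ⟦ used A′ lab′ l ⟧)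
      count h = eul _ _ _ _ _ _ fewer euler (∑-without {al} v (A-alive v z vz)) (∑-mono λ l → true-≤ (h l))
        where
        eul : ∀ d d′ n n′ f f′ → d′ + 2 ≤ d → d ≤ 2 * (n + f) → n′ + 1 ≡ n → f ≤ f′ → d′ ≤ 2 * (n′ + f′)
        eul d d′ n n′ f f′ h₁ h₂ refl h₃ = lin (h₁ ⊕ h₂ ⊕ 2 ⊛ h₃) 0 (solve (d ∷ d′ ∷ n′ ∷ f ∷ f′ ∷ []))

      euler′ : ∑∑ (λ x y → ⟦ A′ x y ⟧) ≤
        2 * (∑ (λ x → ⟦ (al without v) x ⟧) + ∑ λ l → ⟦ used A′ lab′ l ⟧)
      euler′ with rot z v ≟ v | rot v z ≟ z
      -- The contracted edge is isolated and its face is lost. By `lone` there is no other edge, so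
      -- the left side is zero.
      ... | yes e | yes e′ = ℕₚ.≤-trans (ℕₚ.≤-reflexive (∑-zero λ x → ∑-zero λ y → cong ⟦_⟧ (¬true⇒false (none x y)))) z≤n
        where
        ends : ∀ x y → A x y ≡ true → x ≡ v ⊎ x ≡ z
        ends = lone (λ b h → rot-fix vz h e′) (λ b h → rot-fix zv h e)
        none : ∀ x y → ¬ (A′ x y ≡ true)
        none x y h with contract-elim {v} {z} {A} {x} {y} h
        ... | x≢v , y≢v , x≢y , inj₂ (inj₁ (refl , p)) = x≢y (≡.sym (rot-fix vz p e′))
        ... | x≢v , y≢v , x≢y , inj₂ (inj₂ (refl , p)) = x≢y (rot-fix vz p e′)
        ... | x≢v , y≢v , x≢y , inj₁ p with ends x y p | ends y x (A-sym x y p)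
        ...   | inj₁ e₁ | _ = x≢v e₁
        ...   | inj₂ _ | inj₁ e₂ = y≢v e₂
        ...   | inj₂ e₁ | inj₂ e₂ = x≢y (trans e₁ (≡.sym e₂))
      ... | no ne | _      = count (used′ (ne ∘ proj₁))
      ... | yes _ | no ne  = count (used′ (ne ∘ proj₂))

    contractTorus : Torus (al without v) (contract v z A)
    contractTorus = record
      { A-sym = λ x y h → let x≢v , y≢v , x≢y , c = contract-elim {v} {z} {A} {x} {y} h in case c of λ where
          (inj₁ p) → contract-intro {A = A} y≢v x≢v (x≢y ∘ ≡.sym) (A-sym x y p)
          (inj₂ (inj₁ (refl , p))) → contract-introʳ {A = A} y≢v z≢v (x≢y ∘ ≡.sym) p
          (inj₂ (inj₂ (refl , p))) → contract-introˡ {A = A} z≢v x≢v (x≢y ∘ ≡.sym) p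
      ; A-irr = λ x h → proj₁ (proj₂ (proj₂ (contract-elim {v} {z} {A} {x} {x} h))) refl
      ; A-alive = λ x y h → let x≢v , y≢v , x≢y , c = contract-elim {v} {z} {A} {x} {y} h in
          without-intro (case c of λ where
            (inj₁ p) → A-alive x y p
            (inj₂ (inj₁ (refl , p))) → A-alive z v zv
            (inj₂ (inj₂ (refl , p))) → A-alive x v (A-sym v x p)) x≢v
      ; rot = rot′ ; rot-A = rot-A′ ; rot-tr = rot-tr′
      ; L = L ; lab = lab′ ; lab-φ = lab-φ′
      ; euler = euler′
      }

-- Mixed graphs: real edges R count for parity, the constraint edges F (traces of contractions) do not.

module _ {N : ℕ} where

  private
    V : Set
    V = Fin N

  Conn : (V → Bool) → (V → V → Bool) → Set
  Conn al A = ∀ (S : V → Bool) a b → al a ≡ true → al b ≡ true → S a ≡ true → S b ≡ false →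
    ∃ λ u → ∃ λ w → S u ≡ true × S w ≡ false × A u w ≡ true

  contractConn : ∀ {al A} v z → A v z ≡ true → v ≢ z → (∀ x y → A x y ≡ true → A y x ≡ true) →
    Conn al A → Conn (al without v) (contract v z A)
  contractConn {al} {A} v z vz v≢z A-sym conn S a b ha hb sa sb =
    let u , w , su , sw , h = conn S̃ a b (proj₁ a∈) (proj₁ b∈) (trans (S̃-≢ (proj₂ a∈)) sa) (trans (S̃-≢ (proj₂ b∈)) sb)
    in by u w su sw h (u ≟ v) (w ≟ v)
    where
    a∈ = without-elim {al = al} {v = v} {a} ha
    b∈ = without-elim {al = al} {v = v} {b} hb
    -- The contracted vertex is put on the same side of the cut as z.
    S̃ : V → Bool
    S̃ x = if x == v then S z else S x
    S̃-v : S̃ v ≡ S z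
    S̃-v rewrite ==-refl v = refl
    S̃-≢ : ∀ {x} → x ≢ v → S̃ x ≡ S x
    S̃-≢ h rewrite ≢⇒== h = refl
    differ : ∀ {x y} → S x ≡ true → S y ≡ false → x ≢ y
    differ p q refl = false≢true q p
    by : ∀ u w → S̃ u ≡ true → S̃ w ≡ false → A u w ≡ true → Dec (u ≡ v) → Dec (w ≡ v) →
      ∃ λ u → ∃ λ w → S u ≡ true × S w ≡ false × contract v z A u w ≡ true
    by u w su sw h (yes refl) (yes refl) = false≢true sw su
    by u w su sw h (yes refl) (no w≢) = z , w , p , q ,
      contract-introˡ {A = A} (v≢z ∘ ≡.sym) w≢ (differ p q) h
      where p = trans (≡.sym S̃-v) su
            q = trans (≡.sym (S̃-≢ w≢)) sw
    by u w su sw h (no u≢) (yes refl) = u , z , p , q ,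
      contract-introʳ {A = A} u≢ (v≢z ∘ ≡.sym) (differ p q) (A-sym u v h)
      where p = trans (≡.sym (S̃-≢ u≢)) su
            q = trans (≡.sym S̃-v) sw
    by u w su sw h (no u≢) (no w≢) = u , w , p , q , contract-intro {A = A} u≢ w≢ (differ p q) h
      where p = trans (≡.sym (S̃-≢ u≢)) su
            q = trans (≡.sym (S̃-≢ w≢)) sw

  -- Removes the two side conditions of `contractTorus`: `disjoint` by deleting one edge of every
  -- pair that would become parallel, which does not change the contraction, and `lone` because in a
  -- connected graph no vertex lies beside an isolated edge.
  contractConnTorus : ∀ {al A} → Torus al A → Conn al A → ∀ v z → A v z ≡ true →
    Torus (al without v) (contract v z A)
  contractConnTorus {al} {A} t conn v z vz = Torus-resp same (contractTorus t₁ v z vz₁ disjoint lone)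
    where
    open Torus t using (A-sym; A-irr; A-≢; A-alive)
    z≢v : z ≢ v
    z≢v = A-≢ vz ∘ ≡.sym
    -- the edges from v to the common neighbours of v and z are deleted first
    dup A₁ : V → V → Bool
    dup x y = (x == v ∧ A z y) ∨ (y == v ∧ A z x)
    A₁ x y = A x y ∧ not (dup x y)
    dup-elim : ∀ {x y} → dup x y ≡ true → (x ≡ v × A z y ≡ true) ⊎ (y ≡ v × A z x ≡ true)
    dup-elim {x} {y} h with ∨-elim {x == v ∧ A z y} h
    ... | inj₁ p = inj₁ (==⇒≡ (∧-elimˡ p) , ∧-elimʳ {x == v} p)
    ... | inj₂ p = inj₂ (==⇒≡ (∧-elimˡ p) , ∧-elimʳ {y == v} p)
    A₁⇒A : ∀ {x y} → A₁ x y ≡ true → A x y ≡ true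
    A₁⇒A = ∧-elimˡ
    A₁-intro : ∀ {x y} → A x y ≡ true → ¬ (x ≡ v × A z y ≡ true) → ¬ (y ≡ v × A z x ≡ true) → A₁ x y ≡ true
    A₁-intro {x} {y} h h₁ h₂ = ∧-intro h (not-intro λ d → case dup-elim {x} {y} d of λ where
      (inj₁ p) → h₁ p
      (inj₂ p) → h₂ p)
    A₁-sym : ∀ x y → A₁ x y ≡ true → A₁ y x ≡ true
    A₁-sym x y h = A₁-intro (A-sym x y (A₁⇒A h))
      (λ { (refl , p) → not-elim (∧-elimʳ {A x v} h) (∨-introʳ {p = x == v ∧ A z v} (∧-intro (==-refl v) p)) })
      (λ { (refl , p) → not-elim (∧-elimʳ {A v y} h) (∨-introˡ (∧-intro (==-refl v) p)) })
    t₁ : Torus al A₁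
    t₁ = subgraphTorus t A₁ A₁-sym (λ x y → A₁⇒A)
    vz₁ : A₁ v z ≡ true
    vz₁ = A₁-intro vz (A-irr z ∘ proj₂) (z≢v ∘ proj₁)
    disjoint : ∀ b → A₁ v b ≡ true → A₁ z b ≡ true → ⊥
    disjoint b p q = not-elim (∧-elimʳ {A v b} p) (∨-introˡ (∧-intro (==-refl v) (A₁⇒A q)))
    lone : (∀ b → A₁ v b ≡ true → b ≡ z) → (∀ b → A₁ z b ≡ true → b ≡ v) →
           ∀ x y → A₁ x y ≡ true → x ≡ v ⊎ x ≡ z
    lone hv hz x y h = by (x ≟ v) (x ≟ z)
      where
      onlyz : ∀ b → A z b ≡ true → b ≡ v
      onlyz b p with b ≟ v
      ... | yes e = e
      ... | no ne = hz b (A₁-intro p (z≢v ∘ proj₁) (ne ∘ proj₁))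
      onlyv : ∀ b → A v b ≡ true → b ≡ z
      onlyv b p = hv b (A₁-intro p (λ (_ , q) → A-irr v (subst (λ w → A v w ≡ true) (onlyz b q) p))
        (λ (e , _) → A-irr v (subst (λ w → A v w ≡ true) e p)))
      S : V → Bool
      S w = (w == v) ∨ (w == z)
      by : Dec (x ≡ v) → Dec (x ≡ z) → x ≡ v ⊎ x ≡ z
      by (yes e) _ = inj₁ e
      by _ (yes e) = inj₂ e
      by (no x≢v) (no x≢z) = let u , w , su , sw , uw = conn S v x (A-alive v z vz) (A-alive x y (A₁⇒A h))
                                    (∨-introˡ (==-refl v)) (cong₂ _∨_ (≢⇒== x≢v) (≢⇒== x≢z)) in
        case ∨-elim {u == v} su of λ where
          (inj₁ e) → false≢true sw (∨-introʳ {p = w == v} (≡⇒== (onlyv w (subst (λ u → A u w ≡ true) (==⇒≡ e) uw))))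
          (inj₂ e) → false≢true sw (∨-introˡ (≡⇒== (onlyz w (subst (λ u → A u w ≡ true) (==⇒≡ e) uw))))
    same : ∀ x y → contract v z A₁ x y ≡ contract v z A x y
    same x y = true-≡
      (λ h → let x≢v , y≢v , x≢y , c = contract-elim {v = v} {z} {A₁} {x} {y} h in case c of λ where
        (inj₁ p)                 → contract-intro {A = A} x≢v y≢v x≢y (A₁⇒A p)
        (inj₂ (inj₁ (refl , p))) → contract-introˡ {A = A} z≢v y≢v x≢y (A₁⇒A p)
        (inj₂ (inj₂ (refl , p))) → contract-introʳ {A = A} x≢v z≢v x≢y (A₁⇒A p))
      (λ h → let x≢v , y≢v , x≢y , c = contract-elim {v = v} {z} {A} {x} {y} h in case c of λ where
        (inj₁ p)                 → plain x≢v y≢v x≢y p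
        (inj₂ (inj₁ (refl , p))) → case true? (A z y) of λ where
          (yes q) → plain x≢v y≢v x≢y q
          (no ¬q) → contract-introˡ {A = A₁} z≢v y≢v x≢y (A₁-intro p (¬q ∘ proj₂) (y≢v ∘ proj₁))
        (inj₂ (inj₂ (refl , p))) → case true? (A z x) of λ where
          (yes q) → plain x≢v y≢v x≢y (A-sym z x q)
          (no ¬q) → contract-introʳ {A = A₁} x≢v z≢v x≢y (A₁-intro p (¬q ∘ proj₂) (x≢v ∘ proj₁)))
      where
      plain : ∀ {x y} → x ≢ v → y ≢ v → x ≢ y → A x y ≡ true → contract v z A₁ x y ≡ true
      plain x≢v y≢v x≢y p = contract-intro {A = A₁} x≢v y≢v x≢y (A₁-intro p (x≢v ∘ proj₁) (y≢v ∘ proj₁))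

-- `noadj` concerns `R` alone: contraction only removes real edges, so the condition is inherited,
-- whereas the new edges may well complete adjacent triangles.
record Mixed (N : ℕ) : Set where
  field
    alive : Fin N → Bool
    R F   : Fin N → Fin N → Bool
  A : Fin N → Fin N → Bool
  A x y = R x y ∨ F x y
  field
    R-sym : ∀ x y → R x y ≡ true → R y x ≡ true
    R≢F   : ∀ x y → R x y ≡ true → F x y ≡ true → ⊥
    noadj : ∀ a b x y → R a b ≡ true → R a x ≡ true → R b x ≡ true → R a y ≡ true → R b y ≡ true → x ≡ y
    torus : Torus alive A
    conn  : Conn alive A
  open Torus torus public using (A-sym; A-irr; A-alive; A-≢)

  R⇒A : ∀ {x y} → R x y ≡ true → A x y ≡ true
  R⇒A = ∨-introˡ

  F⇒A : ∀ {x y} → F x y ≡ true → A x y ≡ true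
  F⇒A {x} {y} = ∨-introʳ {p = R x y}

  A-elim : ∀ {x y} → A x y ≡ true → R x y ≡ true ⊎ F x y ≡ true
  A-elim {x} {y} = ∨-elim {R x y}

  rdeg sdeg deg : Fin N → ℕ
  rdeg v = ∑ λ u → ⟦ R v u ⟧
  sdeg v = ∑ λ u → ⟦ F v u ⟧
  deg v  = ∑ λ u → ⟦ A v u ⟧

  deg-split : ∀ v → deg v ≡ rdeg v + sdeg v
  deg-split v = trans (∑-cong pt) (∑-+ _ _)
    where
    pt : ∀ u → ⟦ A v u ⟧ ≡ ⟦ R v u ⟧ + ⟦ F v u ⟧
    pt u with R v u in e₁ | F v u in e₂
    ... | true  | true  = ⊥-elim (R≢F v u e₁ e₂)
    ... | true  | false = refl
    ... | false | _     = refl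

  -- the vertices that can lose their last odd colour when a neighbour is coloured
  hard : Fin N → Bool
  hard v = not (positive (sdeg v)) ∧ not (odd (rdeg v))

  hdeg : Fin N → ℕ
  hdeg v = ∑ λ u → ⟦ R v u ∧ hard u ⟧

  hard-intro : ∀ {v} → sdeg v ≡ 0 → odd (rdeg v) ≡ false → hard v ≡ true
  hard-intro e e′ rewrite e | e′ = refl

  hard-sdeg : ∀ {v} → hard v ≡ true → sdeg v ≡ 0
  hard-sdeg {v} h with sdeg v
  ... | zero = refl

  hard-even : ∀ {v} → hard v ≡ true → odd (rdeg v) ≡ false
  hard-even {v} h = ¬true⇒false (not-elim (∧-elimʳ {not (positive (sdeg v))} h))

  sdeg0 : ∀ {v} → sdeg v ≡ 0 → ∀ {u} → A v u ≡ true → R v u ≡ true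
  sdeg0 {v} e {u} h with A-elim {v} {u} h
  ... | inj₁ r = r
  ... | inj₂ f = case subst (1 ≤_) e (∃-∑ {f = F v} u f) of λ ()

  hard-R : ∀ {v} → hard v ≡ true → ∀ {u} → A v u ≡ true → R v u ≡ true
  hard-R {v} h {u} = sdeg0 {v} (hard-sdeg {v} h) {u}

  count : (Fin N → Fin 8) → Fin N → Fin 8 → ℕ
  count c v i = ∑ λ u → ⟦ R v u ∧ c u == i ⟧

  OddAt : (Fin N → Fin 8) → Fin N → Set
  OddAt c v = ∃ λ i → odd (count c v i) ≡ true

  -- Constraint edges stand for paths with a free middle vertex, so only vertices without them need an odd colour.
  Colorable : Set
  Colorable = ∃ λ c → (∀ x y → A x y ≡ true → c x ≢ c y) ×
                      (∀ v → sdeg v ≡ 0 → 1 ≤ rdeg v → OddAt c v)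

  size : ℕ
  size = ∑ λ v → ⟦ alive v ⟧

-- Contraction of mixed graphs

module _ {N : ℕ} where
  open Mixed

  opaque
    -- An edge inherited from v is absorbed if it is parallel to a real edge and becomes a
    -- constraint edge otherwise, so the two kinds stay disjoint.
    contractR contractF : Mixed N → Fin N → Fin N → Fin N → Fin N → Bool
    contractR K v z x y = not (x == v) ∧ (not (y == v) ∧ R K x y)
    contractF K v z x y = contract v z (A K) x y ∧ not (contractR K v z x y)

    contractR-intro : ∀ (K : Mixed N) v z x y → x ≢ v → y ≢ v → R K x y ≡ true → contractR K v z x y ≡ true
    contractR-intro K v z x y h₁ h₂ h = ∧-intro (≢⇒/= h₁) (∧-intro (≢⇒/= h₂) h)

    contractR-elim : ∀ (K : Mixed N) v z x y → contractR K v z x y ≡ true → x ≢ v × y ≢ v × R K x y ≡ true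
    contractR-elim K v z x y h = /=⇒≢ (∧-elimˡ h) ,
      /=⇒≢ (∧-elimˡ (∧-elimʳ {not (x == v)} h)) , ∧-elimʳ {not (y == v)} (∧-elimʳ {not (x == v)} h)

    contractF-elim : ∀ (K : Mixed N) v z x y → contractF K v z x y ≡ true →
      contract v z (A K) x y ≡ true × ¬ (contractR K v z x y ≡ true)
    contractF-elim K v z x y h = ∧-elimˡ h , not-elim (∧-elimʳ {contract v z (A K) x y} h)

    contractF-intro : ∀ (K : Mixed N) v z x y → contract v z (A K) x y ≡ true → ¬ (contractR K v z x y ≡ true) →
      contractF K v z x y ≡ true
    contractF-intro K v z x y h h′ = ∧-intro h (not-intro h′)

  contractR⇒ : ∀ (K : Mixed N) v z x y → contractR K v z x y ≡ true → contract v z (A K) x y ≡ true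
  contractR⇒ K v z x y h = let a , b , r = contractR-elim K v z x y h in
    contract-intro {A = A K} a b (A-≢ K (R⇒A K r)) (R⇒A K r)

  contractA : ∀ (K : Mixed N) v z x y →
    contract v z (A K) x y ≡ contractR K v z x y ∨ contractF K v z x y
  contractA K v z x y = true-≡
    (λ h → case true? (contractR K v z x y) of λ where
      (yes p) → ∨-introˡ p
      (no ¬p) → ∨-introʳ {p = contractR K v z x y} (contractF-intro K v z x y h ¬p))
    (λ h → case ∨-elim {contractR K v z x y} h of λ where
      (inj₁ p) → contractR⇒ K v z x y p
      (inj₂ p) → proj₁ (contractF-elim K v z x y p))

  opaque
    contractMixed : (K : Mixed N) (v z : Fin N) → A K v z ≡ true → Mixed N
    contractMixed K v z vz = record
      { alive = alive K without v
      ; R = contractR K v z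
      ; F = contractF K v z
      ; R-sym = λ x y h → let a , b , r = contractR-elim K v z x y h in contractR-intro K v z y x b a (R-sym K x y r)
      ; R≢F = λ x y r f → proj₂ (contractF-elim K v z x y f) r
      ; noadj = λ a b x y h₁ h₂ h₃ h₄ h₅ → noadj K a b x y (r a b h₁) (r a x h₂) (r b x h₃) (r a y h₄) (r b y h₅)
      ; torus = Torus-resp (contractA K v z) (contractConnTorus (torus K) (conn K) v z vz)
      ; conn = λ S a b ha hb sa sb →
          let u , w , su , sw , h = contractConn v z vz (A-≢ K vz) (A-sym K) (conn K) S a b ha hb sa sb
          in u , w , su , sw , trans (≡.sym (contractA K v z u w)) h
      }
      where
      r : ∀ x y → contractR K v z x y ≡ true → R K x y ≡ true
      r x y h = proj₂ (proj₂ (contractR-elim K v z x y h))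

    contract-size : ∀ (K : Mixed N) v z vz → size (contractMixed K v z vz) + 1 ≡ size K
    contract-size K v z vz = ∑-without {al = alive K} v (A-alive K v z vz)

    contractMixed-R : ∀ (K : Mixed N) v z vz x y → R (contractMixed K v z vz) x y ≡ contractR K v z x y
    contractMixed-R K v z vz x y = refl

    contractMixed-F : ∀ (K : Mixed N) v z vz x y → F (contractMixed K v z vz) x y ≡ contractF K v z x y
    contractMixed-F K v z vz x y = refl

    contractMixed-A : ∀ (K : Mixed N) v z vz x y → contract v z (A K) x y ≡ A (contractMixed K v z vz) x y
    contractMixed-A K v z vz x y = contractA K v z x y

-- Partial colourings

module _ {N : ℕ} where
  private
    V : Set
    V = Fin N

  opaque
    _with′_ : (V → Bool) → V → V → Bool
    (W with′ v) x = W x ∨ (x == v)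

    with-old : ∀ {W v x} → W x ≡ true → (W with′ v) x ≡ true
    with-old = ∨-introˡ

    with-new : ∀ {W v} → (W with′ v) v ≡ true
    with-new {W} {v} = ∨-introʳ {p = W v} (==-refl v)

    with-elim : ∀ {W v x} → (W with′ v) x ≡ true → W x ≡ true ⊎ x ≡ v
    with-elim {W} {v} {x} h with ∨-elim {W x} h
    ... | inj₁ p = inj₁ p
    ... | inj₂ p = inj₂ (==⇒≡ p)

  with-without : ∀ {W v x} → W x ≡ true → ((W without v) with′ v) x ≡ true
  with-without {W} {v} {x} h with x ≟ v
  ... | yes refl = with-new {W = W without v}
  ... | no ne    = with-old (without-intro h ne)

  open Mixed

  record Partial (K : Mixed N) (W : V → Bool) (c : V → Fin 8) : Set where
    field
      proper : ∀ x y → W x ≡ true → W y ≡ true → A K x y ≡ true → c x ≢ c y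
      oddly  : ∀ x → W x ≡ true → sdeg K x ≡ 0 → 1 ≤ rdeg K x → (∀ y → A K x y ≡ true → W y ≡ true) → OddAt K c x

  Unique : Mixed N → (V → Bool) → (V → Fin 8) → V → V → Set
  Unique K W c v z = ∀ b → W b ≡ true → b ≢ z → A K v b ≡ true → c z ≢ c b

  colorable-partial : ∀ {K c} → (∀ x y → A K x y ≡ true → c x ≢ c y) →
    (∀ v → sdeg K v ≡ 0 → 1 ≤ rdeg K v → OddAt K c v) → Partial K (λ _ → true) c
  colorable-partial p o = record { proper = λ x y _ _ → p x y ; oddly = λ x _ s r _ → o x s r }

  module _ (K : Mixed N) (v z : V) (vz : A K v z ≡ true) {W : V → Bool} {c : V → Fin 8}
           (P : Partial (contractMixed K v z vz) W c) where
    private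
      K′ = contractMixed K v z vz

      toA′ : ∀ {x y} → contract v z (A K) x y ≡ true → A K′ x y ≡ true
      toA′ {x} {y} = trans (≡.sym (contractMixed-A K v z vz x y))

      fromA′ : ∀ {x y} → A K′ x y ≡ true → contract v z (A K) x y ≡ true
      fromA′ {x} {y} = trans (contractMixed-A K v z vz x y)

    contract-adj : ∀ {x y} → x ≢ v → y ≢ v → A K x y ≡ true → A K′ x y ≡ true
    contract-adj {x} {y} h₁ h₂ h = toA′ {x} {y} (contract-intro {A = A K} h₁ h₂ (A-≢ K {x} {y} h) h)

    -- If the whole neighbourhood of x is coloured without v, then x is not adjacent to v; it has
    -- the same real edges in the contraction and gains no constraint edge, so its odd colour
    -- remains. At a neighbour of v nothing is claimed.
    expand : Partial K (W without v) c
    expand = record { proper = pr ; oddly = od }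
      where
      pr : ∀ x y → (W without v) x ≡ true → (W without v) y ≡ true → A K x y ≡ true → c x ≢ c y
      pr x y hx hy h = let wx , x≢v = without-elim {x = x} hx; wy , y≢v = without-elim {x = y} hy in
        Partial.proper P x y wx wy (contract-adj {x} {y} x≢v y≢v h)
      od : ∀ x → (W without v) x ≡ true → sdeg K x ≡ 0 → 1 ≤ rdeg K x →
           (∀ y → A K x y ≡ true → (W without v) y ≡ true) → OddAt K c x
      od x hx s r nb = let i , o = Partial.oddly P x wx (∑-zero λ y → ⟦⟧-false (noF y))
                             (subst (1 ≤_) (∑-cong λ y → cong ⟦_⟧ (sameR y)) r)
                             (λ y h → proj₁ (without-elim {x = y} (nb y (fromA y h))))
                       in i , trans (cong odd (∑-cong λ y → cong (λ b → ⟦ b ∧ c y == i ⟧) (sameR y))) o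
        where
        wx = proj₁ (without-elim {x = x} hx)
        x≢v = proj₂ (without-elim {x = x} hx)
        y≢v : ∀ y → A K x y ≡ true → y ≢ v
        y≢v y h = proj₂ (without-elim {x = y} (nb y h))
        fromA : ∀ y → A K′ x y ≡ true → A K x y ≡ true
        fromA y h = case proj₂ (proj₂ (proj₂ (contract-elim {v = v} {z} {A K} {x} {y} (fromA′ {x} {y} h)))) of λ where
          (inj₁ p)                 → p
          (inj₂ (inj₁ (refl , _))) → ⊥-elim (y≢v v (A-sym K v z vz) refl)
          (inj₂ (inj₂ (_ , p)))    → ⊥-elim (y≢v v (A-sym K v x p) refl)
        sameR : ∀ y → R K x y ≡ R K′ x y
        sameR y = trans (true-≡ (λ h → contractR-intro K v z x y x≢v (y≢v y (R⇒A K {x} {y} h)) h)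
                                (λ h → proj₂ (proj₂ (contractR-elim K v z x y h))))
                        (≡.sym (contractMixed-R K v z vz x y))
        noF : ∀ y → ¬ (F K′ x y ≡ true)
        noF y h = proj₂ (contractF-elim K v z x y (trans (≡.sym (contractMixed-F K v z vz x y)) h))
          (trans (≡.sym (contractMixed-R K v z vz x y))
            (trans (≡.sym (sameR y)) (sdeg0 K {x} s {y} (fromA y (F⇒A K′ {x} {y} h)))))

    expand-unique : W z ≡ true → Unique K (W without v) c v z
    expand-unique wz b hb b≢z h = let wb , b≢v = without-elim {x = b} hb in
      Partial.proper P z b wz wb (toA′ {z} {b} (contract-introˡ {A = A K} (A-≢ K vz ∘ ≡.sym) b≢v (b≢z ∘ ≡.sym) h))

  -- In contrast to `Partial`, the vertex x may itself be uncoloured, since its odd colour depends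
  -- on the neighbours alone; and only hard vertices are watched, since odd real degree suffices
  -- once everything is coloured.
  record Good (K : Mixed N) (W : V → Bool) (c : V → Fin 8) : Set where
    field
      proper : ∀ x y → W x ≡ true → W y ≡ true → A K x y ≡ true → c x ≢ c y
      oddly  : ∀ x → hard K x ≡ true → 1 ≤ rdeg K x → (∀ y → A K x y ≡ true → W y ≡ true) → OddAt K c x

  partial-good : ∀ {K W c} → Partial K W c →
    (∀ x → W x ≡ false → hard K x ≡ true → 1 ≤ rdeg K x → (∀ y → A K x y ≡ true → W y ≡ true) → OddAt K c x) → Good K W c
  partial-good {K} {W} P o = record
    { proper = Partial.proper P
    ; oddly = λ x h r nb → case true? (W x) of λ where
        (yes w) → Partial.oddly P x w (hard-sdeg K {x} h) r nb
        (no ¬w) → o x (¬true⇒false ¬w) h r nb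
    }

  ∑-count : ∀ (f : V → Bool) (c : V → Fin 8) → ∑ (λ i → ∑ λ u → ⟦ f u ∧ c u == i ⟧) ≡ ∑ λ u → ⟦ f u ⟧
  ∑-count f c = trans (∑-swap λ i u → ⟦ f u ∧ c u == i ⟧) (∑-cong λ u →
    trans (∑-cong λ i → trans (⟦∧⟧ (f u) (c u == i)) (trans (ℕₚ.*-comm ⟦ f u ⟧ _)
      (cong (λ b → ⟦ b ⟧ * ⟦ f u ⟧) (true-≡ {c u == i} {i == c u} (λ e → ≡⇒== (≡.sym (==⇒≡ {a = c u} e))) (λ e → ≡⇒== (≡.sym (==⇒≡ {a = i} e)))))))
    (∑-δ (λ _ → ⟦ f u ⟧) (c u)))

  good-colorable : ∀ {K W c} → Good K W c → (∀ x → W x ≡ true) → Colorable K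
  good-colorable {K} {W} {c} G all = c , (λ x y → Good.proper G x y (all x) (all y)) , odds
    where
    odds : ∀ v → sdeg K v ≡ 0 → 1 ≤ rdeg K v → OddAt K c v
    odds v s r with odd (rdeg K v) in e
    ... | true  = odd-∑ (count K c v) (trans (cong odd (∑-count (R K v) c)) e)
    ... | false = Good.oddly G v (hard-intro K {v} s e) r (λ y _ → all y)

  opaque
    recolour : (V → Fin 8) → V → Fin 8 → V → Fin 8
    recolour c v i u = if u == v then i else c u

    recolour-≢ : ∀ {c v i u} → u ≢ v → recolour c v i u ≡ c u
    recolour-≢ h rewrite ≢⇒== h = refl

    recolour-≡ : ∀ {c} v {i} → recolour c v i v ≡ i
    recolour-≡ v rewrite ==-refl v = refl

  unique-odd : ∀ K {c : V → Fin 8} {u z} → R K u z ≡ true → (∀ b → R K u b ≡ true → b ≢ z → c z ≢ c b) → OddAt K c u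
  unique-odd K {c} {u} {z} uz uniq = c z , cong odd (trans (∑-cong pt) (∑-δ₁ z))
    where
    pt : ∀ b → ⟦ R K u b ∧ c b == c z ⟧ ≡ ⟦ b == z ⟧
    pt b = cong ⟦_⟧ (true-≡ (λ h → by h (b ≟ z)) λ h → back (==⇒≡ {a = b} h))
      where
      by : R K u b ∧ c b == c z ≡ true → Dec (b ≡ z) → b == z ≡ true
      by h (yes e) = ≡⇒== e
      by h (no ne) = ⊥-elim (uniq b (∧-elimˡ h) ne (≡.sym (==⇒≡ (∧-elimʳ {R K u b} h))))
      back : b ≡ z → R K u b ∧ c b == c z ≡ true
      back refl = ∧-intro uz (==-refl (c z))

  module Extend (K : Mixed N) {W : V → Bool} {c : V → Fin 8} (G : Good K W c) (v : V) (v∉W : W v ≡ false) where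
    private
      others : V → Fin 8 → ℕ
      others u j = ∑ λ w → ⟦ (R K u w ∧ not (w == v)) ∧ c w == j ⟧

      -- the colour at v must avoid `oddColour u` for u to keep an odd colour
      oddColour′ : ∀ u → ∃ λ j → R K u v ≡ true → hard K u ≡ true → odd (others u j) ≡ true
      oddColour′ u with true? (R K u v) | true? (hard K u)
      ... | no ¬r | _     = zero , λ r → ⊥-elim (¬r r)
      ... | yes _ | no ¬h = zero , λ _ h → ⊥-elim (¬h h)
      -- A hard u has even real degree, so without v an odd number of real neighbours remains, and
      -- some colour occurs an odd number of times among them.
      ... | yes r | yes h = let j , o = odd-∑ (others u) (trans (cong odd (∑-count (λ w → R K u w ∧ not (w == v)) c)) odd-rest)
                            in j , λ _ _ → o
        where
        sum : ∑ (λ w → ⟦ R K u w ∧ not (w == v) ⟧) + 1 ≡ rdeg K u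
        sum = trans (cong (∑ (λ w → ⟦ R K u w ∧ not (w == v) ⟧) +_) (≡.sym (∑-δ₁ v)))
          (trans (≡.sym (∑-+ _ _)) (∑-cong pt))
          where
          pt : ∀ w → ⟦ R K u w ∧ not (w == v) ⟧ + ⟦ w == v ⟧ ≡ ⟦ R K u w ⟧
          pt w with w ≟ v
          ... | yes refl rewrite r = refl
          ... | no _ with R K u w
          ...   | true = refl
          ...   | false = refl
        odd-rest : odd (∑ λ w → ⟦ R K u w ∧ not (w == v) ⟧) ≡ true
        odd-rest with odd (∑ λ w → ⟦ R K u w ∧ not (w == v) ⟧) in e
        ... | true = refl
        ... | false = ⊥-elim (false≢true (hard-even K {u} h) (trans (cong odd (trans (≡.sym sum) (ℕₚ.+-comm _ 1))) (cong not e)))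

      oddColour : V → Fin 8
      oddColour u = proj₁ (oddColour′ u)

      count-recolour : ∀ i u j → count K (recolour c v i) u j ≡ others u j + ⟦ R K u v ∧ i == j ⟧
      count-recolour i u j = trans (∑-cong pt) (trans (∑-+ _ _) (cong (others u j +_) (∑-δ (λ _ → ⟦ R K u v ∧ i == j ⟧) v)))
        where
        pt : ∀ w → ⟦ R K u w ∧ recolour c v i w == j ⟧ ≡
                   ⟦ (R K u w ∧ not (w == v)) ∧ c w == j ⟧ + ⟦ w == v ⟧ * ⟦ R K u v ∧ i == j ⟧
        pt w = by (w ≟ v)
          where
          by : Dec (w ≡ v) → ⟦ R K u w ∧ recolour c v i w == j ⟧ ≡
                   ⟦ (R K u w ∧ not (w == v)) ∧ c w == j ⟧ + ⟦ w == v ⟧ * ⟦ R K u v ∧ i == j ⟧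
          by (yes refl) = trans (cong (λ k → ⟦ R K u w ∧ k == j ⟧) (recolour-≡ w)) (≡.sym (cong₂ _+_
            (⟦⟧-false λ h → not-elim (∧-elimʳ {R K u w} (∧-elimˡ h)) (==-refl w)) (δ-yes _ (refl {x = w}))))
          by (no ne) = trans (cong (λ k → ⟦ R K u w ∧ k == j ⟧) (recolour-≢ ne)) (≡.sym (trans (cong₂ _+_
            (cong (λ b → ⟦ b ∧ c w == j ⟧) (true-≡ {R K u w ∧ not (w == v)} ∧-elimˡ λ h → ∧-intro h (≢⇒/= ne)))
            (δ-no _ ne)) (ℕₚ.+-identityʳ _)))

    -- The colour of v avoids the colours of P, one odd colour for each vertex of Q, and the support of X.
    extend : (P Q : V → Bool) (X : Fin 8 → ℕ) →
      (∀ w → W w ≡ true → A K v w ≡ true → ∃ λ w′ → P w′ ≡ true × c w′ ≡ c w) →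
      (∀ u → R K v u ≡ true → hard K u ≡ true → Q u ≡ false → (∀ y → A K u y ≡ true → y ≢ v → W y ≡ true) →
         ∀ i → (∀ w → W w ≡ true → A K v w ≡ true → c w ≢ i) → OddAt K (recolour c v i) u) →
      ∑ (λ u → ⟦ P u ⟧) + ∑ (λ u → ⟦ Q u ⟧) + ∑ X ≤ 7 →
      ∃ λ i → Good K (W with′ v) (recolour c v i) × X i ≡ 0
    extend P Q X cover exempt bound = i , record { proper = pr ; oddly = od } , ℕₚ.m+n≡0⇒n≡0 (pCount i + qCount i) i-free
      where
      pCount qCount forbidden : Fin 8 → ℕ
      pCount i = ∑ λ u → ⟦ P u ∧ c u == i ⟧
      qCount i = ∑ λ u → ⟦ Q u ∧ oddColour u == i ⟧
      forbidden i = pCount i + qCount i + X i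
      total : ∑ forbidden ≡ ∑ (λ u → ⟦ P u ⟧) + ∑ (λ u → ⟦ Q u ⟧) + ∑ X
      total = trans (∑-+ (λ i → pCount i + qCount i) X)
        (cong (_+ ∑ X) (trans (∑-+ pCount qCount)
          (cong₂ _+_ (∑-count P c) (∑-count Q oddColour))))
      free = ∑-hole forbidden (s≤s (subst (_≤ 7) (≡.sym total) bound))
      i : Fin 8
      i = proj₁ free
      i-free : forbidden i ≡ 0
      i-free = proj₂ free
      none : ∀ {f : V → Bool} → ∑ (λ u → ⟦ f u ⟧) ≡ 0 → ∀ u → ¬ (f u ≡ true)
      none {f} e u h = case subst (1 ≤_) e (∃-∑ {f = f} u h) of λ ()
      P-free : ∀ u → P u ≡ true → c u ≢ i
      P-free u p e = none {λ u → P u ∧ c u == i} (ℕₚ.m+n≡0⇒m≡0 (pCount i) (ℕₚ.m+n≡0⇒m≡0 (pCount i + qCount i) i-free)) u (∧-intro p (≡⇒== e))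
      Q-free : ∀ u → Q u ≡ true → oddColour u ≢ i
      Q-free u q e = none {λ u → Q u ∧ oddColour u == i} (ℕₚ.m+n≡0⇒n≡0 (pCount i) (ℕₚ.m+n≡0⇒m≡0 (pCount i + qCount i) i-free)) u (∧-intro q (≡⇒== e))
      W-free : ∀ w → W w ≡ true → A K v w ≡ true → c w ≢ i
      W-free w hw h e = let w′ , p , e′ = cover w hw h in P-free w′ p (trans e′ e)
      c′ = recolour c v i
      c′-W : ∀ x → W x ≡ true → c′ x ≡ c x
      c′-W x wx = recolour-≢ (λ { refl → false≢true v∉W wx })
      pr : ∀ x y → (W with′ v) x ≡ true → (W with′ v) y ≡ true → A K x y ≡ true → c′ x ≢ c′ y
      pr x y hx hy h with with-elim {x = x} hx | with-elim {x = y} hy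
      ... | inj₁ wx   | inj₁ wy   = λ e → Good.proper G x y wx wy h (trans (≡.sym (c′-W x wx)) (trans e (c′-W y wy)))
      ... | inj₂ refl | inj₂ refl = ⊥-elim (A-irr K x h)
      ... | inj₁ wx   | inj₂ refl = λ e → W-free x wx (A-sym K x v h) (trans (≡.sym (c′-W x wx)) (trans e (recolour-≡ v)))
      ... | inj₂ refl | inj₁ wy   = λ e → W-free y wy h (trans (≡.sym (c′-W y wy)) (trans (≡.sym e) (recolour-≡ v)))
      od : ∀ x → hard K x ≡ true → 1 ≤ rdeg K x → (∀ y → A K x y ≡ true → (W with′ v) y ≡ true) → OddAt K c′ x
      od x hx r nb with true? (A K x v)
      ... | no ¬xv = let j , o = Good.oddly G x hx r nb′ in
              j , trans (cong odd (∑-cong λ y → cong ⟦_⟧ (same j y (true? (R K x y))))) o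
        where
        y≢v : ∀ y → A K x y ≡ true → y ≢ v
        y≢v y h refl = ¬xv h
        nb′ : ∀ y → A K x y ≡ true → W y ≡ true
        nb′ y h with with-elim {x = y} (nb y h)
        ... | inj₁ w = w
        ... | inj₂ e = ⊥-elim (y≢v y h e)
        same : ∀ j y → Dec (R K x y ≡ true) → (R K x y ∧ c′ y == j) ≡ (R K x y ∧ c y == j)
        same j y (no ¬r) rewrite ¬true⇒false ¬r = refl
        same j y (yes r) = cong (λ k → R K x y ∧ k == j) (recolour-≢ (y≢v y (R⇒A K {x} {y} r)))
      ... | yes xv with true? (Q x)
      ...   | yes q = oddColour x , trans (cong odd (trans (count-recolour i x (oddColour x))
                (trans (cong (others x (oddColour x) +_) (⟦⟧-false λ h → Q-free x q (≡.sym (==⇒≡ (∧-elimʳ {R K x v} h)))))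
                  (ℕₚ.+-identityʳ _)))) (proj₂ (oddColour′ x) (hard-R K {x} hx {v} xv) hx)
      ...   | no ¬q = exempt x (R-sym K x v (hard-R K {x} hx {v} xv)) hx (¬true⇒false ¬q)
                (λ y h y≢v → case with-elim {x = y} (nb y h) of λ where
                  (inj₁ w) → w
                  (inj₂ e) → ⊥-elim (y≢v e)) i W-free

    -- As v avoids c z, it cannot spoil the colour c z at u.
    unique-exempt : ∀ {u z} → R K u z ≡ true → W z ≡ true → A K v z ≡ true →
      (∀ b → R K u b ≡ true → b ≢ v → b ≢ z → c z ≢ c b) →
      ∀ i → (∀ w → W w ≡ true → A K v w ≡ true → c w ≢ i) → OddAt K (recolour c v i) u
    unique-exempt {u} {z} uz wz vz uniq i avoid = unique-odd K uz λ b ub b≢z → by b ub b≢z (b ≟ v)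
      where
      z≢v : z ≢ v
      z≢v refl = A-irr K z vz
      by : ∀ b → R K u b ≡ true → b ≢ z → Dec (b ≡ v) → recolour c v i z ≢ recolour c v i b
      by b ub b≢z (yes refl) e = avoid z wz vz (trans (≡.sym (recolour-≢ z≢v)) (trans e (recolour-≡ v)))
      by b ub b≢z (no b≢v) e = uniq b ub b≢v b≢z (trans (≡.sym (recolour-≢ z≢v)) (trans e (recolour-≢ b≢v)))

-- Reducible configurations

module _ {N : ℕ} where
  private
    V : Set
    V = Fin N

  without-self : ∀ {al : V → Bool} {v} → (al without v) v ≡ false
  without-self {v = v} = ¬true⇒false λ h → proj₂ (without-elim {x = v} h) refl

  without-false : ∀ {al : V → Bool} {v x} → (al without v) x ≡ false → al x ≡ false ⊎ x ≡ v
  without-false {v = v} {x} h = case x ≟ v of λ where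
    (yes e) → inj₂ e
    (no ne) → inj₁ (¬true⇒false λ p → false≢true h (without-intro p ne))

  with-false : ∀ {W : V → Bool} {v x} → W x ≡ false → x ≢ v → (W with′ v) x ≡ false
  with-false {v = v} {x} h ne = ¬true⇒false λ p → case with-elim {x = x} p of λ where
    (inj₁ w) → false≢true h w
    (inj₂ e) → ne e

  drop-one : ∀ {f : V → Bool} a → f a ≡ true → ∑ (λ w → ⟦ f w ∧ not (w == a) ⟧) + 1 ≤ ∑ (λ w → ⟦ f w ⟧)
  drop-one {f} a fa = ∑-gap (λ w → true-≤ ∧-elimˡ) a
    (≤-resp₂ (cong (_+ 1) (⟦⟧-false λ h → not-elim (∧-elimʳ {f a} h) (==-refl a))) (⟦⟧-true fa) ℕₚ.≤-refl)

  drop-two : ∀ {f : V → Bool} a b → f a ≡ true → f b ≡ true → a ≢ b →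
    ∑ (λ w → ⟦ (f w ∧ not (w == a)) ∧ not (w == b) ⟧) + 2 ≤ ∑ (λ w → ⟦ f w ⟧)
  drop-two {f} a b fa fb a≢b = two _ _ _
    (drop-one {λ w → f w ∧ not (w == a)} b (∧-intro fb (≢⇒/= (a≢b ∘ ≡.sym)))) (drop-one {f} a fa)
    where
    two : ∀ x y z → x + 1 ≤ y → y + 1 ≤ z → x + 2 ≤ z
    two x y z h₁ h₂ = lin (h₁ ⊕ h₂) 0 (solve (x ∷ y ∷ z ∷ []))

  drop-≤ : ∀ {f : V → Bool} a → ∑ (λ w → ⟦ f w ∧ not (w == a) ⟧) ≤ ∑ (λ w → ⟦ f w ⟧)
  drop-≤ a = ∑-mono λ w → true-≤ ∧-elimˡ

  ∑-all-but : ∀ {f : V → Bool} a → ∑ (λ w → ⟦ f w ⟧) ≤ ∑ (λ w → ⟦ f w ∧ not (w == a) ⟧) + 1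
  ∑-all-but {f} a = ≤-resp₂ refl (≡.sym (trans (∑-+ _ _) (cong (∑ (λ w → ⟦ f w ∧ not (w == a) ⟧) +_) (∑-δ₁ a))))
    (∑-mono λ w → pt (f w) (w == a))
    where
    pt : ∀ p q → ⟦ p ⟧ ≤ ⟦ p ∧ not q ⟧ + ⟦ q ⟧
    pt true  true  = s≤s z≤n
    pt true  false = s≤s z≤n
    pt false _     = z≤n

  avoid-one : ∀ {f : V → Bool} a → 2 ≤ ∑ (λ w → ⟦ f w ⟧) → ∃ λ w → f w ≡ true × w ≢ a
  avoid-one {f} a h = let w , p = ∑-∃ {f = λ w → f w ∧ not (w == a)} (ℕₚ.≤-pred
                            (subst (2 ≤_) (ℕₚ.+-comm _ 1) (ℕₚ.≤-trans h (∑-all-but {f} a))))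
                      in w , ∧-elimˡ p , /=⇒≢ (∧-elimʳ {f w} p)

  avoid-two : ∀ {f : V → Bool} a b → 3 ≤ ∑ (λ w → ⟦ f w ⟧) → ∃ λ w → f w ≡ true × w ≢ a × w ≢ b
  avoid-two {f} a b h = let w , p , w≢b = avoid-one {λ w → f w ∧ not (w == a)} b (ℕₚ.≤-pred
                              (subst (3 ≤_) (ℕₚ.+-comm _ 1) (ℕₚ.≤-trans h (∑-all-but {f} a))))
                        in w , ∧-elimˡ p , /=⇒≢ (∧-elimʳ {f w} p) , w≢b

  -- At least two candidates remain beside v, and their colours differ, so not both are i.
  other-colour : ∀ {f : V → Bool} {c : V → Fin 8} v i → 3 ≤ ∑ (λ w → ⟦ f w ⟧) →
    (∀ a b → f a ≡ true → f b ≡ true → a ≢ v → b ≢ v → a ≢ b → c a ≢ c b) →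
    ∃ λ z → f z ≡ true × z ≢ v × c z ≢ i
  other-colour {f} {c} v i h distinct with avoid-one {f} v (ℕₚ.≤-trans (ℕₚ.n≤1+n 2) h)
  ... | a , fa , a≢v with c a ≟ i
  ...   | no ne    = a , fa , a≢v , ne
  ...   | yes refl = let b , fb , b≢v , b≢a = avoid-two {f} v a h in b , fb , b≢v , distinct b a fb fa b≢v a≢v b≢a

  open Mixed

  module Reduce (K : Mixed N) (ih : ∀ (K′ : Mixed N) → size K′ < size K → Colorable K′) where
    private
      everything : V → Bool
      everything _ = true

      smaller : ∀ {K₁ : Mixed N} v z vz → size K₁ ≤ size K → size (contractMixed K₁ v z vz) < size K
      smaller {K₁} v z vz h = ℕₚ.≤-trans (ℕₚ.≤-reflexive (trans (ℕₚ.+-comm 1 _) (contract-size K₁ v z vz))) h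

      not-both : ∀ (f g : V → Bool) {u a} → f u ≡ true → g u ≡ true → (f u ∧ g u) ∧ not (u == a) ≡ false → u ≡ a
      not-both f g {u} {a} fu gu h = case u ≟ a of λ where
        (yes e) → e
        (no ne) → false≢true h (∧-intro (∧-intro fu gu) (≢⇒/= ne))

      no-extra : Fin 8 → ℕ
      no-extra _ = 0

      no-extra-sum : ∑ no-extra ≡ 0
      no-extra-sum = ∑-zero {f = no-extra} λ _ → refl

      isHardNbr : V → V → Bool
      isHardNbr v u = R K v u ∧ hard K u

    reduce-light : ∀ v z → A K v z ≡ true → deg K v + hdeg K v ≤ 7 → Colorable K
    reduce-light v z vz light =
      let c , p , o = ih (contractMixed K v z vz) (smaller {K} v z vz ℕₚ.≤-refl)
          P₀ = colorable-partial {K = contractMixed K v z vz} p o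
          P₁ = expand K v z vz P₀
          uniq = expand-unique K v z vz P₀ refl
          -- The only uncoloured vertex is v, and `c z` occurs exactly once around it.
          G = partial-good P₁ λ x x∉ hx _ _ → case without-false {al = everything} {x = x} x∉ of λ where
                (inj₂ refl) → unique-odd K (hard-R K {v} hx {z} vz) λ b vb b≢z →
                  uniq b (without-intro refl (A-≢ K {v} {b} (R⇒A K {v} {b} vb) ∘ ≡.sym)) b≢z (R⇒A K {v} {b} vb)
          i , G′ , _ = Extend.extend K G v (without-self {al = everything}) (A K v) (isHardNbr v) no-extra
            (λ w _ vw → w , vw , refl)
            (λ u vu hu q → false≢true q (∧-intro vu hu))
            (≤-resp₂ (trans (cong (deg K v + hdeg K v +_) no-extra-sum) (ℕₚ.+-identityʳ _)) refl light)
      in good-colorable G′ λ x → with-without {W = everything} {v} {x} refl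

    -- Both x and y are contracted into z, which keeps c z unique around them; so y, coloured first, need not
    -- spare x, nor x spare y.
    reduce-pair : ∀ x y z → hard K y ≡ true → R K x y ≡ true → A K x z ≡ true → A K y z ≡ true →
      deg K x + hdeg K x ≤ 8 → deg K y + hdeg K y ≤ 8 + ⟦ hard K x ⟧ → Colorable K
    reduce-pair x y z hy xy xz yz lx ly = good-colorable G₂ total
      where
      yx = R-sym K x y xy
      x≢y = A-≢ K {x} {y} (R⇒A K {x} {y} xy)
      x≢z = A-≢ K {x} {z} xz
      y≢z = A-≢ K {y} {z} yz
      K₁ = contractMixed K y z yz
      W₁ W : V → Bool
      W₁ = everything without x
      W = W₁ without y
      adj₁ : ∀ {a b} → a ≢ y → b ≢ y → A K a b ≡ true → A K₁ a b ≡ true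
      adj₁ {a} {b} h₁ h₂ h = trans (≡.sym (contractMixed-A K y z yz a b)) (contract-intro {A = A K} h₁ h₂ (A-≢ K {a} {b} h) h)
      xz₁ : A K₁ x z ≡ true
      xz₁ = adj₁ {x} {z} x≢y (y≢z ∘ ≡.sym) xz
      K₂ = contractMixed K₁ x z xz₁
      sol = ih K₂ (smaller {K₁} x z xz₁ (ℕₚ.≤-trans (ℕₚ.n≤1+n _) (smaller {K} y z yz ℕₚ.≤-refl)))
      c = proj₁ sol
      P₂ : Partial K₂ everything c
      P₂ = colorable-partial {K = K₂} (proj₁ (proj₂ sol)) (proj₂ (proj₂ sol))
      P₁ : Partial K₁ W₁ c
      P₁ = expand K₁ x z xz₁ P₂
      P₀ : Partial K W c
      P₀ = expand K y z yz P₁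
      z∈W₁ : W₁ z ≡ true
      z∈W₁ = without-intro refl (x≢z ∘ ≡.sym)
      z∈W : W z ≡ true
      z∈W = without-intro z∈W₁ (y≢z ∘ ≡.sym)
      W-intro : ∀ {b} → b ≢ x → b ≢ y → W b ≡ true
      W-intro h₁ h₂ = without-intro (without-intro refl h₁) h₂
      uniq-y : Unique K W c y z
      uniq-y = expand-unique K y z yz P₁ z∈W₁
      uniq-x : ∀ b → b ≢ y → b ≢ z → A K x b ≡ true → c z ≢ c b
      uniq-x b b≢y b≢z h = expand-unique K₁ x z xz₁ P₂ refl b
        (without-intro refl (A-≢ K {x} {b} h ∘ ≡.sym)) b≢z (adj₁ {x} {b} x≢y b≢y h)
      y∉W : W y ≡ false
      y∉W = without-self {al = W₁}
      x∉W : W x ≡ false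
      x∉W = ¬true⇒false λ h → proj₂ (without-elim {x = x} (proj₁ (without-elim {al = W₁} {x = x} h))) refl
      G₀ : Good K W c
      -- Each of x and y still has an uncoloured neighbour, namely the other, so nothing has to be
      -- shown for them yet.
      G₀ = partial-good P₀ λ a a∉ _ _ nb → case without-false {al = W₁} {x = a} a∉ of λ where
        (inj₂ refl) → false≢true x∉W (nb x (R⇒A K {y} {x} yx))
        (inj₁ a∉₁)  → case without-false {al = everything} {x = a} a∉₁ of λ where
          (inj₂ refl) → false≢true y∉W (nb y (R⇒A K {x} {y} xy))
      step₁ = Extend.extend K G₀ y y∉W (λ w → A K y w ∧ not (w == x)) (λ u → isHardNbr y u ∧ not (u == x)) no-extra
        (λ w ww yw → w , ∧-intro yw (≢⇒/= {a = w} {x} λ { refl → false≢true x∉W ww }) , refl)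
        (λ u yu hu q _ → exempt u hu (not-both (R K y) (hard K) yu hu q))
        (bound (hard K x) refl)
        where
        exempt : ∀ u → hard K u ≡ true → u ≡ x → ∀ i →
          (∀ w → W w ≡ true → A K y w ≡ true → c w ≢ i) → OddAt K (recolour c y i) u
        exempt u hu refl = Extend.unique-exempt K G₀ y y∉W {x} {z} (hard-R K {x} hu {z} xz) z∈W yz
          λ b xb b≢y b≢z → uniq-x b b≢y b≢z (R⇒A K {x} {b} xb)
        -- The uncoloured x saves one prohibition, and a second one if it is hard, being exempt:
        -- this is the bound `8 + ⟦ hard K x ⟧` for y.
        arith : ∀ d h p q e → p + 1 ≤ d → q + e ≤ h → d + h ≤ 8 + e → (p + q) + 0 ≤ 7
        arith d h p q e h₁ h₂ h₃ = lin (h₁ ⊕ h₂ ⊕ h₃) 0 (solve (d ∷ h ∷ p ∷ q ∷ e ∷ []))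
        bound : ∀ b → hard K x ≡ b → ∑ (λ w → ⟦ A K y w ∧ not (w == x) ⟧) +
          ∑ (λ u → ⟦ isHardNbr y u ∧ not (u == x) ⟧) + ∑ no-extra ≤ 7
        bound b e = ≤-resp₂ (cong (∑ (λ w → ⟦ A K y w ∧ not (w == x) ⟧) +
            ∑ (λ u → ⟦ isHardNbr y u ∧ not (u == x) ⟧) +_) no-extra-sum) refl
          (arith (deg K y) (hdeg K y) _ _ ⟦ b ⟧ (drop-one {f = A K y} x (R⇒A K {y} {x} yx)) (hs b e)
            (subst (λ b → deg K y + hdeg K y ≤ 8 + ⟦ b ⟧) e ly))
          where
          hs : ∀ b → hard K x ≡ b → ∑ (λ u → ⟦ isHardNbr y u ∧ not (u == x) ⟧) + ⟦ b ⟧ ≤ hdeg K y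
          hs true  e = drop-one {f = isHardNbr y} x (∧-intro yx e)
          hs false e = ≤-resp₂ (ℕₚ.+-identityʳ _) refl (drop-≤ {f = isHardNbr y} x)
      i₁ = proj₁ step₁
      c₁ = recolour c y i₁
      W₂ : V → Bool
      W₂ = W with′ y
      G₁ : Good K W₂ c₁
      G₁ = proj₁ (proj₂ step₁)
      x∉W₂ : W₂ x ≡ false
      x∉W₂ = with-false {W = W} {x = x} x∉W x≢y
      step₂ = Extend.extend K G₁ x x∉W₂ (A K x) (λ u → isHardNbr x u ∧ not (u == y)) no-extra
        (λ w _ xw → w , xw , refl)
        (λ u xu hu q _ → exempt u (not-both (R K x) (hard K) xu hu q))
        (≤-resp₂ (cong (deg K x + ∑ (λ u → ⟦ isHardNbr x u ∧ not (u == y) ⟧) +_) no-extra-sum) refl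
          (arith (deg K x) (hdeg K x) _ (drop-one {f = isHardNbr x} y (∧-intro xy hy)) lx))
        where
        exempt : ∀ u → u ≡ y → ∀ i → (∀ w → W₂ w ≡ true → A K x w ≡ true → c₁ w ≢ i) →
          OddAt K (recolour c₁ x i) u
        exempt u refl = Extend.unique-exempt K G₁ x x∉W₂ {y} {z} (hard-R K {y} hy {z} yz) (with-old z∈W) xz
          λ b yb b≢x b≢z e → let b≢y = A-≢ K {y} {b} (R⇒A K {y} {b} yb) ∘ ≡.sym in
            uniq-y b (W-intro b≢x b≢y) b≢z (R⇒A K {y} {b} yb)
              (trans (≡.sym (recolour-≢ (y≢z ∘ ≡.sym))) (trans e (recolour-≢ b≢y)))
        -- Now y is coloured and its colour is forbidden for x; only the exemption of the hard y is
        -- saved, whence the bound 8.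
        arith : ∀ d h q → q + 1 ≤ h → d + h ≤ 8 → (d + q) + 0 ≤ 7
        arith d h q h₁ h₂ = lin (h₁ ⊕ h₂) 0 (solve (d ∷ h ∷ q ∷ []))
      G₂ = proj₁ (proj₂ step₂)
      total : ∀ b → (W₂ with′ x) b ≡ true
      total b = case b ≟ x of λ where
        (yes refl) → with-new {W = W₂}
        (no b≢x)   → with-old (with-without {W = W₁} {y} {b} (without-intro refl b≢x))

    -- All three vertices are contracted into z and recoloured in the order u, w, x. If u avoids c z as well, that
    -- colour stays unique around w, and the last vertex x only has to spare u and its third real neighbour.
    reduce-triangle : ∀ x u w z → hard K x ≡ false → hard K u ≡ true → hard K w ≡ true →
      R K x u ≡ true → R K x w ≡ true → R K u w ≡ true → A K x z ≡ true → A K w z ≡ true → z ≢ u →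
      deg K x + hdeg K x ≤ 8 → deg K u + hdeg K u ≤ 9 → deg K w + hdeg K w ≤ 9 → Colorable K
    reduce-triangle x u w z sx hu hw xu xw uw xz wz z≢u lx lu lw = good-colorable G₃ total
      where
      ra : ∀ {a b} → R K a b ≡ true → A K a b ≡ true
      ra {a} {b} = R⇒A K {a} {b}
      ux = R-sym K x u xu
      wx = R-sym K x w xw
      wu = R-sym K u w uw
      x≢u = A-≢ K {x} {u} (ra xu)
      x≢w = A-≢ K {x} {w} (ra xw)
      u≢w = A-≢ K {u} {w} (ra uw)
      x≢z = A-≢ K {x} {z} xz
      w≢z = A-≢ K {w} {z} wz
      K₁ = contractMixed K w z wz
      toA₁ : ∀ {a b} → contract w z (A K) a b ≡ true → A K₁ a b ≡ true
      toA₁ {a} {b} = trans (≡.sym (contractMixed-A K w z wz a b))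
      xz₁ : A K₁ x z ≡ true
      xz₁ = toA₁ {x} {z} (contract-intro {A = A K} x≢w (w≢z ∘ ≡.sym) x≢z xz)
      -- The contraction of w has turned u w into an edge u z, so u too can be contracted into z,
      -- whether or not it was adjacent to it before.
      uz₁ : A K₁ u z ≡ true
      uz₁ = toA₁ {u} {z} (contract-introʳ {A = A K} u≢w (w≢z ∘ ≡.sym) (z≢u ∘ ≡.sym) (ra wu))
      K₂ = contractMixed K₁ x z xz₁
      uz₂ : A K₂ u z ≡ true
      uz₂ = trans (≡.sym (contractMixed-A K₁ x z xz₁ u z))
        (contract-intro {A = A K₁} (x≢u ∘ ≡.sym) (x≢z ∘ ≡.sym) (z≢u ∘ ≡.sym) uz₁)
      K₃ = contractMixed K₂ u z uz₂
      weaken : ∀ {a b} → a < b → a ≤ b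
      weaken = ℕₚ.≤-trans (ℕₚ.n≤1+n _)
      sol = ih K₃ (smaller {K₂} u z uz₂ (weaken (smaller {K₁} x z xz₁ (weaken (smaller {K} w z wz ℕₚ.≤-refl)))))
      c = proj₁ sol
      W₁ W₂ W : V → Bool
      W₁ = everything without u
      W₂ = W₁ without x
      W = W₂ without w
      P₃ : Partial K₃ everything c
      P₃ = colorable-partial {K = K₃} (proj₁ (proj₂ sol)) (proj₂ (proj₂ sol))
      P₂ : Partial K₁ W₂ c
      P₂ = expand K₁ x z xz₁ (expand K₂ u z uz₂ P₃)
      P₀ : Partial K W c
      P₀ = expand K w z wz P₂
      W-intro : ∀ {b} → b ≢ u → b ≢ x → b ≢ w → W b ≡ true
      W-intro h₁ h₂ h₃ = without-intro (without-intro (without-intro refl h₁) h₂) h₃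
      z∈W : W z ≡ true
      z∈W = W-intro z≢u (x≢z ∘ ≡.sym) (w≢z ∘ ≡.sym)
      uniq : Unique K W c w z
      uniq = expand-unique K w z wz P₂ (without-intro (without-intro refl z≢u) (x≢z ∘ ≡.sym))
      w∉W : W w ≡ false
      w∉W = without-self {al = W₂}
      x∉W : W x ≡ false
      x∉W = ¬true⇒false λ h → proj₂ (without-elim {al = W₁} {x = x} (proj₁ (without-elim {al = W₂} {x = x} h))) refl
      u∉W : W u ≡ false
      u∉W = ¬true⇒false λ h → proj₂ (without-elim {al = everything} {x = u}
        (proj₁ (without-elim {al = W₁} {x = u} (proj₁ (without-elim {al = W₂} {x = u} h))))) refl
      G₀ : Good K W c
      G₀ = partial-good P₀ λ a a∉ _ _ nb → case without-false {al = W₂} {x = a} a∉ of λ where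
        (inj₂ refl) → false≢true x∉W (nb x (ra wx))
        (inj₁ a∉₂)  → case without-false {al = W₁} {x = a} a∉₂ of λ where
          (inj₂ refl) → false≢true w∉W (nb w (ra xw))
          (inj₁ a∉₁)  → case without-false {al = everything} {x = a} a∉₁ of λ where
            (inj₂ refl) → false≢true w∉W (nb w (ra uw))
      extra : Fin 8 → ℕ
      extra i = ⟦ i == c z ⟧
      step₁ = Extend.extend K G₀ u u∉W (λ p → (A K u p ∧ not (p == x)) ∧ not (p == w))
        (λ q → isHardNbr u q ∧ not (q == w)) extra
        (λ p pp up → p , ∧-intro (∧-intro up (≢⇒/= {a = p} {x} λ { refl → false≢true x∉W pp }))
                                 (≢⇒/= {a = p} {w} λ { refl → false≢true w∉W pp }) , refl)
        (λ q uq hq Qq nb → ⊥-elim (false≢true x∉W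
          (nb x (subst (λ q → A K q x ≡ true) (≡.sym (not-both (R K u) (hard K) uq hq Qq)) (ra wx)) x≢u)))
        (≤-resp₂ (cong (∑ (λ p → ⟦ (A K u p ∧ not (p == x)) ∧ not (p == w) ⟧) +
            ∑ (λ q → ⟦ isHardNbr u q ∧ not (q == w) ⟧) +_) (∑-δ₁ (c z))) refl
          (arith (deg K u) (hdeg K u) _ _ (drop-two {f = A K u} x w (ra ux) (ra uw) x≢w)
            (drop-one {f = isHardNbr u} w (∧-intro uw hw)) lu))
        where
        -- The uncoloured x and w save two colours, the hard w is exempt because its neighbour x is
        -- still uncoloured, and avoiding `c z` costs one: 9 - 2 - 1 + 1 = 7.
        arith : ∀ d h p q → p + 2 ≤ d → q + 1 ≤ h → d + h ≤ 9 → (p + q) + 1 ≤ 7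
        arith d h p q h₁ h₂ h₃ = lin (h₁ ⊕ h₂ ⊕ h₃) 0 (solve (d ∷ h ∷ p ∷ q ∷ []))
      i₁ = proj₁ step₁
      i₁≢cz : i₁ ≢ c z
      i₁≢cz e = case trans (≡.sym (cong ⟦_⟧ (≡⇒== e))) (proj₂ (proj₂ step₁)) of λ ()
      c₁ = recolour c u i₁
      W₃ : V → Bool
      W₃ = W with′ u
      G₁ : Good K W₃ c₁
      G₁ = proj₁ (proj₂ step₁)
      w∉W₃ : W₃ w ≡ false
      w∉W₃ = with-false {W = W} {x = w} w∉W (u≢w ∘ ≡.sym)
      x∉W₃ : W₃ x ≡ false
      x∉W₃ = with-false {W = W} {x = x} x∉W x≢u
      step₂ = Extend.extend K G₁ w w∉W₃ (λ p → A K w p ∧ not (p == x)) (λ q → isHardNbr w q ∧ not (q == u)) no-extra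
        (λ p pp wp → p , ∧-intro wp (≢⇒/= {a = p} {x} λ { refl → false≢true x∉W₃ pp }) , refl)
        (λ q wq hq Qq nb → ⊥-elim (false≢true x∉W₃
          (nb x (subst (λ q → A K q x ≡ true) (≡.sym (not-both (R K w) (hard K) wq hq Qq)) (ra ux)) x≢w)))
        (≤-resp₂ (cong (∑ (λ p → ⟦ A K w p ∧ not (p == x) ⟧) +
            ∑ (λ q → ⟦ isHardNbr w q ∧ not (q == u) ⟧) +_) no-extra-sum) refl
          (arith (deg K w) (hdeg K w) _ _ (drop-one {f = A K w} x (ra wx))
            (drop-one {f = isHardNbr w} u (∧-intro wu hu)) lw))
        where
        -- The uncoloured x saves a colour, and it also exempts its hard neighbour u: 9 - 1 - 1 = 7.
        arith : ∀ d h p q → p + 1 ≤ d → q + 1 ≤ h → d + h ≤ 9 → (p + q) + 0 ≤ 7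
        arith d h p q h₁ h₂ h₃ = lin (h₁ ⊕ h₂ ⊕ h₃) 0 (solve (d ∷ h ∷ p ∷ q ∷ []))
      c₂ = recolour c₁ w (proj₁ step₂)
      W₄ : V → Bool
      W₄ = W₃ with′ w
      G₂ : Good K W₄ c₂
      G₂ = proj₁ (proj₂ step₂)
      x∉W₄ : W₄ x ≡ false
      x∉W₄ = with-false {W = W₃} {x = x} x∉W₃ x≢w
      step₃ = Extend.extend K G₂ x x∉W₄ (A K x) (λ q → isHardNbr x q ∧ not (q == w)) no-extra
        (λ p _ xp → p , xp , refl)
        (λ q xq hq Qq _ → exempt q (not-both (R K x) (hard K) xq hq Qq))
        (≤-resp₂ (cong (deg K x + ∑ (λ q → ⟦ isHardNbr x q ∧ not (q == w) ⟧) +_) no-extra-sum) refl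
          (arith (deg K x) (hdeg K x) _ (drop-one {f = isHardNbr x} w (∧-intro xw hw)) lx))
        where
        arith : ∀ d h q → q + 1 ≤ h → d + h ≤ 8 → (d + q) + 0 ≤ 7
        arith d h q h₁ h₂ = lin (h₁ ⊕ h₂) 0 (solve (d ∷ h ∷ q ∷ []))
        c₂z : c₂ z ≡ c z
        c₂z = trans (recolour-≢ (w≢z ∘ ≡.sym)) (recolour-≢ z≢u)
        exempt : ∀ q → q ≡ w → ∀ i → (∀ p → W₄ p ≡ true → A K x p ≡ true → c₂ p ≢ i) →
          OddAt K (recolour c₂ x i) q
        exempt q refl = Extend.unique-exempt K G₂ x x∉W₄ {w} {z} (hard-R K {w} hw {z} wz) (with-old (with-old z∈W)) xz
          λ b wb b≢x b≢z e → by b wb b≢x b≢z (trans (≡.sym c₂z) e) (b ≟ u)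
          where
          by : ∀ b → R K w b ≡ true → b ≢ x → b ≢ z → c z ≡ c₂ b → Dec (b ≡ u) → ⊥
          by b wb b≢x b≢z e (yes refl) = i₁≢cz (≡.sym (trans e (trans (recolour-≢ u≢w) (recolour-≡ u))))
          by b wb b≢x b≢z e (no b≢u) = uniq b (W-intro b≢u b≢x b≢w) b≢z (ra wb)
            (trans e (trans (recolour-≢ b≢w) (recolour-≢ b≢u)))
            where b≢w = A-≢ K {w} {b} (ra wb) ∘ ≡.sym
      G₃ = proj₁ (proj₂ step₃)
      total : ∀ b → (W₄ with′ x) b ≡ true
      total b = by (b ≟ x) (b ≟ w) (b ≟ u)
        where
        by : Dec (b ≡ x) → Dec (b ≡ w) → Dec (b ≡ u) → (W₄ with′ x) b ≡ true
        by (yes refl) _ _ = with-new {W = W₄}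
        by (no _) (yes refl) _ = with-old (with-new {W = W₃})
        by (no _) (no _) (yes refl) = with-old (with-old (with-new {W = W}))
        by (no b≢x) (no b≢w) (no b≢u) = with-old (with-old (with-old (W-intro b≢u b≢x b≢w)))

    -- A vertex of degree four faces up to 4 + 4 prohibitions, one too many. The one that is
    -- coloured first still has an uncoloured neighbour; for the last one a prohibition must be
    -- saved, and the order of u and v is chosen to this end. The neighbours into which they are
    -- contracted are arbitrary: the contractions only have to produce a smaller graph that is
    -- connected and toroidal.
    reduce-fours : ∀ u v → R K u v ≡ true → hard K u ≡ true → hard K v ≡ true → deg K u ≡ 4 → deg K v ≡ 4 → Colorable K
    reduce-fours u v uv hu hv du dv = by (Finₚ.any? λ a → Finₚ.any? λ b → true? (A K v a) ×-dec true? (A K v b) ×-dec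
        ¬? (a ≟ u) ×-dec ¬? (b ≟ u) ×-dec ¬? (a ≟ b) ×-dec c a ≟ c b)
      where
      ra : ∀ {a b} → R K a b ≡ true → A K a b ≡ true
      ra {a} {b} = R⇒A K {a} {b}
      vu = R-sym K u v uv
      u≢v = A-≢ K {u} {v} (ra uv)
      nu = avoid-one {f = A K u} v (subst (2 ≤_) (≡.sym du) (s≤s (s≤s z≤n)))
      u₁ = proj₁ nu
      uu₁ = proj₁ (proj₂ nu)
      nv = avoid-one {f = A K v} u (subst (2 ≤_) (≡.sym dv) (s≤s (s≤s z≤n)))
      v₁ = proj₁ nv
      vv₁ = proj₁ (proj₂ nv)
      K₁ = contractMixed K u u₁ uu₁
      vv₁′ : A K₁ v v₁ ≡ true
      vv₁′ = trans (≡.sym (contractMixed-A K u u₁ uu₁ v v₁))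
        (contract-intro {A = A K} (u≢v ∘ ≡.sym) (proj₂ (proj₂ nv)) (A-≢ K {v} {v₁} vv₁) vv₁)
      K₂ = contractMixed K₁ v v₁ vv₁′
      sol = ih K₂ (smaller {K₁} v v₁ vv₁′ (ℕₚ.≤-trans (ℕₚ.n≤1+n _) (smaller {K} u u₁ uu₁ ℕₚ.≤-refl)))
      c = proj₁ sol
      W₁ W : V → Bool
      W₁ = everything without v
      W = W₁ without u
      W-intro : ∀ {b} → b ≢ u → b ≢ v → W b ≡ true
      W-intro h₁ h₂ = without-intro (without-intro refl h₂) h₁
      u∉W : W u ≡ false
      u∉W = without-self {al = W₁}
      v∉W : W v ≡ false
      v∉W = ¬true⇒false λ h → proj₂ (without-elim {x = v} (proj₁ (without-elim {al = W₁} {x = v} h))) refl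
      G₀ : Good K W c
      G₀ = partial-good (expand K u u₁ uu₁ (expand K₁ v v₁ vv₁′
          (colorable-partial {K = K₂} (proj₁ (proj₂ sol)) (proj₂ (proj₂ sol)))))
        λ a a∉ _ _ nb → case without-false {al = W₁} {x = a} a∉ of λ where
          (inj₂ refl) → false≢true v∉W (nb v (ra uv))
          (inj₁ a∉₁)  → case without-false {al = everything} {x = a} a∉₁ of λ where
            (inj₂ refl) → false≢true u∉W (nb u (ra vu))
      Distinct : V → V → Set
      Distinct u v = ∀ a b → A K u a ≡ true → A K u b ≡ true → a ≢ v → b ≢ v → a ≢ b → c a ≢ c b
      Repeat : V → V → Set
      Repeat u v = ∃ λ a → ∃ λ b → A K v a ≡ true × A K v b ≡ true × a ≢ u × b ≢ u × a ≢ b × c a ≡ c b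
      -- Either the last vertex has two neighbours of the same colour and so one forbidden colour less,
      -- or the other neighbours of the first one have distinct colours and then its last neighbour is free.
      finish : ∀ u v → R K u v ≡ true → hard K u ≡ true → hard K v ≡ true → deg K u ≡ 4 → deg K v ≡ 4 →
        W u ≡ false → W v ≡ false → (∀ {b} → b ≢ u → b ≢ v → W b ≡ true) → Good K W c →
        Repeat u v ⊎ Distinct u v → Colorable K
      finish u v uv hu hv du dv u∉W v∉W W-intro G₀ choice = good-colorable (proj₁ (proj₂ (step₂ choice))) total
        where
        v~u = R-sym K u v uv
        v≢u = A-≢ K {v} {u} (ra v~u)
        hdeg≤ : ∀ x → deg K x ≡ 4 → hdeg K x ≤ 4
        hdeg≤ x e = ≤-resp₂ refl (≡.sym e) (∑-mono λ y → true-≤ λ h → R⇒A K {x} {y} (∧-elimˡ h))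
        step₁ = Extend.extend K G₀ u u∉W (λ p → A K u p ∧ not (p == v)) (isHardNbr u) no-extra
          (λ p pp up → p , ∧-intro up (≢⇒/= {a = p} {v} λ { refl → false≢true v∉W pp }) , refl)
          (λ q uq hq Qq → false≢true Qq (∧-intro uq hq))
          (≤-resp₂ (cong (∑ (λ p → ⟦ A K u p ∧ not (p == v) ⟧) + hdeg K u +_) no-extra-sum) refl
            (arith _ _ (≤-resp₂ refl (≡.sym du) (drop-one {f = A K u} v (ra uv))) (hdeg≤ u du)))
          where
          arith : ∀ p q → p + 1 ≤ 4 → q ≤ 4 → (p + q) + 0 ≤ 7
          arith p q h₁ h₂ = lin (h₁ ⊕ h₂) 0 (solve (p ∷ q ∷ []))
        i₁ = proj₁ step₁
        c₁ = recolour c u i₁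
        W₂ : V → Bool
        W₂ = W with′ u
        G₁ : Good K W₂ c₁
        G₁ = proj₁ (proj₂ step₁)
        v∉W₂ : W₂ v ≡ false
        v∉W₂ = with-false {W = W} {x = v} v∉W v≢u
        Step₂ : Set
        Step₂ = ∃ λ i → Good K (W₂ with′ v) (recolour c₁ v i) × no-extra i ≡ 0
        step₂ : Repeat u v ⊎ Distinct u v → Step₂
        step₂ (inj₁ (a , b , va , vb , a≢u , b≢u , a≢b , ca≡cb)) = Extend.extend K G₁ v v∉W₂ (λ p → A K v p ∧ not (p == b)) (isHardNbr v) no-extra
          cover
          (λ q vq hq Qq → false≢true Qq (∧-intro vq hq))
          (≤-resp₂ (cong (∑ (λ p → ⟦ A K v p ∧ not (p == b) ⟧) + hdeg K v +_) no-extra-sum) refl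
            (arith _ _ (≤-resp₂ refl (≡.sym dv) (drop-one {f = A K v} b vb)) (hdeg≤ v dv)))
          where
          same : c₁ a ≡ c₁ b
          same = trans (recolour-≢ a≢u) (trans ca≡cb (≡.sym (recolour-≢ b≢u)))
          cover : ∀ w → W₂ w ≡ true → A K v w ≡ true → ∃ λ w′ → A K v w′ ∧ not (w′ == b) ≡ true × c₁ w′ ≡ c₁ w
          cover w _ vw = case w ≟ b of λ where
            (yes refl) → a , ∧-intro va (≢⇒/= a≢b) , same
            (no w≢b)   → w , ∧-intro vw (≢⇒/= w≢b) , refl
          arith : ∀ p q → p + 1 ≤ 4 → q ≤ 4 → (p + q) + 0 ≤ 7
          arith p q h₁ h₂ = lin (h₁ ⊕ h₂) 0 (solve (p ∷ q ∷ []))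
        step₂ (inj₂ distinct) = Extend.extend K G₁ v v∉W₂ (A K v) (λ q → isHardNbr v q ∧ not (q == u)) no-extra
          (λ p _ vp → p , vp , refl)
          (λ q vq hq Qq _ i _ → exempt q (not-both (R K v) (hard K) vq hq Qq) i)
          (≤-resp₂ (cong (deg K v + ∑ (λ q → ⟦ isHardNbr v q ∧ not (q == u) ⟧) +_) no-extra-sum) refl
            (arith (deg K v) (hdeg K v) _ dv (drop-one {f = isHardNbr v} u (∧-intro v~u hu)) (hdeg≤ v dv)))
          where
          arith : ∀ d h q → d ≡ 4 → q + 1 ≤ h → h ≤ 4 → (d + q) + 0 ≤ 7
          arith _ h q refl h₁ h₂ = lin (h₁ ⊕ h₂) 0 (solve (h ∷ q ∷ []))
          oddu : ∀ i → OddAt K (recolour c₁ v i) u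
          exempt : ∀ q → q ≡ u → ∀ i → OddAt K (recolour c₁ v i) q
          exempt q refl = oddu
          oddu i = let z , uz , z≢v , z≢i = other-colour {f = A K u} v i (≤-resp₂ refl du (ℕₚ.n≤1+n 3)) distinct in unique-odd K (hard-R K {u} hu {z} uz)
            λ b ub b≢z e → by z uz z≢v z≢i b (ra ub) b≢z e (b ≟ v)
            where
            colour : ∀ {b} → A K u b ≡ true → b ≢ v → recolour c₁ v i b ≡ c b
            colour {b} ub b≢v = trans (recolour-≢ b≢v) (recolour-≢ (A-≢ K {u} {b} ub ∘ ≡.sym))
            by : ∀ z → A K u z ≡ true → z ≢ v → c z ≢ i → ∀ b → A K u b ≡ true → b ≢ z →
              recolour c₁ v i z ≡ recolour c₁ v i b → Dec (b ≡ v) → ⊥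
            by z uz z≢v z≢i b ub b≢z e (yes refl) = z≢i (trans (≡.sym (colour uz z≢v)) (trans e (recolour-≡ v)))
            by z uz z≢v z≢i b ub b≢z e (no b≢v) = distinct z b uz ub z≢v b≢v (b≢z ∘ ≡.sym)
              (trans (≡.sym (colour uz z≢v)) (trans e (colour ub b≢v)))
        total : ∀ b → (W₂ with′ v) b ≡ true
        total b = by (b ≟ u) (b ≟ v)
          where
          by : Dec (b ≡ u) → Dec (b ≡ v) → (W₂ with′ v) b ≡ true
          by _ (yes refl) = with-new {W = W₂}
          by (yes refl) (no _) = with-old (with-new {W = W})
          by (no b≢u) (no b≢v) = with-old (with-old (W-intro b≢u b≢v))
      by : Dec (Repeat u v) → Colorable K
      by (yes r)   = finish u v uv hu hv du dv u∉W v∉W W-intro G₀ (inj₁ r)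
      by (no none) = finish v u vu hv hu dv du v∉W u∉W (λ h₁ h₂ → W-intro h₂ h₁) G₀
        (inj₂ λ a b va vb a≢u b≢u a≢b e → none (a , b , va , vb , a≢u , b≢u , a≢b , e))

-- Triangular faces

module _ {N : ℕ} where
  private
    V : Set
    V = Fin N

  -- A double sum is bounded below by a few chosen darts, which are taken out one after another;
  -- erasing them ensures that none is counted twice.
  erase : (V → V → ℕ) → V → V → V → V → ℕ
  erase g x y a b = if a == x ∧ b == y then 0 else g a b

  erase-≢ : ∀ {g x y a b} → (a ≡ x → b ≡ y → ⊥) → erase g x y a b ≡ g a b
  erase-≢ {g} {x} {y} {a} {b} h with a ≟ x | b ≟ y
  ... | yes p | yes q = ⊥-elim (h p q)
  ... | yes p | no q  = refl
  ... | no p  | _     = refl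

  ∑∑-peel : ∀ g x y → g x y + ∑∑ (erase g x y) ≡ ∑∑ g
  ∑∑-peel g x y = ≡.sym (trans (∑-cong λ a → ∑-cong λ b → pt a b) (trans (∑-cong λ a → ∑-+ _ _)
    (trans (∑-+ _ _) (cong (_+ ∑∑ (erase g x y)) at))))
    where
    pt : ∀ a b → g a b ≡ ⟦ a == x ⟧ * (⟦ b == y ⟧ * g a b) + erase g x y a b
    pt a b with a ≟ x | b ≟ y
    ... | yes p | yes q = ≡.sym (trans (ℕₚ.+-identityʳ _) (trans (ℕₚ.+-identityʳ _) (ℕₚ.+-identityʳ _)))
    ... | yes p | no q  = refl
    ... | no p  | _     = refl
    at : ∑∑ (λ a b → ⟦ a == x ⟧ * (⟦ b == y ⟧ * g a b)) ≡ g x y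
    at = trans (∑-cong λ a → trans (∑-*ˡ ⟦ a == x ⟧ _) (cong (⟦ a == x ⟧ *_) (∑-δ (g a) y)))
      (∑-δ (λ a → g a y) x)

  open Mixed

  module Faces (K : Mixed N) (deg≥ : ∀ v → alive K v ≡ true → 4 ≤ deg K v) where
    open Torus (torus K) using (rot; rot-A; rot-tr; rot-fix; L; lab; lab-φ; euler)

    edge-deg : ∀ {v u} → A K v u ≡ true → 4 ≤ deg K v
    edge-deg {v} {u} h = deg≥ v (A-alive K v u h)

    no-fix : ∀ {v u} → A K v u ≡ true → rot v u ≢ u
    no-fix {v} {u} h e = let w , vw , ne = avoid-one {f = A K v} u (ℕₚ.≤-trans (s≤s (s≤s z≤n)) (edge-deg h))
                         in ne (rot-fix h vw e)

    -- the corner of v between u and w belongs to a triangular face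
    opaque
      T : V → V → V → Bool
      T v u w = A K v u ∧ ((rot v u == w) ∧ ((rot w v == u) ∧ (rot u w == v)))

      T-intro : ∀ {v u w} → A K v u ≡ true → rot v u ≡ w → rot w v ≡ u → rot u w ≡ v → T v u w ≡ true
      T-intro h a b c = ∧-intro h (∧-intro (≡⇒== a) (∧-intro (≡⇒== b) (≡⇒== c)))

      T-elim : ∀ {v u w} → T v u w ≡ true → A K v u ≡ true × rot v u ≡ w × rot w v ≡ u × rot u w ≡ v
      T-elim {v} {u} {w} h = let a , b , c , d = ∧-elim₄ {A K v u} {rot v u == w} {rot w v == u} h in
        a , ==⇒≡ b , ==⇒≡ c , ==⇒≡ d

    T-vu : ∀ {v u w} → T v u w ≡ true → A K v u ≡ true
    T-vu h = proj₁ (T-elim h)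

    T-vw : ∀ {v u w} → T v u w ≡ true → A K v w ≡ true
    T-vw {v} {u} {w} h = let a , b , _ = T-elim h in subst (λ w → A K v w ≡ true) b (rot-A v u a)

    T-rotate : ∀ {v u w} → T v u w ≡ true → T w v u ≡ true
    T-rotate {v} {u} {w} h = let a , b , c , d = T-elim h in T-intro (A-sym K v w (T-vw h)) c d b

    T-cyclic : ∀ v u w → T v u w ≡ T w v u
    T-cyclic v u w = true-≡ T-rotate (T-rotate ∘ T-rotate)

    T-uw : ∀ {v u w} → T v u w ≡ true → A K u w ≡ true
    T-uw {v} {u} {w} h = A-sym K w u (T-vw (T-rotate h))

    T-fun : ∀ {v u w w′} → T v u w ≡ true → T v u w′ ≡ true → w ≡ w′
    T-fun h h′ = trans (≡.sym (proj₁ (proj₂ (T-elim h)))) (proj₁ (proj₂ (T-elim h′)))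

    T-fun′ : ∀ {v x x′ u} → T v x u ≡ true → T v x′ u ≡ true → x ≡ x′
    T-fun′ h h′ = trans (≡.sym (proj₁ (proj₂ (proj₂ (T-elim h))))) (proj₁ (proj₂ (proj₂ (T-elim h′))))

    -- The rotation at v would interchange u and w and so reach no third neighbour, against degree
    -- at least four.
    no-digon : ∀ {v u w} → T v u w ≡ true → T v w u ≡ true → ⊥
    no-digon {v} {u} {w} h h′ =
      let x , vx , x≢u , x≢w = avoid-two {f = A K v} u w (ℕₚ.≤-trans (s≤s (s≤s (s≤s z≤n))) (edge-deg {v} {u} (T-vu h)))
      in case ∨-elim {x == u} (rot-tr v (λ y → (y == u) ∨ (y == w)) step u x (T-vu h) vx (∨-introˡ (==-refl u))) of λ where
        (inj₁ e) → x≢u (==⇒≡ e)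
        (inj₂ e) → x≢w (==⇒≡ e)
      where
      step : ∀ y → A K v y ≡ true → (y == u) ∨ (y == w) ≡ true → (rot v y == u) ∨ (rot v y == w) ≡ true
      step y _ s with ∨-elim {y == u} s
      ... | inj₁ e = ∨-introʳ {p = rot v y == u} (≡⇒== (trans (cong (rot v) (==⇒≡ e)) (proj₁ (proj₂ (T-elim h)))))
      ... | inj₂ e = ∨-introˡ (≡⇒== (trans (cong (rot v) (==⇒≡ e)) (proj₁ (proj₂ (T-elim h′)))))

    ∑T : (V → V → V → ℕ) → ℕ
    ∑T f = ∑ λ v → ∑∑ λ u w → ⟦ T v u w ⟧ * f v u w

    ∑T-cyclic : ∀ f → ∑T f ≡ ∑T (λ v u w → f u w v)
    ∑T-cyclic f = trans (∑-cong λ v → ∑-cong λ u → ∑-cong λ w → cong (λ b → ⟦ b ⟧ * f v u w) (T-cyclic v u w))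
      (trans (∑-cong λ v → ∑-swap λ u w → ⟦ T w v u ⟧ * f v u w)
        (∑-swap λ v w → ∑ λ u → ⟦ T w v u ⟧ * f v u w))

    ∑T-+ : ∀ f g → ∑T (λ v u w → f v u w + g v u w) ≡ ∑T f + ∑T g
    ∑T-+ f g = trans (∑-cong λ v → trans (∑-cong λ u → trans (∑-cong λ w → ℕₚ.*-distribˡ-+ ⟦ T v u w ⟧ _ _)
      (∑-+ _ _)) (∑-+ _ _)) (∑-+ _ _)

    private
      corner : V → V → ℕ
      corner a b = ∑ λ w → ⟦ T b a w ⟧

      weight : Fin L → V → V → ℕ
      weight l a b = ⟦ A K a b ∧ lab a b == l ⟧ * (3 + corner a b)

      weight-3 : ∀ {l a b} → A K a b ≡ true → lab a b ≡ l → 3 ≤ weight l a b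
      weight-3 {l} {a} {b} h e rewrite ∧-intro h (≡⇒== e) = ℕₚ.≤-trans (ℕₚ.m≤m+n 3 _) (ℕₚ.m≤m+n _ 0)

      weight-4 : ∀ {l a b w} → A K a b ≡ true → lab a b ≡ l → T b a w ≡ true → 4 ≤ weight l a b
      weight-4 {l} {a} {b} {w} h e t rewrite ∧-intro h (≡⇒== e) =
        ℕₚ.≤-trans (ℕₚ.+-monoʳ-≤ 3 (∃-∑ {f = T b a} w t)) (ℕₚ.m≤m+n _ 0)

      -- a face is either a triangle, with three darts of weight 4, or has four darts of weight 3
      face-weight : ∀ l → used (A K) lab l ≡ true → 12 ≤ ∑∑ (weight l)
      face-weight l h = by (y ≟ a) (s ≟ b)
        where
        dart = used-elim {A = A K} {lab} h
        a = proj₁ dart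
        b = proj₁ (proj₂ dart)
        w = rot b a
        y = rot w b
        s = rot y w
        ab = proj₁ (proj₂ (proj₂ dart))
        l₀ = proj₂ (proj₂ (proj₂ dart))
        bw : A K b w ≡ true
        bw = rot-A b a (A-sym K a b ab)
        l₁ : lab b w ≡ l
        l₁ = trans (lab-φ a b ab) l₀
        wy : A K w y ≡ true
        wy = rot-A w b (A-sym K b w bw)
        l₂ : lab w y ≡ l
        l₂ = trans (lab-φ b w bw) l₁
        ys : A K y s ≡ true
        ys = rot-A y w (A-sym K w y wy)
        l₃ : lab y s ≡ l
        l₃ = trans (lab-φ w y wy) l₂
        a≢b = A-≢ K {a} {b} ab
        b≢w = A-≢ K {b} {w} bw
        w≢y = A-≢ K {w} {y} wy
        g g₁ g₂ : V → V → ℕ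
        g = weight l
        g₁ = erase g a b
        g₂ = erase g₁ b w
        triangle : y ≡ a → s ≡ b → 12 ≤ ∑∑ g
        triangle y≡a s≡b = ≤-resp₂ refl peel (ℕₚ.+-mono-≤ (weight-4 ab l₀ t₀)
          (ℕₚ.+-mono-≤ (weight-4 bw l₁ (T-rotate t₀))
            (ℕₚ.≤-trans (≤-resp₂ refl (trans (erase-≢ {g₁} {b} {w} λ e _ → b≢w (≡.sym e))
                (erase-≢ {g} {a} {b} λ _ e → a≢b (trans (≡.sym y≡a) e)))
                (weight-4 wy l₂ (subst (λ z → T z w b ≡ true) (≡.sym y≡a) (T-rotate (T-rotate t₀)))))
              (ℕₚ.m≤m+n _ (∑∑ (erase g₂ w y))))))
          where
          t₀ : T b a w ≡ true
          t₀ = T-intro (A-sym K a b ab) refl y≡a (trans (cong (λ z → rot z w) (≡.sym y≡a)) s≡b)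
          peel : ∑∑ g ≡ g a b + (g b w + (g₂ w y + ∑∑ (erase g₂ w y)))
          peel = trans (≡.sym (∑∑-peel g a b)) (cong (g a b +_) (trans (≡.sym (∑∑-peel g₁ b w))
            (cong₂ _+_ (erase-≢ {g} {a} {b} λ e _ → a≢b (≡.sym e)) (≡.sym (∑∑-peel g₂ w y)))))
        -- As no rotation has a fixed point, the walk never turns back; the four darts can only
        -- coincide by a return to a b after three steps, that is, for a triangle.
        long : (y ≡ a → s ≡ b → ⊥) → 12 ≤ ∑∑ g
        long ne = ≤-resp₂ refl peel (ℕₚ.+-mono-≤ (weight-3 ab l₀) (ℕₚ.+-mono-≤ (weight-3 bw l₁)
          (ℕₚ.+-mono-≤ (weight-3 wy l₂) (ℕₚ.≤-trans (weight-3 ys l₃) (ℕₚ.m≤m+n _ (∑∑ (erase g₃ y s)))))))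
          where
          g₃ = erase g₂ w y
          peel : ∑∑ g ≡ g a b + (g b w + (g w y + (g y s + ∑∑ (erase g₃ y s))))
          peel = trans (≡.sym (∑∑-peel g a b)) (cong (g a b +_) (trans (≡.sym (∑∑-peel g₁ b w))
            (cong₂ _+_ (erase-≢ {g} {a} {b} λ e _ → a≢b (≡.sym e)) (trans (≡.sym (∑∑-peel g₂ w y))
              (cong₂ _+_ (trans (erase-≢ {g₁} {b} {w} λ e _ → b≢w (≡.sym e))
                                (erase-≢ {g} {a} {b} λ e _ → no-fix (A-sym K a b ab) e))
                (trans (≡.sym (∑∑-peel g₃ y s)) (cong (_+ ∑∑ (erase g₃ y s))
                  (trans (erase-≢ {g₂} {w} {y} λ e _ → w≢y (≡.sym e))
                    (trans (erase-≢ {g₁} {b} {w} λ e _ → no-fix (A-sym K b w bw) e)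
                      (erase-≢ {g} {a} {b} ne))))))))))
        by : Dec (y ≡ a) → Dec (s ≡ b) → 12 ≤ ∑∑ g
        by (yes p) (yes q) = triangle p q
        by (no p)  _       = long λ e _ → p e
        by (yes _) (no q)  = long λ _ e → q e

      ∑-weight : ∑ (λ l → ∑∑ (weight l)) ≡ ∑∑ (λ a b → ⟦ A K a b ⟧ * (3 + corner a b))
      ∑-weight = trans (∑-swap λ l a → ∑ (weight l a)) (∑-cong λ a → trans (∑-swap λ l b → weight l a b) (∑-cong λ b →
        trans (∑-cong λ l → cong (_* (3 + corner a b)) (trans (⟦∧⟧ (A K a b) _)
            (trans (ℕₚ.*-comm ⟦ A K a b ⟧ _) (cong (λ p → ⟦ p ⟧ * ⟦ A K a b ⟧) (flip l (lab a b))))))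
          (trans (∑-*ʳ (3 + corner a b) _) (cong (_* (3 + corner a b)) (∑-δ (λ _ → ⟦ A K a b ⟧) (lab a b))))))
        where
        flip : ∀ (l k : Fin L) → k == l ≡ l == k
        flip l k = true-≡ {k == l} {l == k} (λ e → ≡⇒== (≡.sym (==⇒≡ {a = k} e))) (λ e → ≡⇒== (≡.sym (==⇒≡ {a = l} e)))

      A-corner : ∀ a b → ⟦ A K a b ⟧ * (3 + corner a b) ≡ 3 * ⟦ A K a b ⟧ + corner a b
      A-corner a b with true? (A K a b)
      ... | yes h rewrite h = ℕₚ.+-identityʳ _
      ... | no ¬h = trans (cong (_* (3 + corner a b)) (⟦⟧-false ¬h)) (≡.sym (cong₂ _+_ (cong (3 *_) (⟦⟧-false ¬h))
          (∑-zero λ w → ⟦⟧-false λ t → ¬h (A-sym K b a (T-vu t)))))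

    -- With f used labels and t triangular corners, the weights give 12 f ≤ 3 d + t for d darts.
    -- Adding 36 times Euler's inequality to 6 times this one eliminates f; 72 is four times 18, and
    -- 6 is a third of 18 because a triangle has three corners.
    edges≤ : 18 * ∑ (deg K) ≤ 72 * size K + 6 * ∑T (λ _ _ _ → 1)
    edges≤ = arith (∑ (deg K)) (size K) _ (∑T λ _ _ _ → 1) euler
      (≤-resp₂ (≡.sym (∑-*ˡ 12 _)) total (∑-mono λ l → faces l (true? (used (A K) lab l))))
      where
      faces : ∀ l → Dec (used (A K) lab l ≡ true) → 12 * ⟦ used (A K) lab l ⟧ ≤ ∑∑ (weight l)
      faces l (yes h) = ≤-resp₂ (cong (12 *_) (⟦⟧-true h)) refl (face-weight l h)
      faces l (no ¬h) = ≤-resp₂ (cong (12 *_) (⟦⟧-false ¬h)) refl z≤n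
      total : 3 * ∑ (deg K) + ∑T (λ _ _ _ → 1) ≡ ∑ (λ l → ∑∑ (weight l))
      total = ≡.sym (trans ∑-weight (trans (∑-cong λ a → ∑-cong λ b → A-corner a b) (trans (∑-cong λ a → ∑-+ _ _)
        (trans (∑-+ _ _) (cong₂ _+_ (trans (∑-cong λ a → ∑-*ˡ 3 _) (∑-*ˡ 3 _))
          (trans (∑-swap corner) (∑-cong λ b → ∑-cong λ a → ∑-cong λ w → ≡.sym (ℕₚ.*-identityʳ _))))))))
      arith : ∀ d n f t → d ≤ 2 * (n + f) → 12 * f ≤ 3 * d + t → 18 * d ≤ 72 * n + 6 * t
      arith d n f t h₁ h₂ = lin (36 ⊛ h₁ ⊕ 6 ⊛ h₂) 0 (solve (d ∷ n ∷ f ∷ t ∷ []))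

-- Discharging: the balance at a single vertex

at-most-one : ∀ {m} {f : Fin m → Bool} {b} → (∀ i j → f i ≡ true → f j ≡ true → i ≡ j) →
  (∀ i → f i ≡ true → b ≡ true) → ∑ (λ i → ⟦ f i ⟧) ≤ ⟦ b ⟧
at-most-one {f = f} {b} uniq h with Finₚ.any? (λ i → true? (f i))
... | yes (i , fi) = ≤-resp₂ refl (⟦⟧-true (h i fi)) (ℕₚ.≤-trans
        (∑-mono λ j → true-≤ {f j} {j == i} λ fj → ≡⇒== (uniq j i fj fi)) (ℕₚ.≤-reflexive (∑-δ₁ i)))
... | no none      = ≤-resp₂ (∑-zero λ i → ⟦⟧-false λ fi → none (i , fi)) refl z≤n

∧-xor : ∀ p q → 2 * ⟦ p ∧ q ⟧ + ⟦ p xor q ⟧ ≡ ⟦ p ⟧ + ⟦ q ⟧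
∧-xor true  true  = refl
∧-xor true  false = refl
∧-xor false true  = refl
∧-xor false false = refl

infix 7 _=ℕ_
_=ℕ_ : ℕ → ℕ → Bool
zero  =ℕ zero  = true
zero  =ℕ suc b = false
suc a =ℕ zero  = false
suc a =ℕ suc b = a =ℕ b

=ℕ⇒≡ : ∀ a b → a =ℕ b ≡ true → a ≡ b
=ℕ⇒≡ zero    zero    h = refl
=ℕ⇒≡ (suc a) (suc b) h = cong suc (=ℕ⇒≡ a b h)

≡⇒=ℕ : ∀ {a b} → a ≡ b → a =ℕ b ≡ true
≡⇒=ℕ {zero}  refl = refl
≡⇒=ℕ {suc a} refl = ≡⇒=ℕ {a} refl

even-six : ∀ d → 6 ≤ d → odd d ≡ false → d ≡ 6 ⊎ 8 ≤ d
even-six 6 _ _ = inj₁ refl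
even-six (suc (suc (suc (suc (suc (suc (suc (suc d)))))))) _ _ = inj₂ (ℕₚ.m≤m+n 8 d)
even-six 0 () _
even-six 1 (s≤s ()) _
even-six 2 (s≤s (s≤s ())) _
even-six 3 (s≤s (s≤s (s≤s ()))) _
even-six 4 (s≤s (s≤s (s≤s (s≤s ())))) _
even-six 5 (s≤s (s≤s (s≤s (s≤s (s≤s ()))))) _

-- In the next lemmas a, b, c count the triangular corners at a hard vertex of degree k + s with k hard and
-- s other neighbours, according to whether two, one or none of the two sides lead to a hard neighbour.

balance₀ : ∀ a b c k s → 2 * a + b ≤ k → b + 2 * c ≤ 2 * s → 8 ≤ (k + s) + k → 6 ≤ k + s →
  73 + (6 * a + (8 * b + 6 * c)) ≤ 18 * (k + s)
balance₀ a b c k s h₁ h₂ h₃ h₄ = lin (5 ⊛ h₁ ⊕ 3 ⊛ h₂ ⊕ h₃ ⊕ 11 ⊛ h₄) (4 * a + 1) (solve (a ∷ b ∷ c ∷ k ∷ s ∷ []))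

balance₁-8 : ∀ a b c → 2 * a + b ≤ 1 → b + 2 * c ≤ 14 → c + 1 ≤ 7 → 73 + (6 * a + (8 * b + 10 * c)) ≤ 144
balance₁-8 a b c h₁ h₂ h₃ = lin (8 ⊛ h₁ ⊕ 10 ⊛ h₃) (10 * a + 3) (solve (a ∷ b ∷ c ∷ []))

-- The subscript in these names is the excess of degree plus hard degree over 8, with 2 for anything
-- from 2 on, and the last number is the (least) degree. The bound 73 means a positive final charge;
-- here it is only 72, for a = 0 and b = c = 2 give equality.
balance₁-6 : ∀ a b c → 2 * a + b ≤ 3 → b + 2 * c ≤ 6 → c + 1 ≤ 3 → 72 + (6 * a + (8 * b + 10 * c)) ≤ 108
balance₁-6 a b 0 h₁ h₂ h₃ = lin (8 ⊛ h₁) (10 * a + 12) (solve (a ∷ b ∷ []))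
balance₁-6 a b 1 h₁ h₂ h₃ = lin (8 ⊛ h₁) (10 * a + 2) (solve (a ∷ b ∷ []))
balance₁-6 0 b 2 h₁ h₂ h₃ = lin (8 ⊛ h₂) 0 (solve (b ∷ []))
balance₁-6 (suc a) b 2 h₁ h₂ h₃ = lin (8 ⊛ h₁) (10 * a + 2) (solve (a ∷ b ∷ []))
balance₁-6 a b (suc (suc (suc c))) h₁ h₂ h₃ = ⊥-elim (ℕₚ.<-irrefl refl (lin {a = 4} {3} h₃ c (solve (c ∷ []))))

balance₂-8 : ∀ a b c k s → 2 * a + b ≤ k → b + 2 * c ≤ 2 * s → 10 ≤ (k + s) + k → 8 ≤ k + s →
  73 + (9 * a + (8 * b + 10 * c)) ≤ 18 * (k + s)
balance₂-8 a b c k s h₁ h₂ h₃ h₄ = lin (5 ⊛ h₁ ⊕ 5 ⊛ h₂ ⊕ 5 ⊛ h₃ ⊕ 3 ⊛ h₄) (a + 2 * b + 1)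
  (solve (a ∷ b ∷ c ∷ k ∷ s ∷ []))

balance₂-6 : ∀ a b c k s → k + s ≡ 6 → 2 * a + b ≤ k → b + 2 * c ≤ 2 * s → 10 ≤ (k + s) + k →
  (1 ≤ s → c + 1 ≤ s) → 73 + (9 * a + (8 * b + 10 * c)) ≤ 108
balance₂-6 a b c k 0 e h₁ h₂ h₃ h₄ with trans (≡.sym (ℕₚ.+-identityʳ k)) e
... | refl = lin (5 ⊛ h₁ ⊕ 5 ⊛ h₂) (a + 2 * b + 5) (solve (a ∷ b ∷ c ∷ []))
balance₂-6 a b c k 1 e h₁ h₂ h₃ h₄ with ℕₚ.+-cancelʳ-≡ 1 k 5 e
... | refl = lin (5 ⊛ h₁ ⊕ 5 ⊛ h₂) (a + 2 * b) (solve (a ∷ b ∷ c ∷ []))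
balance₂-6 a b c k 2 e h₁ h₂ h₃ h₄ with ℕₚ.+-cancelʳ-≡ 2 k 4 e
balance₂-6 a b 0 k 2 e h₁ h₂ h₃ h₄ | refl = lin (8 ⊛ h₁) (7 * a + 3) (solve (a ∷ b ∷ []))
balance₂-6 a b 1 k 2 e h₁ h₂ h₃ h₄ | refl = lin halved 0 (solve (a ∷ b ∷ []))
  where
  -- The multipliers of the two hypotheses are 9/2 and 7/2, so the inequality is proved doubled.
  halved : 9 * a + 8 * b ≤ 25
  halved = ℕₚ.*-cancelˡ-≤ 2 (lin {a = 2 * (9 * a + 8 * b)} {2 * 25} (9 ⊛ h₁ ⊕ 7 ⊛ h₂) 0 (solve (a ∷ b ∷ [])))
balance₂-6 a b (suc (suc c)) k 2 e h₁ h₂ h₃ h₄ | refl =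
  ⊥-elim (ℕₚ.<-irrefl refl (lin {a = 3} {2} (h₄ (s≤s z≤n)) c (solve (c ∷ []))))
balance₂-6 a b c k (suc (suc (suc s))) e h₁ h₂ h₃ h₄ =
  ⊥-elim (ℕₚ.<-irrefl refl (lin {a = 16} {15} (h₃ ⊕ 2 ⊛ ℕₚ.≤-reflexive e) s (solve (k ∷ s ∷ []))))

-- Charges and transfers

module _ {N : ℕ} where
  private
    V : Set
    V = Fin N

  open Mixed

  record Irreducible (K : Mixed N) : Set where
    field
      light : ∀ v → alive K v ≡ true → 8 ≤ deg K v + hdeg K v
      pair  : ∀ x y z → hard K y ≡ true → R K x y ≡ true → A K x z ≡ true → A K y z ≡ true →
              deg K x + hdeg K x ≤ 8 → ¬ (deg K y + hdeg K y ≤ 8 + ⟦ hard K x ⟧)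
      triangle : ∀ x u w z → hard K x ≡ false → hard K u ≡ true → hard K w ≡ true →
              R K x u ≡ true → R K x w ≡ true → R K u w ≡ true → A K x z ≡ true → A K w z ≡ true → z ≢ u →
              deg K x + hdeg K x ≤ 8 → deg K u + hdeg K u ≤ 9 → ¬ (deg K w + hdeg K w ≤ 9)
      fours : ∀ u v → R K u v ≡ true → hard K u ≡ true → hard K v ≡ true → deg K u ≡ 4 → ¬ (deg K v ≡ 4)

  module Balance (K : Mixed N) (irr : Irreducible K) where
    open Irreducible irr

    hd : V → Bool
    hd = hard K

    hdeg≤rdeg : ∀ v → hdeg K v ≤ rdeg K v
    hdeg≤rdeg v = ∑-mono λ u → true-≤ ∧-elimˡ

    rdeg≤deg : ∀ v → rdeg K v ≤ deg K v
    rdeg≤deg v = ∑-mono λ u → true-≤ (R⇒A K {v} {u})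

    hdeg≤deg : ∀ v → hdeg K v ≤ deg K v
    hdeg≤deg v = ℕₚ.≤-trans (hdeg≤rdeg v) (rdeg≤deg v)

    deg≥ : ∀ v → alive K v ≡ true → 4 ≤ deg K v
    deg≥ v al = ℕₚ.*-cancelˡ-≤ 2 (arith (deg K v) _ (light v al) (hdeg≤deg v))
      where
      arith : ∀ d h → 8 ≤ d + h → h ≤ d → 2 * 4 ≤ 2 * d
      arith d h h₁ h₂ = lin (h₁ ⊕ h₂) 0 (solve (d ∷ h ∷ []))

    open Faces K deg≥ public

    alive-l : ∀ {v u} → A K v u ≡ true → alive K v ≡ true
    alive-l {v} {u} = A-alive K v u

    alive-r : ∀ {v u} → A K v u ≡ true → alive K u ≡ true
    alive-r {v} {u} h = A-alive K u v (A-sym K v u h)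

    all-hard : ∀ {v} → deg K v ≤ hdeg K v → ∀ {u} → A K v u ≡ true → hd u ≡ true
    all-hard {v} le {u} h = ∧-elimʳ {R K v u} (⟦⟧-pos (ℕₚ.≤-reflexive (trans (≡.sym (⟦⟧-true h))
      (≡.sym (∑-eq (λ u → true-≤ {R K v u ∧ hd u} (R⇒A K {v} {u} ∘ ∧-elimˡ)) le u)))))

    all-real-hard : ∀ {v} → rdeg K v ≤ hdeg K v → ∀ {u} → R K v u ≡ true → hd u ≡ true
    all-real-hard {v} le {u} h = ∧-elimʳ {R K v u} (⟦⟧-pos (ℕₚ.≤-reflexive (trans (≡.sym (⟦⟧-true h))
      (≡.sym (∑-eq (λ u → true-≤ {R K v u ∧ hd u} ∧-elimˡ) le u)))))

    four-hdeg : ∀ {v} → alive K v ≡ true → deg K v ≡ 4 → 4 ≤ hdeg K v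
    four-hdeg {v} al e = ℕₚ.+-cancelˡ-≤ 4 4 _ (subst (λ d → 8 ≤ d + hdeg K v) e (light v al))

    -- Since degree plus hard degree is at least 8, a vertex of degree four has hard degree four,
    -- which takes up all its edges.
    four-nbr : ∀ {v u} → deg K v ≡ 4 → A K v u ≡ true → hd u ≡ true
    four-nbr {v} {u} e h = all-hard (subst (_≤ hdeg K v) (≡.sym e) (four-hdeg (alive-l h) e)) h

    four-hard : ∀ {v} → alive K v ≡ true → deg K v ≡ 4 → hd v ≡ true
    four-hard {v} al e = hard-intro K {v} s0 (cong odd r4)
      where
      r≥ : 4 ≤ rdeg K v
      r≥ = ℕₚ.≤-trans (four-hdeg al e) (hdeg≤rdeg v)
      r4 : rdeg K v ≡ 4
      r4 = ℕₚ.≤-antisym (subst (rdeg K v ≤_) e (rdeg≤deg v)) r≥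
      s0 : sdeg K v ≡ 0
      s0 = ℕₚ.+-cancelˡ-≡ 4 _ 0 (trans (cong (_+ sdeg K v) (≡.sym r4)) (trans (≡.sym (deg-split K v)) e))

    hard-rdeg : ∀ {v} → hd v ≡ true → deg K v ≡ rdeg K v
    hard-rdeg {v} h = trans (deg-split K v) (trans (cong (rdeg K v +_) (hard-sdeg K {v} h)) (ℕₚ.+-identityʳ _))

    hard-deg-even : ∀ {v} → hd v ≡ true → odd (deg K v) ≡ false
    hard-deg-even {v} h = trans (cong odd (hard-rdeg h)) (hard-even K {v} h)

    -- The charges: every edge endpoint brings 18 and every vertex costs 72; a triangular corner costs 6.
    -- In a triangle a b c, the vertex a gives 3 to b if b has degree 4, and 2 if a is hard and b has degree 5,
    -- a constraint edge, and either two of those or a real edge to c.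
    opaque
      pay₃ : V → V → Bool
      pay₃ a b = (deg K b =ℕ 4) ∧ not (deg K a =ℕ 4)

      pay₃-elim : ∀ {a b} → pay₃ a b ≡ true → deg K b ≡ 4 × deg K a ≢ 4
      pay₃-elim {a} {b} h = =ℕ⇒≡ (deg K b) 4 (∧-elimˡ h) , λ e → not-elim (∧-elimʳ {deg K b =ℕ 4} h) (≡⇒=ℕ e)

      pay₃-intro : ∀ {a b} → deg K b ≡ 4 → deg K a ≢ 4 → pay₃ a b ≡ true
      pay₃-intro {a} {b} p q = ∧-intro (≡⇒=ℕ p) (not-intro λ h → q (=ℕ⇒≡ (deg K a) 4 h))

      pay₂ : V → V → V → Bool
      pay₂ a b c = hd a ∧ ((deg K b =ℕ 5) ∧ (positive (sdeg K b) ∧ ((sdeg K b =ℕ 2) ∨ R K b c)))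

      pay₂-intro : ∀ {a b c} → hd a ≡ true → deg K b ≡ 5 → 1 ≤ sdeg K b → sdeg K b ≡ 2 ⊎ R K b c ≡ true →
        pay₂ a b c ≡ true
      pay₂-intro {a} {b} {c} h d s e = ∧-intro h (∧-intro (≡⇒=ℕ d) (∧-intro (positive-intro s) (case e of λ where
        (inj₁ p) → ∨-introˡ (≡⇒=ℕ p)
        (inj₂ r) → ∨-introʳ {p = sdeg K b =ℕ 2} r)))

      pay₂-elim : ∀ {a b c} → pay₂ a b c ≡ true →
        hd a ≡ true × deg K b ≡ 5 × 1 ≤ sdeg K b × (sdeg K b ≡ 2 ⊎ R K b c ≡ true)
      pay₂-elim {a} {b} {c} h =
        let p , q , r , s = ∧-elim₄ {hd a} {deg K b =ℕ 5} {positive (sdeg K b)} h in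
        p , =ℕ⇒≡ (deg K b) 5 q , positive-elim r , (case ∨-elim {sdeg K b =ℕ 2} s of λ where
          (inj₁ e) → inj₁ (=ℕ⇒≡ (sdeg K b) 2 e)
          (inj₂ e) → inj₂ e)

    fl : V → V → V → ℕ
    fl a b c = 3 * ⟦ pay₃ a b ⟧ + 2 * ⟦ pay₂ a b c ⟧

    out inn : V → V → V → ℕ
    out v u w = fl v u w + fl v w u
    inn v u w = fl u v w + fl w v u

    C : V → (V → V → ℕ) → ℕ
    C v φ = ∑∑ λ u w → ⟦ T v u w ⟧ * φ u w

    C-mono : ∀ {v φ ψ} → (∀ u w → T v u w ≡ true → φ u w ≤ ψ u w) → C v φ ≤ C v ψ
    C-mono {v} {φ} {ψ} h = ∑-mono λ u → ∑-mono λ w → by u w (true? (T v u w))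
      where
      by : ∀ u w → Dec (T v u w ≡ true) → ⟦ T v u w ⟧ * φ u w ≤ ⟦ T v u w ⟧ * ψ u w
      by u w (yes t) = ℕₚ.*-monoʳ-≤ ⟦ T v u w ⟧ (h u w t)
      by u w (no ¬t) = ≤-resp₂ (cong (_* φ u w) (⟦⟧-false ¬t)) refl z≤n

    C-+ : ∀ v φ ψ → C v (λ u w → φ u w + ψ u w) ≡ C v φ + C v ψ
    C-+ v φ ψ = trans (∑-cong λ u → trans (∑-cong λ w → ℕₚ.*-distribˡ-+ ⟦ T v u w ⟧ _ _) (∑-+ _ _)) (∑-+ _ _)

    C-* : ∀ v k φ → C v (λ u w → k * φ u w) ≡ k * C v φ
    C-* v k φ = trans (∑-cong λ u → trans (∑-cong λ w → comm ⟦ T v u w ⟧ (φ u w)) (∑-*ˡ k _)) (∑-*ˡ k _)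
      where
      comm : ∀ a b → a * (k * b) ≡ k * (a * b)
      comm a b = solve (a ∷ k ∷ b ∷ [])

    -- Each side of v bounds at most one corner before and one after it.
    module _ (v : V) (q : V → V → Bool) (b : V → Bool)
             (hb : ∀ u w → T v u w ≡ true → q u w ≡ true → b u ≡ true)
             (hb′ : ∀ u w → T v w u ≡ true → q u w ≡ true → b u ≡ true) where
      private
        s⁺ s⁻ : V → ℕ
        s⁺ u = ∑ λ w → ⟦ T v u w ∧ q u w ⟧
        s⁻ u = ∑ λ x → ⟦ T v x u ∧ q u x ⟧

        split : C v (λ u w → ⟦ q u w ⟧ + ⟦ q w u ⟧) ≡ ∑ λ u → s⁺ u + s⁻ u
        split = trans (C-+ v (λ u w → ⟦ q u w ⟧) (λ u w → ⟦ q w u ⟧)) (trans (cong₂ _+_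
          (∑-cong λ u → ∑-cong λ w → ≡.sym (⟦∧⟧ (T v u w) (q u w)))
          (trans (∑-swap λ u w → ⟦ T v u w ⟧ * ⟦ q w u ⟧)
            (∑-cong λ w → ∑-cong λ u → ≡.sym (⟦∧⟧ (T v u w) (q w u))))) (≡.sym (∑-+ s⁺ s⁻)))

        s⁺≤ : ∀ u → s⁺ u ≤ ⟦ b u ⟧
        s⁺≤ u = at-most-one {f = λ w → T v u w ∧ q u w} (λ i j hi hj → T-fun (∧-elimˡ hi) (∧-elimˡ hj))
          λ w h → hb u w (∧-elimˡ h) (∧-elimʳ {T v u w} h)

        s⁻≤ : ∀ u → s⁻ u ≤ ⟦ b u ⟧
        s⁻≤ u = at-most-one {f = λ x → T v x u ∧ q u x} (λ i j hi hj → T-fun′ (∧-elimˡ hi) (∧-elimˡ hj))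
          λ x h → hb′ u x (∧-elimˡ h) (∧-elimʳ {T v x u} h)

      slot₂ : C v (λ u w → ⟦ q u w ⟧ + ⟦ q w u ⟧) ≤ 2 * ∑ (λ u → ⟦ b u ⟧)
      slot₂ = ≤-resp₂ split (≡.sym (∑-*ˡ 2 _)) (∑-mono λ u → ≤-resp₂ refl (cong (⟦ b u ⟧ +_) (ℕₚ.+-identityʳ _))
        (ℕₚ.+-mono-≤ (s⁺≤ u) (s⁻≤ u)))

      -- A side whose two corners are never both selected counts once instead of twice. In each
      -- application `excl` rests on `no-real-pair`: this is where the absence of adjacent real
      -- triangles enters the count.
      slot₁ : (∀ u w x → T v u w ≡ true → q u w ≡ true → T v x u ≡ true → q u x ≡ true → ⊥) →
        C v (λ u w → ⟦ q u w ⟧ + ⟦ q w u ⟧) ≤ ∑ (λ u → ⟦ b u ⟧)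
      slot₁ excl = ≤-resp₂ split refl (∑-mono λ u → by u (Finₚ.any? λ x → true? (T v x u ∧ q u x)))
        where
        by : ∀ u → Dec (∃ λ x → T v x u ∧ q u x ≡ true) → s⁺ u + s⁻ u ≤ ⟦ b u ⟧
        by u (no none) = ≤-resp₂ (trans (cong (s⁺ u +_) (∑-zero λ x → ⟦⟧-false λ h → none (x , h))) (ℕₚ.+-identityʳ _))
          refl (s⁺≤ u)
        by u (yes (x , h)) = ≤-resp₂ (cong (_+ s⁻ u) (∑-zero λ w → ⟦⟧-false λ h′ →
          excl u w x (∧-elimˡ h′) (∧-elimʳ {T v u w} h′) (∧-elimˡ h) (∧-elimʳ {T v x u} h))) refl (s⁻≤ u)

    -- consecutive real triangles would share the edge v u
    no-real-pair : ∀ {v u w x} → R K v u ≡ true → R K v w ≡ true → R K v x ≡ true → R K u w ≡ true → R K u x ≡ true →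
      T v u w ≡ true → T v x u ≡ true → ⊥
    no-real-pair {v} {u} {w} {x} vu vw vx uw ux t t′ =
      no-digon t (subst (λ x → T v x u ≡ true) (≡.sym (noadj K v u w x vu vw uw vx ux)) t′)

    -- Expenses and receipts of v in eighteenths, kept on two sides to avoid subtraction:
    -- `lhs v ≤ rhs v` means that v does not end up negative.
    lhs rhs : V → ℕ
    lhs v = 72 * ⟦ alive K v ⟧ + C v (λ u w → 6 + out v u w)
    rhs v = 18 * deg K v + C v (inn v)

    rhs≤lhs : ∑ rhs ≤ ∑ lhs
    rhs≤lhs = ≤-resp₂
      (trans (∑-+ (λ v → 18 * deg K v) _) (cong (_+ ∑T inn) (∑-*ˡ 18 (deg K))))
      (trans (∑-+ (λ v → 72 * ⟦ alive K v ⟧) _) (cong₂ _+_ (∑-*ˡ 72 _) (trans (∑T-+ (λ _ _ _ → 6) out)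
        (cong₂ _+_ six (trans (∑T-+ (λ v u w → fl v u w) (λ v u w → fl v w u)) (trans (ℕₚ.+-comm (∑T λ v u w → fl v u w) (∑T λ v u w → fl v w u)) flow))))))
      (ℕₚ.≤-trans (ℕₚ.+-monoˡ-≤ (∑T inn) edges≤) (ℕₚ.≤-reflexive (ℕₚ.+-assoc (72 * size K) _ _)))
      where
      six : ∑T (λ _ _ _ → 6) ≡ 6 * ∑T (λ _ _ _ → 1)
      six = trans (∑-cong λ v → C-* v 6 (λ _ _ → 1)) (∑-*ˡ 6 _)
      -- A transfer is booked at the corner of its giver and at the corner of its receiver in the
      -- same triangle; turning the triangle matches the two.
      flow : ∑T (λ v u w → fl v w u) + ∑T (λ v u w → fl v u w) ≡ ∑T inn
      flow = trans (cong₂ _+_ (∑T-cyclic (λ v u w → fl v w u)) (trans (∑T-cyclic (λ v u w → fl v u w)) (∑T-cyclic (λ v u w → fl u w v))))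
        (≡.sym (∑T-+ (λ v u w → fl u v w) (λ v u w → fl w v u)))

    C-6+ : ∀ v φ → C v (λ u w → 6 + φ u w) ≡ 6 * C v (λ _ _ → 1) + C v φ
    C-6+ v φ = trans (C-+ v (λ _ _ → 6) φ) (cong (_+ C v φ) (C-* v 6 (λ _ _ → 1)))

    corners≤deg : ∀ v → C v (λ _ _ → 1) ≤ deg K v
    corners≤deg v = ∑-mono λ u → ≤-resp₂ (∑-cong λ w → ℕₚ.*-identityʳ _) refl
      (at-most-one {f = T v u} (λ i j → T-fun) (λ w → T-vu))

-- Hard vertices of degree at least six

module _ {N : ℕ} where
  private
    V : Set
    V = Fin N

  open Mixed

  module HardBalance (K : Mixed N) (irr : Irreducible K) where
    open Irreducible irr
    open Balance K irr

    pay₂-soft : ∀ {a b c} → pay₂ a b c ≡ true → hd b ≡ false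
    pay₂-soft {a} {b} h = let _ , _ , s , _ = pay₂-elim h in
      ¬true⇒false λ hb → case subst (1 ≤_) (hard-sdeg K {b} hb) s of λ ()

    pay₃-hard : ∀ {v u w} → T v u w ≡ true → pay₃ v u ≡ true → hd u ≡ true × hd w ≡ true
    pay₃-hard {v} {u} {w} t p = let d , _ = pay₃-elim p in four-hard (alive-r (T-vu t)) d , four-nbr d (T-uw t)

    four-light : ∀ {u} → deg K u ≡ 4 → deg K u + hdeg K u ≤ 8
    four-light {u} d = ℕₚ.≤-trans (ℕₚ.+-monoʳ-≤ (deg K u) (hdeg≤deg u)) (ℕₚ.≤-reflexive (cong₂ _+_ d d))

    two-light : ∀ {u} → deg K u ≡ 5 → sdeg K u ≡ 2 → deg K u + hdeg K u ≤ 8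
    two-light {u} d s = arith (deg K u) (rdeg K u) (hdeg K u) (sdeg K u) (deg-split K u) (hdeg≤rdeg u) d s
      where
      arith : ∀ d r h s → d ≡ r + s → h ≤ r → d ≡ 5 → s ≡ 2 → d + h ≤ 8
      arith d r h s e h≤r d5 refl = lin (h≤r ⊕ 2 ⊛ ℕₚ.≤-reflexive d5 ⊕ ℕₚ.≤-reflexive (≡.sym e)) 0 (solve (d ∷ r ∷ h ∷ []))

    module HardVertex (v : V) (hv : hd v ≡ true) (al : alive K v ≡ true) where

      s : ℕ
      s = ∑ λ u → ⟦ A K v u ∧ not (hd u) ⟧

      k+s : hdeg K v + s ≡ deg K v
      k+s = trans (≡.sym (∑-+ _ _)) (∑-cong pt)
        where
        pt : ∀ u → ⟦ R K v u ∧ hd u ⟧ + ⟦ A K v u ∧ not (hd u) ⟧ ≡ ⟦ A K v u ⟧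
        pt u with R K v u in r | F K v u in f | hd u
        ... | true  | _     | true  = refl
        ... | true  | _     | false = refl
        ... | false | true  | _     = false≢true r (hard-R K {v} hv {u} (F⇒A K {v} {u} f))
        ... | false | false | _     = refl

      R-edge : ∀ {u} → A K v u ≡ true → R K v u ≡ true
      R-edge {u} = hard-R K {v} hv {u}

      hh hs ss : V → V → ℕ
      hh u w = ⟦ hd u ∧ hd w ⟧
      hs u w = ⟦ hd u xor hd w ⟧
      ss u w = ⟦ not (hd u) ∧ not (hd w) ⟧

      HH HS SS : ℕ
      HH = C v hh
      HS = C v hs
      SS = C v ss

      C-cong : ∀ {φ ψ} → (∀ u w → φ u w ≡ ψ u w) → C v φ ≡ C v ψ
      C-cong h = ∑-cong λ u → ∑-cong λ w → cong (⟦ T v u w ⟧ *_) (h u w)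

      -- All edges at v and at a hard neighbour u are real, so triangular faces on both sides of v u
      -- would be adjacent real triangles: a side towards a hard neighbour bounds at most one
      -- triangular corner.
      hard-slots : 2 * HH + HS ≤ hdeg K v
      hard-slots = ≤-resp₂ (trans (cong (_+ HS) (≡.sym (C-* v 2 hh))) (trans (≡.sym (C-+ v (λ u w → 2 * hh u w) hs))
          (C-cong λ u w → ∧-xor (hd u) (hd w)))) refl
        (slot₁ v (λ u _ → hd u) (λ u → R K v u ∧ hd u) (λ u w t h → ∧-intro (R-edge (T-vu t)) h)
          (λ u w t h → ∧-intro (R-edge (T-vw t)) h)
          λ u w x t h t′ _ → no-real-pair (R-edge (T-vu t)) (R-edge (T-vw t)) (R-edge (T-vu t′))
            (hard-R K {u} h {w} (T-uw t)) (hard-R K {u} h {x} (A-sym K x u (T-uw t′))) t t′)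

      soft-slots : HS + 2 * SS ≤ 2 * s
      soft-slots = ≤-resp₂ (trans (cong (HS +_) (≡.sym (C-* v 2 ss))) (trans (≡.sym (C-+ v hs (λ u w → 2 * ss u w)))
          (C-cong λ u w → pt (hd u) (hd w)))) refl
        (slot₂ v (λ u _ → not (hd u)) (λ u → A K v u ∧ not (hd u)) (λ u w t h → ∧-intro (T-vu t) h)
          (λ u w t h → ∧-intro (T-vw t) h))
        where
        pt : ∀ p q → ⟦ p xor q ⟧ + 2 * ⟦ not p ∧ not q ⟧ ≡ ⟦ not p ⟧ + ⟦ not q ⟧
        pt true  true  = refl
        pt true  false = refl
        pt false true  = refl
        pt false false = refl

      -- Somewhere in the rotation a soft neighbour is followed by a hard one.
      soft-corners : 1 ≤ hdeg K v → 1 ≤ s → SS + 1 ≤ s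
      soft-corners k≥1 s≥1 = by (Finₚ.any? λ u → true? (turn u))
        where
        turn : V → Bool
        turn u = (A K v u ∧ not (hd u)) ∧ hd (Torus.rot (torus K) v u)
        row : ∀ u → ∑ (λ w → ⟦ T v u w ⟧ * ss u w) ≤ ⟦ A K v u ∧ not (hd u) ⟧
        row u = ≤-resp₂ (∑-cong λ w → ≡.sym (⟦∧⟧ (T v u w) _)) refl
          (at-most-one {f = λ w → T v u w ∧ (not (hd u) ∧ not (hd w))} (λ i j p q → T-fun (∧-elimˡ p) (∧-elimˡ q))
            λ w p → ∧-intro (T-vu (∧-elimˡ p)) (∧-elimˡ (∧-elimʳ {T v u w} p)))
        at : ∀ u w → turn u ≡ true → Dec (T v u w ≡ true) → ⟦ T v u w ⟧ * ss u w ≡ 0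
        at u w h (no ¬t) = cong (_* ss u w) (⟦⟧-false ¬t)
        at u w h (yes t) = trans (cong (⟦ T v u w ⟧ *_) (⟦⟧-false λ z → not-elim (∧-elimʳ {not (hd u)} z)
          (subst (λ w → hd w ≡ true) (proj₁ (proj₂ (T-elim t))) (∧-elimʳ {A K v u ∧ not (hd u)} h)))) (ℕₚ.*-zeroʳ ⟦ T v u w ⟧)
        by : Dec (∃ λ u → turn u ≡ true) → SS + 1 ≤ s
        by (yes (u , h)) = ∑-gap row u (ℕₚ.≤-reflexive (trans (cong (_+ 1) (∑-zero λ w → at u w h (true? (T v u w))))
                            (≡.sym (⟦⟧-true (∧-elimˡ h)))))
        by (no none) = let a , ha = ∑-∃ {f = λ u → R K v u ∧ hd u} k≥1
                           b , hb = ∑-∃ {f = λ u → A K v u ∧ not (hd u)} s≥1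
                      in ⊥-elim (not-elim (Torus.rot-tr (torus K) v (not ∘ hd)
                           (λ u vu su → not-intro λ hr → none (u , ∧-intro (∧-intro vu su) hr))
                           b a (∧-elimˡ hb) (R⇒A K {v} {a} (∧-elimˡ ha)) (∧-elimʳ {A K v b} hb)) (∧-elimʳ {R K v a} ha))

      cost : ∀ α β γ →
        (∀ u w → T v u w ≡ true → hd u ≡ true → hd w ≡ true → 6 + out v u w ≤ α) →
        (∀ u w → T v u w ≡ true → hd u xor hd w ≡ true → 6 + out v u w ≤ β) →
        (∀ u w → T v u w ≡ true → hd u ≡ false → hd w ≡ false → 6 + out v u w ≤ γ) →
        C v (λ u w → 6 + out v u w) ≤ α * HH + (β * HS + γ * SS)
      cost α β γ hα hβ hγ = ℕₚ.≤-trans (C-mono pt) (ℕₚ.≤-reflexive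
        (trans (C-+ v (λ u w → α * hh u w) (λ u w → β * hs u w + γ * ss u w)) (cong₂ _+_ (C-* v α hh)
          (trans (C-+ v (λ u w → β * hs u w) (λ u w → γ * ss u w)) (cong₂ _+_ (C-* v β hs) (C-* v γ ss))))))
        where
        pt : ∀ u w → T v u w ≡ true → 6 + out v u w ≤ α * hh u w + (β * hs u w + γ * ss u w)
        pt u w t = by (hd u) (hd w) refl refl
          where
          by : ∀ p q → hd u ≡ p → hd w ≡ q → 6 + out v u w ≤ α * ⟦ p ∧ q ⟧ + (β * ⟦ p xor q ⟧ + γ * ⟦ not p ∧ not q ⟧)
          by true  true  eu ew = ℕₚ.≤-trans (hα u w t eu ew) (ℕₚ.≤-reflexive (solve (α ∷ β ∷ γ ∷ [])))
          by true  false eu ew = ℕₚ.≤-trans (hβ u w t (cong₂ _xor_ eu ew)) (ℕₚ.≤-reflexive (solve (α ∷ β ∷ γ ∷ [])))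
          by false true  eu ew = ℕₚ.≤-trans (hβ u w t (cong₂ _xor_ eu ew)) (ℕₚ.≤-reflexive (solve (α ∷ β ∷ γ ∷ [])))
          by false false eu ew = ℕₚ.≤-trans (hγ u w t eu ew) (ℕₚ.≤-reflexive (solve (α ∷ β ∷ γ ∷ [])))

      out≤ : ∀ {u w} p₁ p₂ q₁ q₂ → ⟦ pay₃ v u ⟧ ≤ p₁ → ⟦ pay₃ v w ⟧ ≤ p₂ → ⟦ pay₂ v u w ⟧ ≤ q₁ → ⟦ pay₂ v w u ⟧ ≤ q₂ →
        6 + out v u w ≤ 6 + (3 * p₁ + 2 * q₁ + (3 * p₂ + 2 * q₂))
      out≤ p₁ p₂ q₁ q₂ h₁ h₂ h₃ h₄ = ℕₚ.+-monoʳ-≤ 6 ((3 ⊛ h₁ ⊕ 2 ⊛ h₃) ⊕ (3 ⊛ h₂ ⊕ 2 ⊛ h₄))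

      zero-≤ : ∀ {b} → ¬ (b ≡ true) → ⟦ b ⟧ ≤ 0
      zero-≤ h = ℕₚ.≤-reflexive (⟦⟧-false h)

      -- With u as the first vertex of `pair`, which is hard and has sum at most 8, the bound for v
      -- rises to 8 + 1.
      four-heavy : ∀ {u z} → deg K u ≡ 4 → A K v u ≡ true → A K u z ≡ true → A K v z ≡ true → ¬ (deg K v + hdeg K v ≤ 9)
      four-heavy {u} {z} d vu uz vz le = pair u v z hv (R-sym K v u (R-edge vu)) uz vz (four-light d)
        (subst (λ b → deg K v + hdeg K v ≤ 8 + ⟦ b ⟧) (≡.sym (four-hard (alive-r vu) d)) le)

      no-pay₃ : deg K v + hdeg K v ≤ 9 → ∀ {u w} → T v u w ≡ true → ¬ (pay₃ v u ≡ true) × ¬ (pay₃ v w ≡ true)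
      no-pay₃ le t = (λ p → four-heavy (proj₁ (pay₃-elim p)) (T-vu t) (T-uw t) (T-vw t) le) ,
                     (λ p → four-heavy (proj₁ (pay₃-elim p)) (T-vw t) (A-sym K _ _ (T-uw t)) (T-vu t) le)

      one-pay₃ : ∀ {u w} → T v u w ≡ true → pay₃ v u ≡ true → pay₃ v w ≡ true → ⊥
      one-pay₃ {u} {w} t p q = let du , _ = pay₃-elim p; dw , _ = pay₃-elim q
                                   hu , hw = pay₃-hard t p in
        pair u w v hw (hard-R K {u} hu {w} (T-uw t)) (A-sym K v u (T-vu t)) (A-sym K v w (T-vw t)) (four-light du)
          (ℕₚ.≤-trans (four-light dw) (ℕₚ.m≤m+n 8 _))

      pay₃-both : ∀ {u w} → T v u w ≡ true → (pay₃ v u ≡ true → hd u ≡ true × hd w ≡ true) ×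
                                             (pay₃ v w ≡ true → hd u ≡ true × hd w ≡ true)
      pay₃-both {u} {w} t = pay₃-hard t , λ p → let d , _ = pay₃-elim p in
        four-nbr d (A-sym K u w (T-uw t)) , four-hard (alive-r (T-vw t)) d

      pay₂≤ : ∀ {a b c} → hd b ≡ true → ⟦ pay₂ a b c ⟧ ≤ 0
      pay₂≤ h = zero-≤ λ p → false≢true (pay₂-soft p) h

      cost-hs : ∀ u w → T v u w ≡ true → hd u xor hd w ≡ true → 6 + out v u w ≤ 8
      cost-hs u w t e = by (hd u) (hd w) refl refl e
        where
        by : ∀ p q → hd u ≡ p → hd w ≡ q → p xor q ≡ true → 6 + out v u w ≤ 8
        by true false eu ew _ = out≤ 0 0 0 1 (zero-≤ λ p → false≢true ew (proj₂ (proj₁ (pay₃-both t) p)))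
          (zero-≤ λ p → false≢true ew (proj₂ (proj₂ (pay₃-both t) p))) (pay₂≤ eu) (⟦⟧≤1 _)
        by false true eu ew _ = out≤ 0 0 1 0 (zero-≤ λ p → false≢true eu (proj₁ (proj₁ (pay₃-both t) p)))
          (zero-≤ λ p → false≢true eu (proj₁ (proj₂ (pay₃-both t) p))) (⟦⟧≤1 _) (pay₂≤ ew)

      cost-ss : ∀ u w → T v u w ≡ true → hd u ≡ false → hd w ≡ false → 6 + out v u w ≤ 10
      cost-ss u w t eu ew = out≤ 0 0 1 1 (zero-≤ λ p → false≢true ew (proj₂ (proj₁ (pay₃-both t) p)))
        (zero-≤ λ p → false≢true ew (proj₂ (proj₂ (pay₃-both t) p))) (⟦⟧≤1 _) (⟦⟧≤1 _)

      cost-hh : ∀ u w → T v u w ≡ true → hd u ≡ true → hd w ≡ true → 6 + out v u w ≤ 9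
      cost-hh u w t hu hw = by (true? (pay₃ v u))
        where
        by : Dec (pay₃ v u ≡ true) → 6 + out v u w ≤ 9
        by (yes p) = out≤ 1 0 0 0 (⟦⟧≤1 _) (zero-≤ (one-pay₃ t p)) (pay₂≤ hu) (pay₂≤ hw)
        by (no ¬p) = out≤ 0 1 0 0 (zero-≤ ¬p) (⟦⟧≤1 _) (pay₂≤ hu) (pay₂≤ hw)

      cost-hh₁ : deg K v + hdeg K v ≤ 9 → ∀ u w → T v u w ≡ true → hd u ≡ true → hd w ≡ true → 6 + out v u w ≤ 6
      cost-hh₁ le u w t hu hw = out≤ 0 0 0 0 (zero-≤ (proj₁ (no-pay₃ le t))) (zero-≤ (proj₂ (no-pay₃ le t))) (pay₂≤ hu) (pay₂≤ hw)

      -- At most three of the five neighbours are hard: either two edges are constraint edges, or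
      -- there is at least one such edge and a real edge leads to the soft w. So a receiver can
      -- serve as the first vertex of `pair`.
      poor-light : ∀ {u w} → deg K u ≡ 5 → 1 ≤ sdeg K u → hd w ≡ false → sdeg K u ≡ 2 ⊎ R K u w ≡ true →
        deg K u + hdeg K u ≤ 8
      poor-light {u} d _ _ (inj₁ e) = two-light d e
      poor-light {u} {w} d s hw (inj₂ uw) = arith (deg K u) (rdeg K u) (hdeg K u) (sdeg K u) (deg-split K u) d s
        (∑-gap (λ x → true-≤ ∧-elimˡ) w (≤-resp₂ (cong (_+ 1) (⟦⟧-false λ h → false≢true hw (∧-elimʳ {R K u w} h))) (⟦⟧-true uw) ℕₚ.≤-refl))
        where
        arith : ∀ d r h s → d ≡ r + s → d ≡ 5 → 1 ≤ s → h + 1 ≤ r → d + h ≤ 8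
        arith d r h s e d5 h₁ h₂ = lin (h₁ ⊕ h₂ ⊕ 2 ⊛ ℕₚ.≤-reflexive d5 ⊕ ℕₚ.≤-reflexive (≡.sym e)) 0 (solve (d ∷ r ∷ h ∷ s ∷ []))

      no-pay₂ : deg K v + hdeg K v ≤ 8 → ∀ {u w} → A K v u ≡ true → A K u w ≡ true → A K v w ≡ true → hd w ≡ false →
        ¬ (pay₂ v u w ≡ true)
      no-pay₂ le {u} {w} vu uw vw hw p = let _ , d , s , e = pay₂-elim p in
        pair u v w hv (R-sym K v u (R-edge vu)) uw vw (poor-light d s hw e) (ℕₚ.≤-trans le (ℕₚ.m≤m+n 8 _))

      cost-ss₀ : deg K v + hdeg K v ≤ 8 → ∀ u w → T v u w ≡ true → hd u ≡ false → hd w ≡ false → 6 + out v u w ≤ 6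
      cost-ss₀ le u w t eu ew = out≤ 0 0 0 0 (zero-≤ (proj₁ no3)) (zero-≤ (proj₂ no3))
        (zero-≤ (no-pay₂ le (T-vu t) (T-uw t) (T-vw t) ew))
        (zero-≤ (no-pay₂ le (T-vw t) (A-sym K u w (T-uw t)) (T-vu t) eu))
        where no3 = no-pay₃ (ℕₚ.≤-trans le (ℕₚ.n≤1+n 8)) t

      finish : ∀ b x → b + C v (λ u w → 6 + out v u w) ≤ x → x ≤ 18 * deg K v → b + C v (λ u w → 6 + out v u w) ≤ rhs v
      finish b x h₁ h₂ = ℕₚ.≤-trans h₁ (ℕₚ.≤-trans h₂ (ℕₚ.m≤m+n _ _))

      Strict : Set
      Strict = 73 + C v (λ u w → 6 + out v u w) ≤ rhs v

      Weak : Set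
      Weak = 72 + C v (λ u w → 6 + out v u w) ≤ rhs v

      private
        e18 : 18 * (hdeg K v + s) ≡ 18 * deg K v
        e18 = cong (18 *_) k+s

      -- The cases are degree plus hard degree equal to 8, equal to 9, and larger. At 8, `pair`
      -- forbids every transfer except 2 at a corner with exactly one hard side; at 9 it still
      -- forbids transfers of 3; from 10 on everything may occur, but then many neighbours are hard,
      -- and their sides bound few triangular corners.
      hard-balance : 6 ≤ deg K v → Strict ⊎ (Weak × deg K v ≡ 6 × hdeg K v ≡ 3)
      hard-balance d≥6 = by (deg K v + hdeg K v ℕ.≤? 8) (deg K v + hdeg K v ℕ.≤? 9) (even-six (deg K v) d≥6 (hard-deg-even hv))
        where
        k = hdeg K v
        d = deg K v
        nine : ∀ d k → ¬ (d + k ≤ 8) → d + k ≤ 9 → d + k ≡ 9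
        nine d k h₁ h₂ = ℕₚ.≤-antisym h₂ (ℕₚ.≰⇒> h₁)
        by : Dec (d + k ≤ 8) → Dec (d + k ≤ 9) → d ≡ 6 ⊎ 8 ≤ d → Strict ⊎ (Weak × d ≡ 6 × k ≡ 3)
        by (yes le) _ _ = inj₁ (finish 73 (18 * (k + s)) (ℕₚ.≤-trans
            (ℕₚ.+-monoʳ-≤ 73 (cost 6 8 6 (cost-hh₁ (ℕₚ.≤-trans le (ℕₚ.n≤1+n 8))) cost-hs (cost-ss₀ le)))
            (balance₀ HH HS SS k s hard-slots soft-slots
              (subst (λ d → 8 ≤ d + k) (≡.sym k+s) (light v al)) (subst (6 ≤_) (≡.sym k+s) d≥6)))
          (ℕₚ.≤-reflexive e18))
        by (no gt) (yes le) (inj₁ d6) = inj₂ (finish 72 108 (ℕₚ.≤-trans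
            (ℕₚ.+-monoʳ-≤ 72 (cost 6 8 10 (cost-hh₁ le) cost-hs cost-ss))
            (balance₁-6 HH HS SS (subst (2 * HH + HS ≤_) k3 hard-slots) (subst (λ s → HS + 2 * SS ≤ 2 * s) s3 soft-slots)
              (subst (SS + 1 ≤_) s3 (soft-corners (≤-resp₂ refl k3 (s≤s z≤n)) (≤-resp₂ refl s3 (s≤s z≤n))))))
          (ℕₚ.≤-reflexive (cong (18 *_) (≡.sym d6))) , d6 , k3)
          where
          k3 : k ≡ 3
          k3 = ℕₚ.+-cancelˡ-≡ 6 k 3 (trans (cong (_+ k) (≡.sym d6)) (nine d k gt le))
          s3 : s ≡ 3
          s3 = ℕₚ.+-cancelˡ-≡ 3 s 3 (trans (cong (_+ s) (≡.sym k3)) (trans k+s d6))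
        by (no gt) (yes le) (inj₂ d≥8) = inj₁ (finish 73 144 (ℕₚ.≤-trans
            (ℕₚ.+-monoʳ-≤ 73 (cost 6 8 10 (cost-hh₁ le) cost-hs cost-ss))
            (balance₁-8 HH HS SS (subst (2 * HH + HS ≤_) k1 hard-slots) (subst (λ s → HS + 2 * SS ≤ 2 * s) s7 soft-slots)
              (subst (SS + 1 ≤_) s7 (soft-corners (≤-resp₂ refl k1 (s≤s z≤n)) (≤-resp₂ refl s7 (s≤s z≤n))))))
          (18 ⊛ d≥8))
          where
          nope : d ≢ 9
          nope e = case trans (≡.sym (cong odd e)) (hard-deg-even hv) of λ ()
          d8 : d ≡ 8
          d8 = case ℕₚ.m≤n⇒m<n∨m≡n d≥8 of λ where
            (inj₂ e) → ≡.sym e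
            (inj₁ l) → ⊥-elim (nope (ℕₚ.≤-antisym (ℕₚ.≤-trans (ℕₚ.m≤m+n d k) le) l))
          k1 : k ≡ 1
          k1 = ℕₚ.+-cancelˡ-≡ 8 k 1 (trans (cong (_+ k) (≡.sym d8)) (nine d k gt le))
          s7 : s ≡ 7
          s7 = ℕₚ.+-cancelˡ-≡ 1 s 7 (trans (cong (_+ s) (≡.sym k1)) (trans k+s d8))
        by (no _) (no gt) (inj₁ d6) = inj₁ (finish 73 108 (ℕₚ.≤-trans
            (ℕₚ.+-monoʳ-≤ 73 (cost 9 8 10 cost-hh cost-hs cost-ss))
            (balance₂-6 HH HS SS k s (trans k+s d6) hard-slots soft-slots big (soft-corners k≥1)))
          (ℕₚ.≤-reflexive (cong (18 *_) (≡.sym d6))))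
          where
          big : 10 ≤ (k + s) + k
          big = subst (λ d → 10 ≤ d + k) (≡.sym k+s) (ℕₚ.≰⇒> gt)
          k≥1 : 1 ≤ k
          k≥1 = ℕₚ.+-cancelˡ-≤ 6 1 k (ℕₚ.≤-trans (ℕₚ.m≤m+n 7 3) (subst (λ d → 10 ≤ d + k) d6 (ℕₚ.≰⇒> gt)))
        by (no _) (no gt) (inj₂ d≥8) = inj₁ (finish 73 (18 * (k + s)) (ℕₚ.≤-trans
            (ℕₚ.+-monoʳ-≤ 73 (cost 9 8 10 cost-hh cost-hs cost-ss))
            (balance₂-8 HH HS SS k s hard-slots soft-slots
              (subst (λ d → 10 ≤ d + k) (≡.sym k+s) (ℕₚ.≰⇒> gt)) (subst (8 ≤_) (≡.sym k+s) d≥8)))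
          (ℕₚ.≤-reflexive e18))

      -- If no neighbour receives charge at both of its corners, the remaining case is strict as well.
      poor-needed : deg K v ≡ 6 → hdeg K v ≡ 3 → (∀ u → A K v u ≡ true → deg K u ≡ 5 → sdeg K u ≢ 2) → Strict
      poor-needed d6 k3 none = finish 73 108 (≤-resp₂ (cong (73 +_) (trans (C-6+ v (out v)) (cong (6 * τ +_) flows))) refl
          (arith τ P s (hdeg K v) (deg K v) corners receivers k+s d6 k3)) (ℕₚ.≤-reflexive (cong (18 *_) (≡.sym d6)))
        where
        τ P : ℕ
        τ = C v (λ _ _ → 1)
        P = C v (λ u w → ⟦ pay₂ v u w ⟧ + ⟦ pay₂ v w u ⟧)
        le9 : deg K v + hdeg K v ≤ 9
        le9 = ℕₚ.≤-reflexive (cong₂ _+_ d6 k3)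
        flows : C v (out v) ≡ 2 * P
        flows = trans (∑-cong λ u → ∑-cong λ w → by u w (true? (T v u w))) (C-* v 2 (λ u w → ⟦ pay₂ v u w ⟧ + ⟦ pay₂ v w u ⟧))
          where
          by : ∀ u w → Dec (T v u w ≡ true) → ⟦ T v u w ⟧ * out v u w ≡ ⟦ T v u w ⟧ * (2 * (⟦ pay₂ v u w ⟧ + ⟦ pay₂ v w u ⟧))
          by u w (no ¬t) = trans (cong (_* out v u w) (⟦⟧-false ¬t))
            (cong (_* (2 * (⟦ pay₂ v u w ⟧ + ⟦ pay₂ v w u ⟧))) (≡.sym (⟦⟧-false ¬t)))
          by u w (yes t) = cong (⟦ T v u w ⟧ *_) (trans
            (cong₂ (λ a b → (3 * a + 2 * ⟦ pay₂ v u w ⟧) + (3 * b + 2 * ⟦ pay₂ v w u ⟧))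
              (⟦⟧-false (proj₁ (no-pay₃ le9 t))) (⟦⟧-false (proj₂ (no-pay₃ le9 t))))
            (≡.sym (ℕₚ.*-distribˡ-+ 2 ⟦ pay₂ v u w ⟧ _)))
        corners : 2 * τ ≤ hdeg K v + 2 * s
        corners = ≤-resp₂ (trans (≡.sym (C-* v 2 (λ _ _ → 1)))
            (trans (C-cong λ u w → pt (hd u) (hd w)) (C-+ v (λ u w → 2 * hh u w + hs u w) (λ u w → hs u w + 2 * ss u w))))
          refl (ℕₚ.+-mono-≤ (≤-resp₂ (trans (C-+ v (λ u w → 2 * hh u w) hs) (cong (_+ HS) (C-* v 2 hh))) refl hard-slots)
                            (≤-resp₂ (trans (C-+ v hs (λ u w → 2 * ss u w)) (cong (HS +_) (C-* v 2 ss))) refl soft-slots))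
          where
          pt : ∀ p q → 2 ≡ (2 * ⟦ p ∧ q ⟧ + ⟦ p xor q ⟧) + (⟦ p xor q ⟧ + 2 * ⟦ not p ∧ not q ⟧)
          pt true  true  = refl
          pt true  false = refl
          pt false true  = refl
          pt false false = refl
        real : ∀ {u w} → T v u w ≡ true ⊎ T v w u ≡ true → pay₂ v u w ≡ true → R K u w ≡ true
        real {u} t p = let _ , d , _ , e = pay₂-elim p in case e of λ where
          (inj₂ r) → r
          (inj₁ e) → ⊥-elim (none u (case t of λ { (inj₁ t) → T-vu t ; (inj₂ t) → T-vw t }) d e)
        -- Without a second constraint edge a receiver is paid only when the opposite side of the
        -- triangle is real at it. Payments at both its corners would come from adjacent real
        -- triangles, so each soft neighbour is paid at most once.
        receivers : P ≤ s
        receivers = slot₁ v (pay₂ v) (λ u → A K v u ∧ not (hd u))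
          (λ u w t p → ∧-intro (T-vu t) (not-intro λ h → false≢true (pay₂-soft p) h))
          (λ u w t p → ∧-intro (T-vw t) (not-intro λ h → false≢true (pay₂-soft p) h))
          λ u w x t p t′ p′ → no-real-pair (R-edge (T-vu t)) (R-edge (T-vw t)) (R-edge (T-vu t′))
            (real (inj₁ t) p) (real (inj₂ t′) p′) t t′
        arith : ∀ τ P s k d → 2 * τ ≤ k + 2 * s → P ≤ s → k + s ≡ d → d ≡ 6 → k ≡ 3 → 73 + (6 * τ + 2 * P) ≤ 108
        arith τ P s k d h₁ h₂ e₁ e₂ e₃ with ℕₚ.+-cancelˡ-≡ 3 s 3 (trans (cong (_+ s) (≡.sym e₃)) (trans e₁ e₂))
        ... | refl = lin (3 ⊛ h₁ ⊕ 2 ⊛ h₂ ⊕ 3 ⊛ ℕₚ.≤-reflexive e₃) 2 (solve (τ ∷ P ∷ k ∷ []))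

-- Vertices of degree four and soft vertices

module _ {N : ℕ} where
  private
    V : Set
    V = Fin N

  open Mixed

  module SoftBalance (K : Mixed N) (irr : Irreducible K) where
    open Irreducible irr
    open Balance K irr

    -- The initial charge is zero, and each triangular corner, which costs 6, is repaid by 3 from
    -- both other vertices: these do not have degree four themselves, by `pair`.
    four-balance : ∀ v → alive K v ≡ true → deg K v ≡ 4 → 72 + C v (λ u w → 6 + out v u w) ≤ rhs v
    four-balance v al d4 = ℕₚ.+-mono-≤ (ℕₚ.≤-reflexive (cong (18 *_) (≡.sym d4))) (C-mono corner)
      where
      hv : hd v ≡ true
      hv = four-hard al d4
      not-four : ∀ {u w} → A K v u ≡ true → A K v w ≡ true → A K u w ≡ true → deg K u ≢ 4
      not-four {u} {w} vu vw uw e = pair v u w (four-hard (alive-r vu) e) (hard-R K {v} hv {u} vu) vw uw (light₄ d4)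
        (ℕₚ.≤-trans (light₄ e) (ℕₚ.m≤m+n 8 _))
        where
        light₄ : ∀ {u} → deg K u ≡ 4 → deg K u + hdeg K u ≤ 8
        light₄ {u} d = ℕₚ.≤-trans (ℕₚ.+-monoʳ-≤ (deg K u) (hdeg≤deg u)) (ℕₚ.≤-reflexive (cong₂ _+_ d d))
      no₃ : ∀ {u} → ⟦ pay₃ v u ⟧ ≡ 0
      no₃ = ⟦⟧-false λ p → proj₂ (pay₃-elim p) d4
      no₂ : ∀ {u w} → A K v u ≡ true → ⟦ pay₂ v u w ⟧ ≡ 0
      no₂ {u} {w} vu = ⟦⟧-false λ p → let _ , _ , s , _ = pay₂-elim p in
        case subst (1 ≤_) (hard-sdeg K {u} (four-nbr d4 vu)) s of λ ()
      corner : ∀ u w → T v u w ≡ true → 6 + out v u w ≤ inn v u w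
      corner u w t = ≤-resp₂ (cong (6 +_) (cong₂ _+_ (cong₂ (λ a b → 3 * a + 2 * b) no₃ (no₂ (T-vu t)))
                                                   (cong₂ (λ a b → 3 * a + 2 * b) no₃ (no₂ (T-vw t)))))
        (cong₂ (λ a b → (3 * a + 2 * ⟦ pay₂ u v w ⟧) + (3 * b + 2 * ⟦ pay₂ w v u ⟧))
          (⟦⟧-true (pay₃-intro d4 (not-four (T-vu t) (T-vw t) (T-uw t))))
          (⟦⟧-true (pay₃-intro d4 (not-four (T-vw t) (T-vu t) (A-sym K u w (T-uw t))))))
        (arith (2 * ⟦ pay₂ u v w ⟧) (2 * ⟦ pay₂ w v u ⟧))
        where
        arith : ∀ a b → 6 ≤ (3 + a) + (3 + b)
        arith a b = lin {x = 0} {0} z≤n (a + b) (solve (a ∷ b ∷ []))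

    module SoftVertex (v : V) (sv : hd v ≡ false) (al : alive K v ≡ true) where

      τ : ℕ
      τ = C v (λ _ _ → 1)

      -- Nothing is given away by a soft vertex: a vertex of degree four has only hard neighbours,
      -- and `pay₂` demands a hard giver.
      no-out : C v (λ u w → 6 + out v u w) ≡ 6 * τ
      no-out = trans (C-6+ v (out v)) (trans (cong (6 * τ +_) zero-out) (ℕₚ.+-identityʳ _))
        where
        no₃ : ∀ {u} → A K v u ≡ true → ⟦ pay₃ v u ⟧ ≡ 0
        no₃ {u} vu = ⟦⟧-false λ p → false≢true sv (four-nbr (proj₁ (pay₃-elim p)) (A-sym K v u vu))
        no₂ : ∀ {u w} → ⟦ pay₂ v u w ⟧ ≡ 0
        no₂ = ⟦⟧-false λ p → false≢true sv (proj₁ (pay₂-elim p))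
        by : ∀ u w → Dec (T v u w ≡ true) → ⟦ T v u w ⟧ * out v u w ≡ 0
        by u w (no ¬t) = cong (_* out v u w) (⟦⟧-false ¬t)
        by u w (yes t) = trans (cong (⟦ T v u w ⟧ *_) (cong₂ _+_ (cong₂ (λ a b → 3 * a + 2 * b) (no₃ (T-vu t)) no₂)
          (cong₂ (λ a b → 3 * a + 2 * b) (no₃ (T-vw t)) no₂))) (ℕₚ.*-zeroʳ ⟦ T v u w ⟧)
        zero-out : C v (out v) ≡ 0
        zero-out = ∑-zero λ u → ∑-zero λ w → by u w (true? (T v u w))

      finish : ∀ b → b + 6 * τ ≤ 18 * deg K v + C v (inn v) → b + C v (λ u w → 6 + out v u w) ≤ rhs v
      finish b = subst (λ x → b + x ≤ rhs v) (≡.sym no-out)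

      soft-big : 6 ≤ deg K v → 72 + C v (λ u w → 6 + out v u w) ≤ rhs v
      soft-big h = finish 72 (ℕₚ.≤-trans (arith τ (deg K v) (corners≤deg v) h) (ℕₚ.m≤m+n _ _))
        where
        arith : ∀ t d → t ≤ d → 6 ≤ d → 72 + 6 * t ≤ 18 * d
        arith t d h₁ h₂ = lin (6 ⊛ h₁ ⊕ 12 ⊛ h₂) 0 (solve (t ∷ d ∷ []))

      soft-bigger : 7 ≤ deg K v → 73 + C v (λ u w → 6 + out v u w) ≤ rhs v
      soft-bigger h = finish 73 (ℕₚ.≤-trans (arith τ (deg K v) (corners≤deg v) h) (ℕₚ.m≤m+n _ _))
        where
        arith : ∀ t d → t ≤ d → 7 ≤ d → 73 + 6 * t ≤ 18 * d
        arith t d h₁ h₂ = lin (6 ⊛ h₁ ⊕ 12 ⊛ h₂) 11 (solve (t ∷ d ∷ []))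

      soft-real : ℕ
      soft-real = ∑ λ u → ⟦ R K v u ∧ not (hd u) ⟧

      real-split : hdeg K v + soft-real ≡ rdeg K v
      real-split = trans (≡.sym (∑-+ _ _)) (∑-cong λ u → pt (R K v u) (hd u))
        where
        pt : ∀ r h → ⟦ r ∧ h ⟧ + ⟦ r ∧ not h ⟧ ≡ ⟦ r ⟧
        pt true  true  = refl
        pt true  false = refl
        pt false _     = refl

      RR : V → V → Bool
      RR u w = R K v u ∧ R K v w

      RR-sym : ∀ u w → RR u w ≡ true → RR w u ≡ true
      RR-sym u w h = ∧-intro (∧-elimʳ {R K v u} h) (∧-elimˡ h)

      RR-comm : ∀ u w → RR u w ≡ RR w u
      RR-comm u w = true-≡ (RR-sym u w) (RR-sym w u)

      FF FR : V → V → Bool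
      FF u w = F K v u ∧ F K v w
      FR u w = F K v u xor F K v w

      g a b : ℕ
      g = C v λ u w → ⟦ RR u w ⟧
      a = C v λ u w → ⟦ FF u w ⟧
      b = C v λ u w → ⟦ FR u w ⟧

      private
        R-or-F : ∀ u → A K v u ≡ true → (R K v u ≡ true × F K v u ≡ false) ⊎ (R K v u ≡ false × F K v u ≡ true)
        R-or-F u h = case A-elim K {v} {u} h of λ where
          (inj₁ r) → inj₁ (r , ¬true⇒false (R≢F K v u r))
          (inj₂ f) → inj₂ (¬true⇒false (λ r → R≢F K v u r f) , f)

      sorted : ∀ u w → T v u w ≡ true → ⟦ RR u w ⟧ + (⟦ FF u w ⟧ + ⟦ FR u w ⟧) ≡ 1
      sorted u w t = by (R-or-F u (T-vu t)) (R-or-F w (T-vw t))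
        where
        value : ∀ {r r′ f f′} → R K v u ≡ r → R K v w ≡ r′ → F K v u ≡ f → F K v w ≡ f′ →
          ⟦ RR u w ⟧ + (⟦ FF u w ⟧ + ⟦ FR u w ⟧) ≡ ⟦ r ∧ r′ ⟧ + (⟦ f ∧ f′ ⟧ + ⟦ f xor f′ ⟧)
        value e₁ e₂ e₃ e₄ = cong₂ _+_ (cong ⟦_⟧ (cong₂ _∧_ e₁ e₂))
          (cong₂ _+_ (cong ⟦_⟧ (cong₂ _∧_ e₃ e₄)) (cong ⟦_⟧ (cong₂ _xor_ e₃ e₄)))
        by : (R K v u ≡ true × F K v u ≡ false) ⊎ (R K v u ≡ false × F K v u ≡ true) →
             (R K v w ≡ true × F K v w ≡ false) ⊎ (R K v w ≡ false × F K v w ≡ true) →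
             ⟦ RR u w ⟧ + (⟦ FF u w ⟧ + ⟦ FR u w ⟧) ≡ 1
        by (inj₁ (p , q)) (inj₁ (p′ , q′)) = value p p′ q q′
        by (inj₁ (p , q)) (inj₂ (p′ , q′)) = value p p′ q q′
        by (inj₂ (p , q)) (inj₁ (p′ , q′)) = value p p′ q q′
        by (inj₂ (p , q)) (inj₂ (p′ , q′)) = value p p′ q q′

      C-cong : ∀ {φ ψ} → (∀ u w → T v u w ≡ true → φ u w ≡ ψ u w) → C v φ ≡ C v ψ
      C-cong h = ℕₚ.≤-antisym (C-mono λ u w t → ℕₚ.≤-reflexive (h u w t)) (C-mono λ u w t → ℕₚ.≤-reflexive (≡.sym (h u w t)))

      τ-split : τ ≡ g + (a + b)
      τ-split = trans (C-cong λ u w t → ≡.sym (sorted u w t))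
        (trans (C-+ v (λ u w → ⟦ RR u w ⟧) (λ u w → ⟦ FF u w ⟧ + ⟦ FR u w ⟧))
          (cong (g +_) (C-+ v (λ u w → ⟦ FF u w ⟧) (λ u w → ⟦ FR u w ⟧))))

      F-slots : 2 * a + b ≤ 2 * sdeg K v
      F-slots = ≤-resp₂ (trans (cong (_+ b) (≡.sym (C-* v 2 (λ u w → ⟦ FF u w ⟧))))
          (trans (≡.sym (C-+ v (λ u w → 2 * ⟦ FF u w ⟧) (λ u w → ⟦ FR u w ⟧))) (C-cong λ u w _ → ∧-xor (F K v u) (F K v w)))) refl
        (slot₂ v (λ u _ → F K v u) (F K v) (λ _ _ _ h → h) (λ _ _ _ h → h))

      module _ (few-soft : soft-real ≤ 1) where

        -- Both ends of a constraint edge are soft, but at most one real neighbour of v is soft.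
        real-triangle : ∀ {u w} → R K v u ≡ true → R K v w ≡ true → A K u w ≡ true → R K u w ≡ true
        real-triangle {u} {w} vu vw uw = by (true? (hd u)) (true? (hd w))
          where
          by : Dec (hd u ≡ true) → Dec (hd w ≡ true) → R K u w ≡ true
          by (yes h) _ = hard-R K {u} h {w} uw
          by _ (yes h) = R-sym K w u (hard-R K {w} h {u} (A-sym K u w uw))
          by (no ¬h) (no ¬h′) = ⊥-elim (ℕₚ.<-irrefl refl (ℕₚ.≤-trans two few-soft))
            where
            gap : ∀ {x} → R K v x ≡ true → ¬ (hd x ≡ true) → 1 ≤ ⟦ R K v x ∧ not (hd x) ⟧
            gap r h = ℕₚ.≤-reflexive (≡.sym (⟦⟧-true (∧-intro r (not-intro h))))
            two : 2 ≤ soft-real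
            two = subst (_≤ soft-real) (cong (_+ 2) (∑-zero {f = λ _ → 0} λ _ → refl))
              (∑-gap₂ (λ _ → z≤n) u w (A-≢ K {u} {w} uw) (gap vu ¬h) (gap vw ¬h′))

        no-two : ∀ u w x → T v u w ≡ true → RR u w ≡ true → T v x u ≡ true → RR u x ≡ true → ⊥
        no-two u w x t r t′ r′ = no-real-pair vu vw vx (real-triangle vu vw (T-uw t))
          (real-triangle vu vx (A-sym K x u (T-uw t′))) t t′
          where
          vu = ∧-elimˡ r
          vw = ∧-elimʳ {R K v u} r
          vx = ∧-elimʳ {R K v u} r′

        R-slots : 2 * g ≤ rdeg K v
        R-slots = ≤-resp₂ (trans (≡.sym (C-* v 2 (λ u w → ⟦ RR u w ⟧))) (C-cong λ u w _ →
            cong (⟦ RR u w ⟧ +_) (trans (ℕₚ.+-identityʳ _) (cong ⟦_⟧ (RR-comm u w))))) refl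
          (slot₁ v RR (R K v) (λ u w _ r → ∧-elimˡ r) (λ u w _ r → ∧-elimˡ r) no-two)

        hardR softR : V → V → Bool
        hardR u w = RR u w ∧ hd u
        softR u w = RR u w ∧ not (hd u)

        -- The ends of the corners with two real sides, sorted into hard ones, each of which pays 2,
        -- and soft ones.
        X Y : ℕ
        X = C v λ u w → ⟦ hardR u w ⟧ + ⟦ hardR w u ⟧
        Y = C v λ u w → ⟦ softR u w ⟧ + ⟦ softR w u ⟧

        Y≤ : Y ≤ soft-real
        Y≤ = slot₁ v softR (λ u → R K v u ∧ not (hd u))
          (λ u w _ r → ∧-intro (∧-elimˡ (∧-elimˡ r)) (∧-elimʳ {RR u w} r))
          (λ u w _ r → ∧-intro (∧-elimˡ (∧-elimˡ r)) (∧-elimʳ {RR u w} r))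
          λ u w x t r t′ r′ → no-two u w x t (∧-elimˡ r) t′ (∧-elimˡ r′)

        X+Y : X + Y ≡ 2 * g
        X+Y = trans (≡.sym (C-+ v (λ u w → ⟦ hardR u w ⟧ + ⟦ hardR w u ⟧) (λ u w → ⟦ softR u w ⟧ + ⟦ softR w u ⟧)))
          (trans (C-cong λ u w _ → trans (cong (λ r → (⟦ hardR u w ⟧ + ⟦ r ∧ hd w ⟧) + (⟦ softR u w ⟧ + ⟦ r ∧ not (hd w) ⟧))
              (≡.sym (RR-comm u w))) (pt (RR u w) (hd u) (hd w))) (C-* v 2 (λ u w → ⟦ RR u w ⟧)))
          where
          pt : ∀ r p q → (⟦ r ∧ p ⟧ + ⟦ r ∧ q ⟧) + (⟦ r ∧ not p ⟧ + ⟦ r ∧ not q ⟧) ≡ 2 * ⟦ r ⟧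
          pt false _     _     = refl
          pt true  true  true  = refl
          pt true  true  false = refl
          pt true  false true  = refl
          pt true  false false = refl

        income : deg K v ≡ 5 → 1 ≤ sdeg K v → 2 * X ≤ C v (inn v)
        income d5 s≥1 = ≤-resp₂ (≡.sym (C-* v 2 (λ u w → ⟦ hardR u w ⟧ + ⟦ hardR w u ⟧))) refl (C-mono λ u w _ →
          ≤-resp₂ (ℕₚ.*-distribˡ-+ 2 ⟦ hardR u w ⟧ _) refl (ℕₚ.+-mono-≤ (each u w) (each w u)))
          where
          each : ∀ u w → 2 * ⟦ hardR u w ⟧ ≤ fl u v w
          each u w = ℕₚ.≤-trans (2 ⊛ true-≤ {hardR u w} λ h → pay₂-intro (∧-elimʳ {RR u w} h) d5 s≥1
            (inj₂ (∧-elimʳ {R K v u} (∧-elimˡ h)))) (ℕₚ.m≤n+m _ (3 * ⟦ pay₃ u v ⟧))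

      module _ (d5 : deg K v ≡ 5) where

        hdeg≥3 : 3 ≤ hdeg K v
        hdeg≥3 = ℕₚ.+-cancelˡ-≤ 5 3 _ (subst (λ d → 8 ≤ d + hdeg K v) d5 (light v al))

        rs : rdeg K v + sdeg K v ≡ 5
        rs = trans (≡.sym (deg-split K v)) d5

        -- No income is used: at least three sides are hard and bound one triangular corner each,
        -- the others two, so there are at most three such corners, and their cost 18 is just the
        -- initial charge 90 - 72.
        soft-five₀ : sdeg K v ≡ 0 → 72 + C v (λ u w → 6 + out v u w) ≤ rhs v
        soft-five₀ s0 = finish 72 (ℕₚ.≤-trans (≤-resp₂ refl (cong (18 *_) d5) (bound τ (arith τ (hdeg K v) soft-real corners real-split′ hdeg≥3)))
          (ℕₚ.m≤m+n _ _))
          where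
          real : ∀ {u} → A K v u ≡ true → R K v u ≡ true
          real {u} = sdeg0 K {v} s0 {u}
          real-split′ : hdeg K v + soft-real ≡ 5
          real-split′ = trans real-split (trans (≡.sym (ℕₚ.+-identityʳ _)) (trans (cong (rdeg K v +_) (≡.sym s0)) rs))
          corners : 2 * τ ≤ hdeg K v + 2 * soft-real
          corners = ≤-resp₂ (trans (≡.sym (C-* v 2 (λ _ _ → 1))) (trans (C-cong λ u w _ → pt (hd u) (hd w))
              (C-+ v (λ u w → ⟦ hd u ⟧ + ⟦ hd w ⟧) (λ u w → ⟦ not (hd u) ⟧ + ⟦ not (hd w) ⟧)))) refl
            (ℕₚ.+-mono-≤
              (slot₁ v (λ u _ → hd u) (λ u → R K v u ∧ hd u) (λ u w t h → ∧-intro (real (T-vu t)) h) (λ u w t h → ∧-intro (real (T-vw t)) h)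
                λ u w x t h t′ _ → no-real-pair (real (T-vu t)) (real (T-vw t)) (real (T-vu t′))
                  (hard-R K {u} h {w} (T-uw t)) (hard-R K {u} h {x} (A-sym K x u (T-uw t′))) t t′)
              (slot₂ v (λ u _ → not (hd u)) (λ u → R K v u ∧ not (hd u)) (λ u w t h → ∧-intro (real (T-vu t)) h)
                (λ u w t h → ∧-intro (real (T-vw t)) h)))
            where
            pt : ∀ p q → 2 ≡ (⟦ p ⟧ + ⟦ q ⟧) + (⟦ not p ⟧ + ⟦ not q ⟧)
            pt true  true  = refl
            pt true  false = refl
            pt false true  = refl
            pt false false = refl
          arith : ∀ t h s → 2 * t ≤ h + 2 * s → h + s ≡ 5 → 3 ≤ h → 2 * t ≤ 7
          arith t h s h₁ e h₂ = lin (h₁ ⊕ h₂ ⊕ 2 ⊛ ℕₚ.≤-reflexive e) 0 (solve (t ∷ h ∷ s ∷ []))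
          bound : ∀ t → 2 * t ≤ 7 → 72 + 6 * t ≤ 18 * 5
          bound 0 _ = ℕₚ.m≤m+n 72 18
          bound 1 _ = ℕₚ.m≤m+n 78 12
          bound 2 _ = ℕₚ.m≤m+n 84 6
          bound 3 _ = ℕₚ.≤-refl
          bound (suc (suc (suc (suc t)))) h = ⊥-elim (ℕₚ.<-irrefl refl (lin {a = 8} {7} h (2 * t) (solve (t ∷ []))))

        -- In the worst case two corners have real sides and two contain the constraint edge. They
        -- cost 24, the initial charge is 18, and at least three of the four real ends are hard and
        -- pay 2 each.
        soft-five₁ : sdeg K v ≡ 1 → 72 + C v (λ u w → 6 + out v u w) ≤ rhs v
        soft-five₁ s1 = finish 72 (≤-resp₂ (cong (λ x → 72 + 6 * x) τ-split) (cong (λ d → 18 * d + C v (inn v)) d5)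
          (arith g a b (X few) (Y few) soft-real (rdeg K v) (C v (inn v)) (R-slots few) (≤-resp₂ refl (cong (2 *_) (≡.sym s1)) F-slots)
            (X+Y few) (Y≤ few) few r4 (income few d5 (ℕₚ.≤-reflexive (≡.sym s1)))))
          where
          r4 : rdeg K v ≡ 4
          r4 = ℕₚ.+-cancelʳ-≡ 1 _ 4 (trans (cong (rdeg K v +_) (≡.sym s1)) rs)
          few : soft-real ≤ 1
          few = ℕₚ.+-cancelˡ-≤ 3 _ 1 (ℕₚ.≤-trans (ℕₚ.+-monoˡ-≤ soft-real hdeg≥3) (ℕₚ.≤-reflexive (trans real-split r4)))
          arith : ∀ g a b X Y n r i → 2 * g ≤ r → 2 * a + b ≤ 2 → X + Y ≡ 2 * g → Y ≤ n → n ≤ 1 → r ≡ 4 → 2 * X ≤ i →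
            72 + 6 * (g + (a + b)) ≤ 90 + i
          arith g a b X Y n r i h₁ h₂ e h₃ h₄ e′ h₅ =
            lin (h₁ ⊕ 6 ⊛ h₂ ⊕ 2 ⊛ ℕₚ.≤-reflexive (≡.sym e) ⊕ 2 ⊛ h₃ ⊕ 2 ⊛ h₄ ⊕ ℕₚ.≤-reflexive e′ ⊕ h₅) (6 * a)
              (solve (g ∷ a ∷ b ∷ X ∷ Y ∷ n ∷ r ∷ i ∷ []))

        module Two (s2 : sdeg K v ≡ 2) where

          r3 : rdeg K v ≡ 3
          r3 = ℕₚ.+-cancelʳ-≡ 2 _ 3 (trans (cong (rdeg K v +_) (≡.sym s2)) rs)

          real-hard : ∀ {u} → R K v u ≡ true → hd u ≡ true
          real-hard = all-real-hard (subst (_≤ hdeg K v) (≡.sym r3) hdeg≥3)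

          few : soft-real ≤ 1
          few = ℕₚ.≤-trans (ℕₚ.≤-reflexive (∑-zero λ u → ⟦⟧-false λ h → not-elim (∧-elimʳ {R K v u} h) (real-hard (∧-elimˡ h)))) z≤n

          income₂ : 2 * b + 4 * g ≤ C v (inn v)
          income₂ = ≤-resp₂ (trans (cong₂ _+_ (≡.sym (C-* v 2 (λ u w → ⟦ FR u w ⟧))) (≡.sym (C-* v 4 (λ u w → ⟦ RR u w ⟧))))
              (≡.sym (C-+ v (λ u w → 2 * ⟦ FR u w ⟧) (λ u w → 4 * ⟦ RR u w ⟧)))) refl (C-mono corner)
            where
            pays : ∀ {u w} → R K v u ≡ true → 2 ≤ fl u v w
            pays {u} {w} r = ℕₚ.≤-trans (ℕₚ.≤-reflexive (cong (2 *_) (≡.sym (⟦⟧-true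
              (pay₂-intro {u} {v} {w} (real-hard r) d5 (ℕₚ.≤-trans (s≤s z≤n) (ℕₚ.≤-reflexive (≡.sym s2))) (inj₁ s2)))))) (ℕₚ.m≤n+m _ (3 * ⟦ pay₃ u v ⟧))
            corner : ∀ u w → T v u w ≡ true → 2 * ⟦ FR u w ⟧ + 4 * ⟦ RR u w ⟧ ≤ inn v u w
            corner u w t = by (R-or-F u (T-vu t)) (R-or-F w (T-vw t))
              where
              value : ∀ {r r′ f f′} → R K v u ≡ r → R K v w ≡ r′ → F K v u ≡ f → F K v w ≡ f′ →
                2 * ⟦ f xor f′ ⟧ + 4 * ⟦ r ∧ r′ ⟧ ≤ inn v u w → 2 * ⟦ FR u w ⟧ + 4 * ⟦ RR u w ⟧ ≤ inn v u w
              value e₁ e₂ e₃ e₄ h = ≤-resp₂ (cong₂ (λ p q → 2 * ⟦ p ⟧ + 4 * ⟦ q ⟧) (cong₂ _xor_ e₃ e₄) (cong₂ _∧_ e₁ e₂)) refl h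
              by : (R K v u ≡ true × F K v u ≡ false) ⊎ (R K v u ≡ false × F K v u ≡ true) →
                   (R K v w ≡ true × F K v w ≡ false) ⊎ (R K v w ≡ false × F K v w ≡ true) →
                   2 * ⟦ FR u w ⟧ + 4 * ⟦ RR u w ⟧ ≤ inn v u w
              by (inj₁ (p , q)) (inj₁ (p′ , q′)) = value p p′ q q′ (ℕₚ.+-mono-≤ (pays {u} {w} p) (pays {w} {u} p′))
              by (inj₁ (p , q)) (inj₂ (p′ , q′)) = value p p′ q q′ (ℕₚ.≤-trans (pays {u} {w} p) (ℕₚ.m≤m+n _ (fl w v u)))
              by (inj₂ (p , q)) (inj₁ (p′ , q′)) = value p p′ q q′ (ℕₚ.≤-trans (pays {w} {u} p′) (ℕₚ.m≤n+m _ (fl u v w)))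
              by (inj₂ (p , q)) (inj₂ (p′ , q′)) = value p p′ q q′ z≤n

          g≤1 : g ≤ 1
          g≤1 = half g (subst (2 * g ≤_) r3 (R-slots few))
            where
            half : ∀ g → 2 * g ≤ 3 → g ≤ 1
            half 0 _ = z≤n
            half 1 _ = s≤s z≤n
            half (suc (suc g)) h = ⊥-elim (ℕₚ.<-irrefl refl (lin {a = 4} {3} h (2 * g) (solve (g ∷ []))))

          F4 : 2 * a + b ≤ 4
          F4 = subst (λ s → 2 * a + b ≤ 2 * s) s2 F-slots

          -- The worst case has five triangular corners, one with two real sides and four with one.
          -- Their cost 30 is covered exactly by the initial 18, two payments at the first corner
          -- and one at each of the others; this fixes the amount 2 of the transfer.
          soft-five₂ : 72 + C v (λ u w → 6 + out v u w) ≤ rhs v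
          soft-five₂ = finish 72 (≤-resp₂ (cong (λ x → 72 + 6 * x) τ-split) (cong (λ d → 18 * d + C v (inn v)) d5)
            (arith g a b (C v (inn v)) g≤1 F4 income₂))
            where
            arith : ∀ g a b i → g ≤ 1 → 2 * a + b ≤ 4 → 2 * b + 4 * g ≤ i → 72 + 6 * (g + (a + b)) ≤ 90 + i
            arith g a b i h₁ h₂ h₃ = lin (2 ⊛ h₁ ⊕ 4 ⊛ h₂ ⊕ h₃) (2 * a) (solve (g ∷ a ∷ b ∷ i ∷ []))

          -- Equality leaves only the worst case, that is, the surroundings needed for the reduction
          -- of three vertices.
          tight : rhs v ≤ 72 + C v (λ u w → 6 + out v u w) → 5 ≤ τ × 1 ≤ g
          tight h = arith₁ τ g a b (C v (inn v)) τ-split h′ F4 income₂ , arith₂ g a b (C v (inn v)) (subst (λ t → 90 + C v (inn v) ≤ 72 + 6 * t) τ-split h′) F4 income₂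
            where
            h′ : 90 + C v (inn v) ≤ 72 + 6 * τ
            h′ = ≤-resp₂ (cong (λ d → 18 * d + C v (inn v)) (≡.sym d5)) (cong (72 +_) (≡.sym no-out)) h
            arith₁ : ∀ t g a b i → t ≡ g + (a + b) → 90 + i ≤ 72 + 6 * t → 2 * a + b ≤ 4 → 2 * b + 4 * g ≤ i → 5 ≤ t
            arith₁ _ g a b i refl h₁ h₂ h₃ = ℕₚ.*-cancelˡ-≤ 2 (lin {a = 2 * 5} (h₁ ⊕ 2 ⊛ h₂ ⊕ h₃) 0 (solve (g ∷ a ∷ b ∷ i ∷ [])))
            arith₂ : ∀ g a b i → 90 + i ≤ 72 + 6 * (g + (a + b)) → 2 * a + b ≤ 4 → 2 * b + 4 * g ≤ i → 1 ≤ g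
            arith₂ g a b i h₁ h₂ h₃ = ℕₚ.*-cancelˡ-≤ 2 (lin {a = 2 * 1} (h₁ ⊕ 4 ⊛ h₂ ⊕ h₃) (2 * a) (solve (g ∷ a ∷ b ∷ i ∷ [])))

        soft-five : 72 + C v (λ u w → 6 + out v u w) ≤ rhs v
        soft-five = by (sdeg K v) refl (ℕₚ.≤-trans (ℕₚ.+-monoˡ-≤ (sdeg K v) (ℕₚ.≤-trans hdeg≥3 (hdeg≤rdeg v))) (ℕₚ.≤-reflexive rs))
          where
          by : ∀ s → sdeg K v ≡ s → 3 + sdeg K v ≤ 5 → 72 + C v (λ u w → 6 + out v u w) ≤ rhs v
          by 0 e _ = soft-five₀ e
          by 1 e _ = soft-five₁ e
          by 2 e _ = Two.soft-five₂ e
          by (suc (suc (suc s))) e h = ⊥-elim (absurd s (subst (λ s → 3 + s ≤ 5) e h))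
            where
            absurd : ∀ s → ¬ (3 + (3 + s) ≤ 5)
            absurd s (s≤s (s≤s (s≤s (s≤s (s≤s ())))))

-- Equality at every vertex

four-or-six : ∀ d → 4 ≤ d → odd d ≡ false → d ≡ 4 ⊎ 6 ≤ d
four-or-six 4 _ _ = inj₁ refl
four-or-six (suc (suc (suc (suc (suc (suc d)))))) _ _ = inj₂ (ℕₚ.m≤m+n 6 d)
four-or-six 0 () _
four-or-six 1 (s≤s ()) _
four-or-six 2 (s≤s (s≤s ())) _
four-or-six 3 (s≤s (s≤s (s≤s ()))) _

four-five-six : ∀ d → 4 ≤ d → d ≡ 4 ⊎ d ≡ 5 ⊎ 6 ≤ d
four-five-six 4 _ = inj₁ refl
four-five-six 5 _ = inj₂ (inj₁ refl)
four-five-six (suc (suc (suc (suc (suc (suc d)))))) _ = inj₂ (inj₂ (ℕₚ.m≤m+n 6 d))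
four-five-six 0 ()
four-five-six 1 (s≤s ())
four-five-six 2 (s≤s (s≤s ()))
four-five-six 3 (s≤s (s≤s (s≤s ())))

module _ {N : ℕ} where
  private
    V : Set
    V = Fin N

  open Mixed

  module Contradiction (K : Mixed N) (irr : Irreducible K) where
    open Irreducible irr
    open Balance K irr
    open HardBalance K irr
    open SoftBalance K irr

    weight : V → ℕ
    weight v = C v λ u w → 6 + out v u w

    lhs-alive : ∀ {v} → alive K v ≡ true → lhs v ≡ 72 + weight v
    lhs-alive {v} al = cong (λ b → 72 * ⟦ b ⟧ + weight v) al

    balanced : ∀ v → lhs v ≤ rhs v
    balanced v = by (true? (alive K v))
      where
      dead : ¬ (alive K v ≡ true) → weight v ≡ 0
      dead ¬al = ∑-zero λ u → ∑-zero λ w → cong (_* (6 + out v u w)) (⟦⟧-false λ t → ¬al (alive-l (T-vu t)))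
      soft : alive K v ≡ true → hd v ≡ false → deg K v ≡ 4 ⊎ deg K v ≡ 5 ⊎ 6 ≤ deg K v → 72 + weight v ≤ rhs v
      soft al sv (inj₁ d)        = false≢true sv (four-hard al d)
      soft al sv (inj₂ (inj₁ d)) = SoftVertex.soft-five v sv al d
      soft al sv (inj₂ (inj₂ h)) = SoftVertex.soft-big v sv al h
      hardCase : alive K v ≡ true → hd v ≡ true → deg K v ≡ 4 ⊎ 6 ≤ deg K v → 72 + weight v ≤ rhs v
      hardCase al hv (inj₁ d) = four-balance v al d
      hardCase al hv (inj₂ h) = case HardVertex.hard-balance v hv al h of λ where
        (inj₁ strict)     → ℕₚ.≤-trans (ℕₚ.n≤1+n _) strict
        (inj₂ (weak , _)) → weak
      live : alive K v ≡ true → Dec (hd v ≡ true) → 72 + weight v ≤ rhs v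
      live al (yes hv) = hardCase al hv (four-or-six _ (deg≥ v al) (hard-deg-even hv))
      live al (no sv)  = soft al (¬true⇒false sv) (four-five-six _ (deg≥ v al))
      by : Dec (alive K v ≡ true) → lhs v ≤ rhs v
      by (yes al) = ≤-resp₂ (lhs-alive al) refl (live al (true? (hd v)))
      by (no ¬al) = ≤-resp₂ (cong₂ (λ a b → 72 * a + b) (⟦⟧-false ¬al) (dead ¬al)) refl z≤n

    tight : ∀ {v} → alive K v ≡ true → rhs v ≤ 72 + weight v
    tight {v} al = ℕₚ.≤-reflexive (trans (≡.sym (∑-eq balanced rhs≤lhs v)) (lhs-alive al))

    no-strict : ∀ {v} → alive K v ≡ true → ¬ (73 + weight v ≤ rhs v)
    no-strict al strict = ℕₚ.<-irrefl refl (ℕₚ.≤-trans strict (tight al))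

    hard-six : ∀ {y} → alive K y ≡ true → hd y ≡ true → 6 ≤ deg K y → deg K y ≡ 6 × hdeg K y ≡ 3
    hard-six {y} al hy h = case HardVertex.hard-balance y hy al h of λ where
      (inj₁ strict)      → ⊥-elim (no-strict al strict)
      (inj₂ (_ , d , k)) → d , k

    -- By equality all corners at x are triangular and one, between u and w, has real sides. Its
    -- hard ends cannot have degree four, x being soft, so by equality they have degree 6 and hard
    -- degree 3, with sum 9, while x has sum at most 8. The next face x w z supplies the vertex z
    -- for `triangle`.
    no-rich-neighbour : ∀ {y x} → A K y x ≡ true → deg K x ≡ 5 → sdeg K x ≡ 2 → ⊥
    no-rich-neighbour {y} {x} yx d5 s2 = contra corner
      where
      al : alive K x ≡ true
      al = alive-r yx
      sx : hd x ≡ false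
      sx = ¬true⇒false λ h → case trans (≡.sym (cong odd d5)) (hard-deg-even h) of λ ()
      open SoftVertex x sx al using (τ; g; RR; module Two)
      open Two d5 s2 using (real-hard; r3) renaming (tight to tight₂)
      τg : 5 ≤ τ × 1 ≤ g
      τg = tight₂ (tight al)
      full : ∀ {u} → A K x u ≡ true → ∃ λ w → T x u w ≡ true
      full {u} xu = let w , p = ∑-pos _ (ℕₚ.≤-reflexive (trans (≡.sym (⟦⟧-true xu)) (≡.sym
                            (∑-eq (λ u → ≤-resp₂ (∑-cong λ w → ℕₚ.*-identityʳ _) refl (at-most-one {f = T x u} (λ i j → T-fun) (λ w → T-vu)))
                              (≤-resp₂ d5 refl (proj₁ τg)) u))))
                    in w , ⟦⟧-pos (≤-resp₂ refl (≡.sym (ℕₚ.*-identityʳ _)) p)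
      corner : ∃ λ u → ∃ λ w → T x u w ∧ RR u w ≡ true
      corner = let u , p = ∑-pos _ (proj₂ τg); w , q = ∑-pos _ p
               in u , w , ⟦⟧-pos (≤-resp₂ refl (⟦∧⟧ (T x u w) (RR u w)) q)
      nine : ∀ {u} → R K x u ≡ true → deg K u + hdeg K u ≤ 9
      nine {u} xu = by (four-or-six _ (deg≥ u (alive-r (R⇒A K {x} {u} xu))) (hard-deg-even (real-hard xu)))
        where
        by : deg K u ≡ 4 ⊎ 6 ≤ deg K u → deg K u + hdeg K u ≤ 9
        by (inj₁ d) = false≢true sx (four-nbr d (A-sym K x u (R⇒A K {x} {u} xu)))
        by (inj₂ h) = let d , k = hard-six (alive-r (R⇒A K {x} {u} xu)) (real-hard xu) h in
          ℕₚ.≤-reflexive (cong₂ _+_ d k)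
      contra : (∃ λ u → ∃ λ w → T x u w ∧ RR u w ≡ true) → ⊥
      contra (u , w , h) = triangle x u w z sx (real-hard xu) (real-hard xw) xu xw
          (hard-R K {u} (real-hard xu) {w} (T-uw t)) (T-vw t′) (T-uw t′)
          (λ e → no-digon t (subst (λ z → T x w z ≡ true) e t′))
          (ℕₚ.+-mono-≤ (ℕₚ.≤-reflexive d5) (ℕₚ.≤-trans (hdeg≤rdeg x) (ℕₚ.≤-reflexive r3))) (nine xu) (nine xw)
        where
        t : T x u w ≡ true
        t = ∧-elimˡ h
        xu = ∧-elimˡ (∧-elimʳ {T x u w} h)
        xw = ∧-elimʳ {R K x u} (∧-elimʳ {T x u w} h)
        z = proj₁ (full (T-vw t))
        t′ : T x w z ≡ true
        t′ = proj₂ (full (T-vw t))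

    no-hard-six : ∀ {y} → alive K y ≡ true → hd y ≡ true → ¬ (6 ≤ deg K y)
    no-hard-six {y} al hy h = let d , k = hard-six al hy h in
      no-strict al (HardVertex.poor-needed y hy al d k λ u yu d5 s2 → no-rich-neighbour yu d5 s2)

    -- Only degree four is left for a hard vertex. All its neighbours are hard too, hence of degree
    -- four, which `fours` forbids.
    no-hard : ∀ {y} → alive K y ≡ true → ¬ (hd y ≡ true)
    no-hard {y} al hy = by (four-or-six _ (deg≥ y al) (hard-deg-even hy))
      where
      by : deg K y ≡ 4 ⊎ 6 ≤ deg K y → ⊥
      by (inj₂ h) = no-hard-six al hy h
      by (inj₁ d) = let u , yu = ∑-∃ {f = A K y} (ℕₚ.≤-trans (s≤s z≤n) (deg≥ y al))
                        hu = four-nbr d yu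
                    in case four-or-six _ (deg≥ u (alive-r yu)) (hard-deg-even hu) of λ where
                         (inj₁ d′) → fours y u (hard-R K {y} hy {u} yu) hy hu d d′
                         (inj₂ h)  → no-hard-six (alive-r yu) hu h

    -- Without hard vertices `light` demands degree at least 8, and such a vertex would keep a
    -- positive charge.
    nothing-alive : ∀ v → ¬ (alive K v ≡ true)
    nothing-alive v al = no-strict al (SoftVertex.soft-bigger v (¬true⇒false (no-hard al)) al
      (ℕₚ.≤-trans (ℕₚ.n≤1+n 7) (subst (8 ≤_) (trans (cong (deg K v +_) h0) (ℕₚ.+-identityʳ _)) (light v al))))
      where
      h0 : hdeg K v ≡ 0
      h0 = ∑-zero λ u → ⟦⟧-false λ h → no-hard (alive-r (R⇒A K {v} {u} (∧-elimˡ h))) (∧-elimʳ {R K v u} h)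

-- The minimal counterexample

-- Makes colourability decidable, so that the argument by a counterexample is constructive; `resp`
-- takes the place of function extensionality.
search-functions : ∀ {m} {B : Set} → (∀ {Q : B → Set} → (∀ b → Dec (Q b)) → Dec (∃ Q)) →
  {P : (Fin m → B) → Set} → (∀ {f g} → (∀ i → f i ≡ g i) → P f → P g) → (∀ f → Dec (P f)) → Dec (∃ P)
search-functions {zero} {B} search resp dec = map′ (λ p → empty , p) (λ (f , p) → resp (λ ()) p) (dec empty)
  where
  empty : Fin 0 → B
  empty ()
search-functions {suc m} {B} search {P} resp dec =
  map′ (λ (b , f , p) → cons b f , p) (λ (f , p) → f zero , f ∘ suc , resp (λ { zero → refl ; (suc i) → refl }) p)
    (search λ b → search-functions search (λ e → resp λ { zero → refl ; (suc i) → e i }) λ f → dec (cons b f))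
  where
  cons : B → (Fin m → B) → Fin (suc m) → B
  cons b f zero    = b
  cons b f (suc i) = f i

module _ {N : ℕ} where
  open Mixed

  colorable? : (K : Mixed N) → Dec (Colorable K)
  colorable? K = search-functions Finₚ.any? resp λ c →
    (Finₚ.all? λ x → Finₚ.all? λ y → true? (A K x y) →-dec ¬? (c x ≟ c y)) ×-dec
    (Finₚ.all? λ v → (sdeg K v ℕ.≟ 0) →-dec ((1 ℕ.≤? rdeg K v) →-dec Finₚ.any? λ i → true? (odd (count K c v i))))
    where
    resp : ∀ {c c′ : Fin N → Fin 8} → (∀ i → c i ≡ c′ i) →
      (∀ x y → A K x y ≡ true → c x ≢ c y) × (∀ v → sdeg K v ≡ 0 → 1 ≤ rdeg K v → OddAt K c v) →
      (∀ x y → A K x y ≡ true → c′ x ≢ c′ y) × (∀ v → sdeg K v ≡ 0 → 1 ≤ rdeg K v → OddAt K c′ v)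
    resp e (p , o) = (λ x y h h′ → p x y h (trans (e x) (trans h′ (≡.sym (e y))))) , λ v s r →
      let i , h = o v s r in i , trans (cong odd (∑-cong λ u → cong (λ k → ⟦ R K v u ∧ k == i ⟧) (≡.sym (e u)))) h

  edgeless-colorable : (K : Mixed N) → (∀ x y → ¬ (A K x y ≡ true)) → Colorable K
  edgeless-colorable K none = (λ _ → zero) , (λ x y h → ⊥-elim (none x y h)) , λ v _ r →
    let u , h = ∑-∃ {f = R K v} r in ⊥-elim (none v u (R⇒A K {v} {u} h))

  isolated-colorable : (K : Mixed N) → ∀ v → alive K v ≡ true → (∀ u → ¬ (A K v u ≡ true)) → Colorable K
  isolated-colorable K v al none = edgeless-colorable K λ x y h → by x y h (x ≟ v)
    where
    by : ∀ x y → A K x y ≡ true → Dec (x ≡ v) → ⊥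
    by x y h (yes refl) = none y h
    by x y h (no ne) = let u , w , su , _ , uw = conn K (_== v) v x al (A-alive K x y h) (==-refl v) (≢⇒== ne) in
      none w (subst (λ u → A K u w ≡ true) (==⇒≡ su) uw)

  uncolorable-irreducible : (K : Mixed N) → (∀ K′ → size K′ < size K → Colorable K′) → ¬ Colorable K → Irreducible K
  uncolorable-irreducible K ih nc = record
    { light = λ v al → ℕₚ.≰⇒> λ le → by-light v al le (Finₚ.any? λ z → true? (A K v z))
    ; pair = λ x y z hy xy xz yz lx ly → nc (reduce-pair x y z hy xy xz yz lx ly)
    ; triangle = λ x u w z sx hu hw xu xw uw xz wz ne lx lu lw →
        nc (reduce-triangle x u w z sx hu hw xu xw uw xz wz ne lx lu lw)
    ; fours = λ u v uv hu hv du dv → nc (reduce-fours u v uv hu hv du dv)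
    }
    where
    open Reduce K ih
    by-light : ∀ v → alive K v ≡ true → deg K v + hdeg K v ≤ 7 → Dec (∃ λ z → A K v z ≡ true) → ⊥
    by-light v al le (yes (z , vz)) = nc (reduce-light v z vz le)
    by-light v al le (no none)      = nc (isolated-colorable K v al λ u h → none (u , h))

  -- An uncolourable K would be irreducible by the induction hypothesis and so have no alive vertex;
  -- but then it has no edge and is colourable by a constant.
  mixed-colorable : ∀ fuel (K : Mixed N) → size K < fuel → Colorable K
  mixed-colorable (suc fuel) K le = decidable-stable (colorable? K) λ nc →
    nc (edgeless-colorable K λ x y h → Contradiction.nothing-alive K
      (uncolorable-irreducible K (λ K′ lt → mixed-colorable fuel K′ (ℕₚ.≤-trans lt (ℕₚ.≤-pred le))) nc) x (A-alive K x y h))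

-- From rotation systems to labelled faces

module _ {X : Set} (f : X → X) where

  iter-+ : ∀ a b x → iter f (a + b) x ≡ iter f a (iter f b x)
  iter-+ zero    b x = refl
  iter-+ (suc a) b x = cong f (iter-+ a b x)

  module _ (D : X → Set) (pres : ∀ {x} → D x → D (f x)) (inj : ∀ {x y} → D x → D y → f x ≡ f y → x ≡ y)
           {M : ℕ} (code : X → Fin M) (code-inj : ∀ {x y} → code x ≡ code y → x ≡ y) where

    iter-pres : ∀ k {x} → D x → D (iter f k x)
    iter-pres zero    d = d
    iter-pres (suc k) d = pres (iter-pres k d)

    iter-cancel : ∀ i j {x} → D x → iter f i x ≡ iter f (i + j) x → x ≡ iter f j x
    iter-cancel zero    j d e = e
    iter-cancel (suc i) j d e = iter-cancel i j d (inj (iter-pres i d) (iter-pres (i + j) d) e)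

    -- Two of the first M + 1 iterates have the same code, and their common initial steps cancel by
    -- injectivity on D.
    periodic : ∀ {x} → D x → ∃ λ p → iter f (suc p) x ≡ x
    periodic {x} d with Finₚ.pigeonhole (ℕₚ.n<1+n M) (λ i → code (iter f (Fin.toℕ i) x))
    ... | i , j , i<j , e with ℕₚ.m≤n⇒∃[o]m+o≡n i<j
    ...   | o , q = o , ≡.sym (iter-cancel (Fin.toℕ i) (suc o) d
              (trans (code-inj e) (cong (λ k → iter f k x) (≡.sym (trans (ℕₚ.+-suc (Fin.toℕ i) o) q)))))

    iter-multiple : ∀ p {x} → iter f (suc p) x ≡ x → ∀ k → iter f (k * suc p) x ≡ x
    iter-multiple p e zero    = refl
    iter-multiple p {x} e (suc k) = trans (iter-+ (suc p) (k * suc p) x)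
      (trans (cong (iter f (suc p)) (iter-multiple p e k)) e)

    -- `SameFace` only looks forward. With period p + 1, going back k steps is going forward k p
    -- steps, as k p + k is a multiple of the period.
    iter-back : ∀ k {x y} → D x → iter f k x ≡ y → ∃ λ l → iter f l y ≡ x
    iter-back k {x} d refl = let p , e = periodic d in k * p ,
      trans (≡.sym (iter-+ (k * p) k x)) (trans (cong (λ j → iter f j x) (arith k p)) (iter-multiple p e k))
      where
      arith : ∀ k p → k * p + k ≡ k * suc p
      arith k p = solve (k ∷ p ∷ [])

-- Finite injections and counting in lists

injective-hits : ∀ {m} (g : Fin (suc m) → Fin (suc m)) → (∀ {i j} → g i ≡ g j → i ≡ j) → ∀ z → ¬ (∀ y → g y ≢ z)
injective-hits {m} g inj z out with Finₚ.pigeonhole (ℕₚ.n<1+n m) (λ y → Fin.punchOut (out y ∘ ≡.sym))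
... | i , j , i<j , q = Finₚ.<⇒≢ i<j (inj (Finₚ.punchOut-injective (out i ∘ ≡.sym) (out j ∘ ≡.sym) q))

-- A section g of f is injective, so by pigeonhole every element is a value of g. Hence both x and
-- x′ are recovered from their common image by g.
surjective⇒injective : ∀ {m} (f : Fin m → Fin m) → (∀ y → ∃ λ x → f x ≡ y) → ∀ {x x′} → f x ≡ f x′ → x ≡ x′
surjective⇒injective {suc m} f surj {x} {x′} e = by (x ≟ x′) (g (f x) ≟ x)
  where
  g : Fin (suc m) → Fin (suc m)
  g y = proj₁ (surj y)
  g-inj : ∀ {i j} → g i ≡ g j → i ≡ j
  g-inj {i} {j} e = trans (≡.sym (proj₂ (surj i))) (trans (cong f e) (proj₂ (surj j)))
  section : ∀ {z y} → g y ≡ z → g (f z) ≡ z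
  section {y = y} gy = trans (cong g (trans (cong f (≡.sym gy)) (proj₂ (surj y)))) gy
  by : Dec (x ≡ x′) → Dec (g (f x) ≡ x) → x ≡ x′
  by (yes p) _        = p
  by (no ne) (yes gx) = ⊥-elim (injective-hits g g-inj x′ λ y gy → ne (trans (≡.sym gx) (trans (cong g e) (section gy))))
  by (no ne) (no gx)  = ⊥-elim (injective-hits g g-inj x λ y gy → gx (section gy))

all-lookup : ∀ {X : Set} {P : X → Set} {xs} → All P xs → ∀ j → P (lookup xs j)
all-lookup (p All.∷ ps) zero    = p
all-lookup (p All.∷ ps) (suc j) = all-lookup ps j

allPairs-lookup : ∀ {X : Set} {P : X → X → Set} {xs} → AllPairs P xs → ∀ i j →
  i ≡ j ⊎ P (lookup xs i) (lookup xs j) ⊎ P (lookup xs j) (lookup xs i)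
allPairs-lookup (px AllPairs.∷ ps) zero    zero    = inj₁ refl
allPairs-lookup (px AllPairs.∷ ps) zero    (suc j) = inj₂ (inj₁ (all-lookup px j))
allPairs-lookup (px AllPairs.∷ ps) (suc i) zero    = inj₂ (inj₂ (all-lookup px i))
allPairs-lookup (px AllPairs.∷ ps) (suc i) (suc j) = case allPairs-lookup ps i j of λ where
  (inj₁ e) → inj₁ (cong suc e)
  (inj₂ p) → inj₂ p

length-filter-tabulate : ∀ {X : Set} (p : X → Bool) {m} (f : Fin m → X) →
  length (filterᵇ p (tabulate f)) ≡ ∑ λ i → ⟦ p (f i) ⟧
length-filter-tabulate p {zero}  f = ≡.sym (∑-empty _)
length-filter-tabulate p {suc m} f = trans head (≡.sym (∑-suc λ i → ⟦ p (f i) ⟧))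
  where
  head : length (filterᵇ p (f zero ∷ tabulate (f ∘ suc))) ≡ ⟦ p (f zero) ⟧ + ∑ (λ i → ⟦ p (f (suc i)) ⟧)
  head with p (f zero)
  ... | true  = cong suc (length-filter-tabulate p (f ∘ suc))
  ... | false = length-filter-tabulate p (f ∘ suc)

length-filter-++ : ∀ {X : Set} (p : X → Bool) xs ys →
  length (filterᵇ p (xs ++ ys)) ≡ length (filterᵇ p xs) + length (filterᵇ p ys)
length-filter-++ p []       ys = refl
length-filter-++ p (x ∷ xs) ys with p x
... | true  = cong suc (length-filter-++ p xs ys)
... | false = length-filter-++ p xs ys

length-filter-map : ∀ {X Y : Set} (p : Y → Bool) (f : X → Y) xs →
  length (filterᵇ p (map f xs)) ≡ length (filterᵇ (p ∘ f) xs)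
length-filter-map p f []       = refl
length-filter-map p f (x ∷ xs) with p (f x)
... | true  = cong suc (length-filter-map p f xs)
... | false = length-filter-map p f xs

length-filter-product : ∀ {X Y : Set} (p : X × Y → Bool) {m k} (f : Fin m → X) (g : Fin k → Y) →
  length (filterᵇ p (cartesianProduct (tabulate f) (tabulate g))) ≡ ∑ λ i → ∑ λ j → ⟦ p (f i , g j) ⟧
length-filter-product p {zero}  f g = ≡.sym (∑-empty _)
length-filter-product p {suc m} f g = trans (length-filter-++ p (map (f zero ,_) (tabulate g)) _)
  (trans (cong₂ _+_ (trans (length-filter-map p (f zero ,_) (tabulate g)) (length-filter-tabulate (λ y → p (f zero , y)) g))
    (length-filter-product p (f ∘ suc) g)) (≡.sym (∑-suc λ i → ∑ λ j → ⟦ p (f i , g j) ⟧)))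

-- The labelled faces of a rotation system

module _ (H : Graph) (rot : Fin (n H) → Fin (n H) → Fin (n H)) (reps : List (Dart H))
         (isRot : IsRotationSystem H rot) (isReps : FaceReps H rot reps)
         (bound : length (darts H) ≤ 2 * (n H + length reps)) where
  private
    V : Set
    V = Fin (n H)

    rot-A : ∀ v u → Adj H v u → Adj H v (rot v u)
    rot-A = proj₁ isRot

    Adj-sym : ∀ u v → Adj H u v → Adj H v u
    Adj-sym u v h = trans (Graph.sym H v u) h

    rot-tr : ∀ v (S : V → Bool) → (∀ u → adj H v u ≡ true → S u ≡ true → S (rot v u) ≡ true) →
             ∀ u w → adj H v u ≡ true → adj H v w ≡ true → S u ≡ true → S w ≡ true
    rot-tr v S closed u w vu vw su = let k , e = proj₂ isRot v u w vu vw in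
      trans (cong S (≡.sym e)) (proj₂ (go k))
      where
      go : ∀ k → adj H v (iter (rot v) k u) ≡ true × S (iter (rot v) k u) ≡ true
      go zero    = vu , su
      go (suc k) = rot-A v _ (proj₁ (go k)) , closed _ (proj₁ (go k)) (proj₂ (go k))

    -- The image of the rotation is a closed set, hence the whole neighbourhood. Extended by the
    -- identity, the rotation is a surjection of all vertices onto themselves, and so injective.
    rot-inj : ∀ {v u u′} → Adj H v u → Adj H v u′ → rot v u ≡ rot v u′ → u ≡ u′
    rot-inj {v} {u} {u′} h h′ e = surjective⇒injective total surj (trans (total-A h) (trans e (≡.sym (total-A h′))))
      where
      total : V → V
      total x = if adj H v x then rot v x else x
      total-A : ∀ {x} → Adj H v x → total x ≡ rot v x
      total-A h rewrite h = refl
      surj : ∀ y → ∃ λ x → total x ≡ y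
      surj y with true? (adj H v y)
      ... | no ¬h = y , fixed
        where
        fixed : total y ≡ y
        fixed rewrite ¬true⇒false ¬h = refl
      ... | yes h = let x , p = ∑-∃ {f = image} (subst (1 ≤_) refl (positive-elim reached)) in
              x , trans (total-A (∧-elimˡ p)) (==⇒≡ (∧-elimʳ {adj H v x} p))
        where
        image : V → Bool
        image x = adj H v x ∧ rot v x == y
        hit : V → Bool
        hit z = positive (∑ λ x → ⟦ adj H v x ∧ rot v x == z ⟧)
        step : ∀ x → Adj H v x → hit (rot v x) ≡ true
        step x hx = positive-intro (∃-∑ {f = λ x′ → adj H v x′ ∧ rot v x′ == rot v x} x (∧-intro hx (==-refl (rot v x))))
        reached : hit y ≡ true
        reached = rot-tr v hit (λ x hx _ → step x hx) (rot v y) y (rot-A v y h) h (step y h)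

    φ : Dart H → Dart H
    φ = faceStep H rot

    φ-pres : ∀ {d} → IsDart H d → IsDart H (φ d)
    φ-pres {u , v} h = rot-A v u (Adj-sym u v h)

    φ-inj : ∀ {d d′} → IsDart H d → IsDart H d′ → φ d ≡ φ d′ → d ≡ d′
    φ-inj {u , v} {u′ , v′} h h′ e with cong proj₁ e
    ... | refl = cong (_, v) (rot-inj (Adj-sym u v h) (Adj-sym u′ v h′) (cong proj₂ e))

    code : Dart H → Fin (n H * n H)
    code (u , v) = Fin.combine u v

    code-inj : ∀ {d d′} → code d ≡ code d′ → d ≡ d′
    code-inj {u , v} {u′ , v′} e = let p , q = Finₚ.combine-injective u v u′ v′ e in cong₂ _,_ p q

    same-sym : ∀ {d e} → IsDart H d → SameFace H rot d e → SameFace H rot e d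
    same-sym d (k , e) = iter-back φ (IsDart H) φ-pres φ-inj code code-inj k d e

    same-trans : ∀ {d e g} → SameFace H rot d e → SameFace H rot e g → SameFace H rot d g
    same-trans {d} (k , refl) (l , refl) = l + k , iter-+ φ l k d

    rep : ∀ d → IsDart H d → ∃ λ i → SameFace H rot (lookup reps i) d
    rep d h = let r , r∈ , s = proj₂ (proj₂ isReps) d h in
      index r∈ , subst (λ r → SameFace H rot r d) (lookup-index r∈) s

    rep-dart : ∀ i → IsDart H (lookup reps i)
    rep-dart = all-lookup (proj₁ isReps)

    rep-unique : ∀ i j → SameFace H rot (lookup reps i) (lookup reps j) → i ≡ j
    rep-unique i j s = case allPairs-lookup (proj₁ (proj₂ isReps)) i j of λ where
      (inj₁ e)         → e
      (inj₂ (inj₁ ne)) → ⊥-elim (ne s)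
      (inj₂ (inj₂ ne)) → ⊥-elim (ne (same-sym (rep-dart i) s))

    -- The label zero is a default for pairs that are not darts; it keeps `lab` total even if there
    -- are no representatives.
    label : ∀ u v → Dec (Adj H u v) → Fin (suc (length reps))
    label u v (yes h) = suc (proj₁ (rep (u , v) h))
    label u v (no _)  = zero

    lab : V → V → Fin (suc (length reps))
    lab u v = label u v (true? (adj H u v))

    lab-dart : ∀ u v → Adj H u v → ∀ i → SameFace H rot (lookup reps i) (u , v) → lab u v ≡ suc i
    lab-dart u v h i s = by (true? (adj H u v))
      where
      by : (d : Dec (Adj H u v)) → label u v d ≡ suc i
      by (no ¬h)  = ⊥-elim (¬h h)
      by (yes h′) = cong suc (rep-unique _ i (same-trans (proj₂ (rep (u , v) h′)) (same-sym (rep-dart i) s)))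

  rotationTorus : Torus (λ _ → true) (adj H)
  rotationTorus = record
    { A-sym = Adj-sym
    ; A-irr = λ a h → false≢true (irrefl H a) h
    ; A-alive = λ _ _ _ → refl
    ; rot = rot ; rot-A = rot-A ; rot-tr = rot-tr
    ; L = suc (length reps) ; lab = lab
    ; lab-φ = λ a b h → let i , s = rep (a , b) h in
        trans (lab-dart b (rot b a) (φ-pres {a , b} h) i (same-trans s (1 , refl))) (≡.sym (lab-dart a b h i s))
    ; euler = ≤-resp₂ (≡.sym (length-filter-product (λ d → adj H (proj₁ d) (proj₂ d)) (λ i → i) (λ j → j)))
        (cong (λ x → 2 * (x + ∑ λ l → ⟦ used (adj H) lab l ⟧)) ∑-one)
        (ℕₚ.≤-trans bound (ℕₚ.*-monoʳ-≤ 2 (ℕₚ.+-monoʳ-≤ (n H) labels)))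
    }
    where
    labels : length reps ≤ ∑ λ l → ⟦ used (adj H) lab l ⟧
    labels = ≤-resp₂ (≡.sym (∑-one)) (∑-suc λ l → ⟦ used (adj H) lab l ⟧) (ℕₚ.≤-trans (∑-mono λ i →
      ℕₚ.≤-reflexive (≡.sym (⟦⟧-true (used-intro {A = adj H} {lab} _ _ (rep-dart i) (lab-dart _ _ (rep-dart i) i (0 , refl))))))
      (ℕₚ.m≤n+m _ _))

-- Components

search-Bool : ∀ {Q : Bool → Set} → (∀ b → Dec (Q b)) → Dec (∃ Q)
search-Bool dec with dec true | dec false
... | yes q | _      = yes (true , q)
... | no _  | yes q  = yes (false , q)
... | no ¬q | no ¬q′ = no λ { (true , q) → ¬q q ; (false , q) → ¬q′ q }

module _ {N : ℕ} where
  private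
    V : Set
    V = Fin N

  -- Deleting edges outside S would leave isolated vertices, which still count in Euler's
  -- inequality. They are contracted into S instead, along edges that the connectedness of the
  -- ambient graph provides.
  shrinkTorus : ∀ fuel {al A} → Torus al A → Conn al A → (S : V → Bool) → (∀ x → S x ≡ true → al x ≡ true) →
    ∀ s → S s ≡ true → (E : V → V → Bool) → (∀ x y → S x ≡ true → S y ≡ true → E x y ≡ true → A x y ≡ true) →
    ∑ (λ x → ⟦ al x ⟧) ≤ fuel →
    ∃ λ al′ → ∃ λ A′ → Torus al′ A′ × (∀ x → al′ x ≡ true → S x ≡ true) ×
      (∀ x y → S x ≡ true → S y ≡ true → E x y ≡ true → A′ x y ≡ true)
  shrinkTorus fuel {al} {A} t conn S S⊆ s s∈ E E⊆ le = by fuel le (Finₚ.any? λ u → true? (al u ∧ not (S u)))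
    where
    open Torus t
    Goal : Set
    Goal = ∃ λ al′ → ∃ λ A′ → Torus al′ A′ × (∀ x → al′ x ≡ true → S x ≡ true) ×
      (∀ x y → S x ≡ true → S y ≡ true → E x y ≡ true → A′ x y ≡ true)
    inside : ∀ x → Dec (S x ≡ true) → ¬ (∃ λ u → al u ∧ not (S u) ≡ true) → al x ≡ true → S x ≡ true
    inside x (yes p) none h = p
    inside x (no ¬p) none h = ⊥-elim (none (x , ∧-intro h (not-intro ¬p)))
    by : ∀ fuel → ∑ (λ x → ⟦ al x ⟧) ≤ fuel → Dec (∃ λ u → al u ∧ not (S u) ≡ true) → Goal
    by _ _ (no none) = al , A , t , (λ x → inside x (true? (S x)) none) , E⊆
    by zero le (yes (u , h)) = case ℕₚ.≤-trans (∃-∑ {f = al} u (∧-elimˡ h)) le of λ ()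
    by (suc fuel) le (yes (u , h)) =
      let v , z , sv , sz , vz = conn (not ∘ S) u s (∧-elimˡ h) (S⊆ s s∈) (∧-elimʳ {al u} h) (cong not s∈)
          v∉ = not-elim sv
          ne : ∀ {x} → S x ≡ true → x ≢ v
          ne = λ { p refl → v∉ p }
      in shrinkTorus fuel (contractConnTorus t conn v z vz) (contractConn v z vz (A-≢ vz) A-sym conn) S
        (λ x p → without-intro (S⊆ x p) (ne p)) s s∈ E
        (λ x y p q e → contract-intro {A = A} (ne p) (ne q) (A-≢ (E⊆ x y p q e)) (E⊆ x y p q e))
        (less _ _ fuel (∑-without {al = al} v (A-alive v z vz)) le)
      where
      less : ∀ a b f → a + 1 ≡ b → b ≤ suc f → a ≤ f
      less a _ f refl h = lin h 0 (solve (a ∷ f ∷ []))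

  module Components (E : V → V → Bool) (E-sym : ∀ x y → E x y ≡ true → E y x ≡ true)
           (noadj : ∀ a b x y → E a b ≡ true → E a x ≡ true → E b x ≡ true → E a y ≡ true → E b y ≡ true → x ≡ y)
           {A₀ : V → V → Bool} (t₀ : Torus (λ _ → true) A₀) (conn₀ : Conn (λ _ → true) A₀)
           (E⊆A₀ : ∀ x y → E x y ≡ true → A₀ x y ≡ true) where

    Closed : (V → Bool) → Set
    Closed S = ∀ x y → S x ≡ true → E x y ≡ true → S y ≡ true

    OddOn : (V → Bool) → Set
    OddOn S = ∃ λ (c : V → Fin 8) → (∀ x y → S x ≡ true → E x y ≡ true → c x ≢ c y) ×
      (∀ v → S v ≡ true → (∃ λ u → E v u ≡ true) → ∃ λ i → odd (∑ λ u → ⟦ E v u ∧ c u == i ⟧) ≡ true)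

    connected-odd : ∀ S s → S s ≡ true → Closed S →
      (∀ X a b → S a ≡ true → S b ≡ true → X a ≡ true → X b ≡ false →
         ∃ λ u → ∃ λ w → S u ≡ true × X u ≡ true × X w ≡ false × E u w ≡ true) → OddOn S
    connected-odd S s s∈ closed connS = c , (λ x y p e → proper x y (toA p e)) , odds
      where
      shrunk = shrinkTorus N t₀ conn₀ S (λ _ _ → refl) s s∈ E (λ x y _ _ → E⊆A₀ x y) (ℕₚ.≤-reflexive ∑-one)
      al = proj₁ shrunk
      t₁ = proj₁ (proj₂ (proj₂ shrunk))
      al⇒S = proj₁ (proj₂ (proj₂ (proj₂ shrunk)))
      E⇒A₁ = proj₂ (proj₂ (proj₂ (proj₂ shrunk)))
      R : V → V → Bool
      R x y = S x ∧ (S y ∧ E x y)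
      R-elim : ∀ {x y} → R x y ≡ true → S x ≡ true × S y ≡ true × E x y ≡ true
      R-elim {x} {y} h = ∧-elimˡ h , ∧-elimˡ (∧-elimʳ {S x} h) , ∧-elimʳ {S y} (∧-elimʳ {S x} h)
      R-intro : ∀ {x y} → S x ≡ true → E x y ≡ true → R x y ≡ true
      R-intro {x} {y} p e = ∧-intro p (∧-intro (closed x y p e) e)
      A′ : V → V → Bool
      A′ x y = R x y ∨ false
      A′⇒R : ∀ {x y} → A′ x y ≡ true → R x y ≡ true
      A′⇒R {x} {y} h = case ∨-elim {R x y} h of λ { (inj₁ r) → r }
      toA : ∀ {x y} → S x ≡ true → E x y ≡ true → A′ x y ≡ true
      toA p e = ∨-introˡ (R-intro p e)
      RE : ∀ {x y} → R x y ≡ true → E x y ≡ true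
      RE {x} {y} h = proj₂ (proj₂ (R-elim {x} {y} h))
      R-sym : ∀ x y → R x y ≡ true → R y x ≡ true
      R-sym x y h = let _ , q , e = R-elim {x} {y} h in R-intro q (E-sym x y e)
      K : Mixed N
      K = record
        { alive = al ; R = R ; F = λ _ _ → false
        ; R-sym = R-sym
        ; R≢F = λ _ _ _ ()
        ; noadj = λ a b x y h₁ h₂ h₃ h₄ h₅ →
            noadj a b x y (RE {a} {b} h₁) (RE {a} {x} h₂) (RE {b} {x} h₃) (RE {a} {y} h₄) (RE {b} {y} h₅)
        ; torus = subgraphTorus t₁ A′ (λ x y h → ∨-introˡ (R-sym x y (A′⇒R {x} {y} h)))
            λ x y h → let p , q , e = R-elim {x} {y} (A′⇒R {x} {y} h) in E⇒A₁ x y p q e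
        ; conn = λ X a b ha hb xa xb → let u , w , su , xu , xw , e = connS X a b (al⇒S a ha) (al⇒S b hb) xa xb in
            u , w , xu , xw , toA su e
        }
      col : Mixed.Colorable K
      col = mixed-colorable (suc (Mixed.size K)) K ℕₚ.≤-refl
      c = proj₁ col
      proper = proj₁ (proj₂ col)
      odds : ∀ v → S v ≡ true → (∃ λ u → E v u ≡ true) → ∃ λ i → odd (∑ λ u → ⟦ E v u ∧ c u == i ⟧) ≡ true
      odds v sv (u , e) = let i , o = proj₂ (proj₂ col) v (∑-zero λ _ → refl) (∃-∑ {f = R v} u (R-intro sv e)) in
        i , trans (cong odd (∑-cong λ u → cong (λ b → ⟦ b ∧ c u == i ⟧) (true-≡ (R-intro sv) (RE {v} {u})))) o

    -- A witness of disconnectedness, used in place of components: it is found by searching all sets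
    -- X.
    Splits : (V → Bool) → (V → Bool) → Set
    Splits S X = (∃ λ a → S a ∧ X a ≡ true) × (∃ λ b → S b ∧ not (X b) ≡ true) ×
      ¬ (∃ λ u → ∃ λ w → (S u ∧ X u) ∧ (not (X w) ∧ E u w) ≡ true)

    splits? : ∀ S → Dec (∃ (Splits S))
    splits? S = search-functions search-Bool resp λ X →
      (Finₚ.any? λ a → true? (S a ∧ X a)) ×-dec (Finₚ.any? λ b → true? (S b ∧ not (X b))) ×-dec
      ¬? (Finₚ.any? λ u → Finₚ.any? λ w → true? ((S u ∧ X u) ∧ (not (X w) ∧ E u w)))
      where
      resp : ∀ {X Y : V → Bool} → (∀ i → X i ≡ Y i) → Splits S X → Splits S Y
      resp {X} {Y} e ((a , ha) , (b , hb) , none) = (a , trans (cong (S a ∧_) (≡.sym (e a))) ha) ,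
        (b , trans (cong (λ x → S b ∧ not x) (≡.sym (e b))) hb) ,
        λ (u , w , h) → none (u , w , trans (cong₂ (λ x y → (S u ∧ x) ∧ (not y ∧ E u w)) (e u) (e w)) h)

    -- A set that splits is coloured part by part. No edge joins the parts, so propriety and the
    -- colour counts around a vertex depend on its own part only.
    odd-on : ∀ fuel S → ∑ (λ x → ⟦ S x ⟧) ≤ fuel → Closed S → OddOn S
    odd-on fuel S le closed = by fuel le (Finₚ.any? λ s → true? (S s)) (splits? S)
      where
      by : ∀ fuel → ∑ (λ x → ⟦ S x ⟧) ≤ fuel → Dec (∃ λ s → S s ≡ true) → Dec (∃ (Splits S)) → OddOn S
      by _ _ (no empty) _ = (λ _ → zero) , (λ x _ p → ⊥-elim (empty (x , p))) , λ v p → ⊥-elim (empty (v , p))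
      by _ _ (yes (s , s∈)) (no whole) = connected-odd S s s∈ closed λ X a b sa sb xa xb →
        case Finₚ.any? (λ u → Finₚ.any? λ w → true? ((S u ∧ X u) ∧ (not (X w) ∧ E u w))) of λ where
          (yes (u , w , h)) → u , w , ∧-elimˡ (∧-elimˡ h) , ∧-elimʳ {S u} (∧-elimˡ h) ,
            ¬true⇒false (not-elim (∧-elimˡ (∧-elimʳ {S u ∧ X u} h))) , ∧-elimʳ {not (X w)} (∧-elimʳ {S u ∧ X u} h)
          (no none) → ⊥-elim (whole (X , (a , ∧-intro sa xa) , (b , ∧-intro sb (cong not xb)) , none))
      by zero le (yes (s , s∈)) _ = case ℕₚ.≤-trans (∃-∑ {f = S} s s∈) le of λ ()
      by (suc fuel) le _ (yes (X , (a , ha) , (b , hb) , none)) = glue (odd-on fuel S₁ le₁ closed₁) (odd-on fuel S₂ le₂ closed₂)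
        where
        S₁ S₂ : V → Bool
        S₁ x = S x ∧ X x
        S₂ x = S x ∧ not (X x)
        less : ∀ a b → a + 1 ≤ b → b ≤ suc fuel → a ≤ fuel
        less a b h₁ h₂ = lin (h₁ ⊕ h₂) 0 (solve (a ∷ b ∷ fuel ∷ []))
        le₁ : ∑ (λ x → ⟦ S₁ x ⟧) ≤ fuel
        le₁ = less _ _ (∑-gap (λ x → true-≤ ∧-elimˡ) b (≤-resp₂ (cong (_+ 1) (⟦⟧-false λ h →
          not-elim (∧-elimʳ {S b} hb) (∧-elimʳ {S b} h))) (⟦⟧-true (∧-elimˡ hb)) ℕₚ.≤-refl)) le
        le₂ : ∑ (λ x → ⟦ S₂ x ⟧) ≤ fuel
        le₂ = less _ _ (∑-gap (λ x → true-≤ ∧-elimˡ) a (≤-resp₂ (cong (_+ 1) (⟦⟧-false λ h →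
          not-elim (∧-elimʳ {S a} h) (∧-elimʳ {S a} ha))) (⟦⟧-true (∧-elimˡ ha)) ℕₚ.≤-refl)) le
        crossing : ∀ x y → S x ≡ true → X x ≡ true → E x y ≡ true → ¬ (X y ≡ true) → ⊥
        crossing x y sx xx e ¬xy = none (x , y , ∧-intro (∧-intro sx xx) (∧-intro (not-intro ¬xy) e))
        X-closed : ∀ x y → S x ≡ true → E x y ≡ true → X x ≡ true → Dec (X y ≡ true) → X y ≡ true
        X-closed x y sx e xx (yes p) = p
        X-closed x y sx e xx (no ¬p) = ⊥-elim (crossing x y sx xx e ¬p)
        X-closed′ : ∀ x y → S x ≡ true → E x y ≡ true → X y ≡ true → X x ≡ true
        X-closed′ x y sx e xy = X-closed y x (closed x y sx e) (E-sym x y e) xy (true? (X x))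
        closed₁ : Closed S₁
        closed₁ x y h e = ∧-intro (closed x y (∧-elimˡ h) e) (X-closed x y (∧-elimˡ h) e (∧-elimʳ {S x} h) (true? (X y)))
        closed₂ : Closed S₂
        closed₂ x y h e = ∧-intro (closed x y (∧-elimˡ h) e)
          (not-intro λ p → not-elim (∧-elimʳ {S x} h) (X-closed′ x y (∧-elimˡ h) e p))
        same-side : ∀ x y → S x ≡ true → E x y ≡ true → X y ≡ X x
        same-side x y sx e = true-≡ (X-closed′ x y sx e) (λ p → X-closed x y sx e p (true? (X y)))
        glue : OddOn S₁ → OddOn S₂ → OddOn S
        glue (c₁ , p₁ , o₁) (c₂ , p₂ , o₂) = c , pr , od
          where
          pick : Bool → V → Fin 8
          pick true  = c₁
          pick false = c₂
          c : V → Fin 8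
          c x = pick (X x) x
          pr : ∀ x y → S x ≡ true → E x y ≡ true → c x ≢ c y
          pr x y sx e eq = side (X x) refl
            (trans eq (cong (λ b → pick b y) (same-side x y sx e)))
            where
            side : ∀ b → X x ≡ b → pick (X x) x ≡ pick (X x) y → ⊥
            side true  h q = p₁ x y (∧-intro sx h) e (subst (λ b → pick b x ≡ pick b y) h q)
            side false h q = p₂ x y (∧-intro sx (cong not h)) e (subst (λ b → pick b x ≡ pick b y) h q)
          od : ∀ v → S v ≡ true → (∃ λ u → E v u ≡ true) → ∃ λ i → odd (∑ λ u → ⟦ E v u ∧ c u == i ⟧) ≡ true
          od v sv nb = side (X v) refl
            where
            count-same : ∀ b → X v ≡ b → ∀ i → ∑ (λ u → ⟦ E v u ∧ c u == i ⟧) ≡ ∑ (λ u → ⟦ E v u ∧ pick b u == i ⟧)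
            count-same b h i = ∑-cong λ u → cong ⟦_⟧ (each u (true? (E v u)))
              where
              each : ∀ u → Dec (E v u ≡ true) → E v u ∧ c u == i ≡ E v u ∧ pick b u == i
              each u (yes e) = cong (λ b → E v u ∧ pick b u == i) (trans (same-side v u sv e) h)
              each u (no ¬e) = trans (cong (_∧ c u == i) (¬true⇒false ¬e)) (cong (_∧ pick b u == i) (≡.sym (¬true⇒false ¬e)))
            side : ∀ b → X v ≡ b → ∃ λ i → odd (∑ λ u → ⟦ E v u ∧ c u == i ⟧) ≡ true
            side true h  = let i , o = o₁ v (∧-intro sv h) nb in i , trans (cong odd (count-same true h i)) o
            side false h = let i , o = o₂ v (∧-intro sv (cong not h)) nb in i , trans (cong odd (count-same false h i)) o

theorem1 : (G : Graph) → Toroidal G → NoAdjacentTriangles G → HasOddColoring G 8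
theorem1 G (H , (refl , sub) , connH , rot , reps , isRot , isReps , bound) noadj =
  let c , proper , odds = odd-on (n H) (λ _ → true) (ℕₚ.≤-reflexive ∑-one) (λ _ _ _ _ → refl) in
  c , (λ u v → proper u v refl) , λ v nb → let i , o = odds v refl nb in
    i , odd⇒%2 (nbrsWithColour G c v i) (trans (cong odd (length-filter-tabulate (λ u → adj G v u ∧ c u == i) (λ u → u))) o)
  where
  open Components (adj G) (λ x y → trans (Graph.sym G y x)) noadj (rotationTorus H rot reps isRot isReps bound)
    (λ S a b _ _ → connH S a b) sub
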